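{- There are $n^{\min\{q,\Delta\}+O(1)}$-delay enumeration algorithms for Minimal Capacitated Vertex Cover Enumeration and Minimal Capacitated Dominating Set Enumeration, where the input is a graph $G$ with $n$ vertices together with a capacity function $c\colon V(G)\to\mathbb N$, $q=\max_{v\in V(G)}c(v)$, and $\Delta$ is the maximum degree of $G$.
   Context: Graphs are finite, undirected and simple; $\mathbb N$ includes $0$. A set $C\subseteq V(G)$ is a capacitated vertex cover of $(G,c)$ if there is a function $\alpha\colon E(G)\to C$ such that $\alpha(\{u,v\})\in\{u,v\}$ for every edge $\{u,v\}$ and $|\alpha^{ -1}(v)|\le c(v)$ for every $v\in C$. A set $D\subseteq V(G)$ is a capacitated dominating set of $(G,c)$ if there is a function $\beta\colon V(G)\setminus D\to D$ such that $\beta(v)$ is a neighbor of $v$ for every $v\in V(G)\setminus D$ and $|\beta^{ -1}(v)|\le c(v)$ for every $v\in D$. Minimality is with respect to inclusion of vertex sets. Minimal Capacitated Vertex Cover (respectively, Dominating Set) Enumeration is the problem of outputting, each exactly once, all minimal capacitated vertex covers (respectively, dominating sets) of $(G,c)$. An enumeration algorithm has delay $D$ (is a $D$-delay algorithm) if the time elapsed between every two consecutive outputs, including pre-processing and post-processing, is at most $D$. The constant hidden in $O(1)$ is absolute. -}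

module Defs where

open import Level using (0ℓ)
open import Data.Bool.Base using (Bool; true; false; T; if_then_else_)
open import Data.Bool.Properties using (T?)
open import Data.Fin.Base as Fin using (Fin)
import Data.Fin.Properties as Fin
open import Data.Fin.Subset using (Subset; _∈_; _∉_; _⊂_; _∩_; ∁; ∣_∣)
open import Data.List.Base
  using (List; []; _∷_; _++_; [_]; map; filter; length; lookup; allFin;
         cartesianProduct; cartesianProductWith)
open import Data.List.Extrema.Nat using (max)
import Data.List.Membership.Propositional as List
open import Data.List.Relation.Unary.Unique.Propositional using (Unique)
open import Data.Nat.Base using (ℕ; zero; suc; _+_; _∸_; _⊔_; _⊓_; _^_; _≤_)
import Data.Nat.Properties as ℕ
open import Data.Product.Base using (_×_; _,_; proj₁; proj₂; ∃-syntax)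
open import Data.Sum.Base using (_⊎_)
open import Data.Vec.Base using (tabulate; toList)
open import Function.Bundles using (_⇔_)
open import Relation.Binary.PropositionalEquality using (_≡_)
open import Relation.Nullary.Decidable using (does; _×-dec_)
open import Relation.Nullary.Negation using (¬_)
open import Relation.Unary using (Pred)

private
  variable
    m n : ℕ

record Graph (n : ℕ) : Set where
  field
    adj       : Fin n → Fin n → Bool
    symmetric : ∀ u v → adj u v ≡ adj v u
    loopless  : ∀ v → adj v v ≡ false

open Graph public

Adjacent : Graph n → Fin n → Fin n → Set
Adjacent G u v = T (adj G u v)

-- Each edge {u,v} is listed once, as the pair (u , v) with u < v.
edges : Graph n → List (Fin n × Fin n)
edges {n} G =
  filter (λ (u , v) → (u Fin.<? v) ×-dec T? (adj G u v))
         (cartesianProduct (allFin n) (allFin n))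

Edge : Graph n → Set
Edge G = Fin (length (edges G))

ends : (G : Graph n) → Edge G → Fin n × Fin n
ends G = lookup (edges G)

degree : Graph n → Fin n → ℕ
degree G v = ∣ tabulate (adj G v) ∣

maxDegree : Graph n → ℕ
maxDegree {n} G = max 0 (map (degree G) (allFin n))

Capacity : ℕ → Set
Capacity n = Fin n → ℕ

maxCapacity : Capacity n → ℕ
maxCapacity {n} c = max 0 (map c (allFin n))

preimage : (Fin m → Fin n) → Fin n → Subset m
preimage f v = tabulate (λ i → does (f i Fin.≟ v))

IsCapacitatedVertexCover : Graph n → Capacity n → Pred (Subset n) 0ℓ
IsCapacitatedVertexCover {n} G c C =
  ∃[ α ] (∀ (e : Edge G) → α e ∈ C)
       × (∀ e → α e ≡ proj₁ (ends G e) ⊎ α e ≡ proj₂ (ends G e))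
       × (∀ (v : Fin n) → v ∈ C → ∣ preimage α v ∣ ≤ c v)

-- β stands for a function on V(G) ∖ D: its values on D are never consulted.
IsCapacitatedDominatingSet : Graph n → Capacity n → Pred (Subset n) 0ℓ
IsCapacitatedDominatingSet {n} G c D =
  ∃[ β ] (∀ (v : Fin n) → v ∉ D → β v ∈ D)
       × (∀ v → v ∉ D → Adjacent G v (β v))
       × (∀ (w : Fin n) → w ∈ D → ∣ ∁ D ∩ preimage β w ∣ ≤ c w)

Minimal : Pred (Subset n) 0ℓ → Pred (Subset n) 0ℓ
Minimal P S = P S × (∀ S′ → S′ ⊂ S → ¬ P S′)

EnumerationProblem : Set₁
EnumerationProblem = ∀ {n} → Graph n → Capacity n → Pred (Subset n) 0ℓ

MinimalCapacitatedVertexCover : EnumerationProblem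
MinimalCapacitatedVertexCover G c = Minimal (IsCapacitatedVertexCover G c)

MinimalCapacitatedDominatingSet : EnumerationProblem
MinimalCapacitatedDominatingSet G c = Minimal (IsCapacitatedDominatingSet G c)

-- The model of computation is the uniform-cost random access machine: finitely
-- many registers (those a program mentions), a memory addressed indirectly,
-- addition and truncated subtraction, and structured control flow.  There is
-- no multiplication, so word lengths grow by at most one bit per step.

Reg : Set
Reg = ℕ

data Instr : Set where
  _≔_         : Reg → ℕ → Instr
  _≔_⊕_ _≔_⊖_ : Reg → Reg → Reg → Instr
  load        : Reg → Reg → Instr
  store       : Reg → Reg → Instr
  branch      : Reg → List Instr → List Instr → Instr
  while       : Reg → List Instr → Instr
  print       : Reg → Instr
  emit        : Instr

Program : Set
Program = List Instr

Word : Set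
Word = List ℕ

-- `control` is the stack of instructions still to be executed, and `buffer`
-- what has been printed since the last completed output.
record Config : Set where
  constructor ⟨_,_,_,_⟩
  field
    control : List Instr
    regs    : ℕ → ℕ
    memory  : ℕ → ℕ
    buffer  : Word

_[_↦_] : (ℕ → ℕ) → ℕ → ℕ → (ℕ → ℕ)
(f [ i ↦ a ]) j = if does (j ℕ.≟ i) then a else f j

data Outcome : Set where
  halted  : Outcome
  silent  : Config → Outcome
  emitted : Word → Config → Outcome

step : Config → Outcome
step ⟨ [] , R , M , b ⟩               = halted
step ⟨ (x ≔ a) ∷ k , R , M , b ⟩      = silent ⟨ k , R [ x ↦ a ] , M , b ⟩
step ⟨ (x ≔ y ⊕ z) ∷ k , R , M , b ⟩  = silent ⟨ k , R [ x ↦ R y + R z ] , M , b ⟩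
step ⟨ (x ≔ y ⊖ z) ∷ k , R , M , b ⟩  = silent ⟨ k , R [ x ↦ R y ∸ R z ] , M , b ⟩
step ⟨ load x y ∷ k , R , M , b ⟩     = silent ⟨ k , R [ x ↦ M (R y) ] , M , b ⟩
step ⟨ store x y ∷ k , R , M , b ⟩    = silent ⟨ k , R , M [ R x ↦ R y ] , b ⟩
step ⟨ branch x p q ∷ k , R , M , b ⟩ with R x
... | zero  = silent ⟨ q ++ k , R , M , b ⟩
... | suc _ = silent ⟨ p ++ k , R , M , b ⟩
step ⟨ while x p ∷ k , R , M , b ⟩ with R x
... | zero  = silent ⟨ k , R , M , b ⟩
... | suc _ = silent ⟨ p ++ while x p ∷ k , R , M , b ⟩
step ⟨ print x ∷ k , R , M , b ⟩      = silent ⟨ k , R , M , b ++ [ R x ] ⟩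
step ⟨ emit ∷ k , R , M , b ⟩         = emitted b ⟨ k , R , M , [] ⟩

data _⟶⟨_⟩_ : Config → ℕ → Config → Set where
  done : ∀ {κ} → κ ⟶⟨ 0 ⟩ κ
  more : ∀ {κ κ′ κ″ t} → step κ ≡ silent κ′ → κ′ ⟶⟨ t ⟩ κ″ → κ ⟶⟨ suc t ⟩ κ″

-- From the given configuration the machine emits exactly the given words, in
-- order, and halts; the time to the first output, between consecutive outputs,
-- and from the last output to halting is at most D.
data Emits (D : ℕ) : Config → List Word → Set where
  stop : ∀ {κ κ′ t} →
         κ ⟶⟨ t ⟩ κ′ → step κ′ ≡ halted → t ≤ D →
         Emits D κ []
  next : ∀ {κ κ′ κ″ t w ws} →
         κ ⟶⟨ t ⟩ κ′ → step κ′ ≡ emitted w κ″ → suc t ≤ D →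
         Emits D κ″ ws → Emits D κ (w ∷ ws)

bit : Bool → ℕ
bit b = if b then 1 else 0

-- n, then the adjacency matrix row by row, then the capacities (one word each).
encodeInput : Graph n → Capacity n → Word
encodeInput {n} G c =
  n ∷ map bit (cartesianProductWith (adj G) (allFin n) (allFin n))
    ++ map c (allFin n)

encodeSubset : Subset n → Word
encodeSubset S = map bit (toList S)

contents : Word → ℕ → ℕ
contents []       i       = 0
contents (a ∷ as) zero    = a
contents (a ∷ as) (suc i) = contents as i

initial : Program → Word → Config
initial p input = ⟨ p , (λ _ → 0) , contents input , [] ⟩

-- A program enumerates the problem with delay bounded by a function of the
-- input: each solution is output exactly once, and nothing else is output.
EnumeratesWithDelay :
  Program → EnumerationProblem → (∀ {n} → Graph n → Capacity n → ℕ) → Set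
EnumeratesWithDelay p Problem delay =
  ∀ {n} (G : Graph n) (c : Capacity n) →
  ∃[ solutions ] Unique solutions
               × (∀ S → S List.∈ solutions ⇔ Problem G c S)
               × Emits (delay G c) (initial p (encodeInput G c))
                       (map encodeSubset solutions)

-- n ^ (min{q, Δ} + k).  The base is kept at least 2: for n ≤ 1 the literal
-- power would be 0 or 1, leaving no time even to print the output.
delayBound : ℕ → Graph n → Capacity n → ℕ
delayBound {n} k G c = (n ⊔ 2) ^ ((maxCapacity c ⊓ maxDegree G) + k)

{-# OPTIONS --safe #-}

-- Both problems ask for the inclusion-minimal sets S for which all "jobs" (the
-- edges, respectively the vertices) can be matched to slots owned by members of
-- S.  Let r = min {q, Δ}.  As no vertex w ever serves more than min {c w, r}
-- jobs, it suffices to give it min {c w, r + 1} slots, respectively min {c w, r}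
-- slots and one for itself.  Feasibility of S is upward closed and is tested by
-- an auction algorithm for bipartite matching.
--
-- The minimal sets are found by breadth-first search.  From a solution X, remove
-- a vertex v and add r + 1 vertices in all n ^ (r + 1) ways; each feasible result
-- is shrunk greedily to a minimal solution.  If Y is another solution and v lies
-- in X but not in Y, then at most r + 1 jobs lose their slot when v is removed, and
-- alternating paths towards the matching of Y place them again using at most
-- r + 1 vertices of Y.  The solution obtained has fewer vertices outside Y than
-- X, so the search reaches Y.  A solution is output when it is taken from the
-- queue, so the delay is the time spent on one solution; repetitions are avoided
-- by marking the binary code of every solution found as a memory address.

module Submission where

open import Defs
open import Data.Bool.Base using (Bool; true; false; T; if_then_else_; _∨_)
import Data.Bool.Properties as Bool
open import Data.Bool.Properties using (T?)
open import Data.Empty using (⊥)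
open import Data.Fin using (#_)
open import Data.Fin.Base as Fin using (Fin; zero; suc; toℕ; fromℕ<; combine; remQuot)
import Data.Fin.Properties as Fin
open import Data.Fin.Subset using (Subset; _∈_; _∉_; _⊆_; _∩_; ∁; ∣_∣)
import Data.Fin.Subset.Properties as Subset
open import Data.List.Base
  using (List; []; _∷_; _++_; [_]; map; length; allFin; cartesianProduct;
         cartesianProductWith; mapMaybe; applyUpTo)
import Data.List.Base as List using (lookup; tabulate)
open import Data.List.Extrema.Nat using (max)
import Data.List.Extrema.Nat as Extrema
import Data.List.Membership.Propositional as List
import Data.List.Membership.Propositional.Properties as List
import Data.List.Properties as List
open import Data.List.Relation.Unary.All using ([]; _∷_)
import Data.List.Relation.Unary.All as All
open import Data.List.Relation.Unary.AllPairs using ([]; _∷_)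
open import Data.List.Relation.Unary.Any using (here; there)
import Data.List.Relation.Unary.Any as Any
import Data.List.Relation.Unary.Any.Properties as Any
open import Data.List.Relation.Unary.Unique.Propositional using (Unique)
import Data.List.Relation.Unary.Unique.Propositional.Properties as Unique
open import Data.Maybe.Base using (Maybe; just; nothing)
import Data.Maybe.Properties as Maybe
open import Data.Nat.Base
  using (ℕ; zero; suc; pred; _+_; _*_; _∸_; _⊔_; _⊓_; _^_; _≤_; _<_; z≤n; s≤s;
         s≤s⁻¹; >-nonZero; _≡ᵇ_)
open import Data.Nat.DivMod using (_%_; [m+kn]%n≡m%n; m<n⇒m%n≡m)
import Data.Nat.Properties as ℕ
open import Data.Nat.Solver using (module +-*-Solver)
open import Data.Product.Base using (_×_; _,_; proj₁; proj₂; ∃-syntax; Σ-syntax)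
import Data.Product.Properties as Product
open import Data.Sum.Base using (_⊎_; inj₁; inj₂)
open import Data.Unit.Base using (⊤; tt)
open import Data.Vec.Base using (Vec; []; _∷_; lookup; tabulate; _[_]≔_)
import Data.Vec.Base as Vec using (here; there)
import Data.Vec.Properties as Vec
open import Function.Base using (_∘_; id; case_of_)
open import Function.Bundles using (_⇔_; mk⇔; Equivalence)
open import Relation.Binary.Definitions using (tri<; tri≈; tri>)
open import Relation.Binary.PropositionalEquality
  using (_≡_; _≢_; refl; sym; trans; cong; cong₂; subst; subst₂)
open import Relation.Nullary.Decidable using (Dec; yes; no; does; dec-true; dec-false; _×-dec_)
import Relation.Nullary.Decidable as Dec
open import Relation.Nullary.Negation using (¬_; contradiction)

-- A language with bounded loops and its compilation

-- The bound concerns a concrete machine program, and `min {q, Δ}` must enter its exponent with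
-- coefficient exactly 1. So running times are never followed along executions. In compiled commands
-- every loop and every multiplication is bounded by a parameter fixed during the setup; hence the
-- cost of a command is a function of its text and of the parameters, and a bound `b ^ (k + d * r)`
-- is computed by recursion on the text. Only the parameter `n ^ (r + 1)` has `r` in its exponent,
-- and it bounds a single loop of the whole program. An auction fits this discipline, since it
-- repeats one local step: with N slots no price exceeds N, and every successful bid raises the sum
-- of the prices by one, so N² + 1 repetitions suffice for a job. Capacities may be arbitrarily
-- large numbers. Cutting them down to at most r + 1 ≤ n + 1 slots per vertex bounds both the
-- running time of a test and the number of jobs stranded when a vertex is removed; the latter is
-- what makes tuples of r + 1 vertices enough.

-- The registers hold the variables of a program, its read-only parameters, and
-- scratch values for evaluating expressions and counting loops.
data Cell : Set where
  variable′ parameter scratch : ℕ → Cell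

-- The residues modulo 3 yield three unbounded families of registers that never collide.
cell : Cell → Reg
cell (variable′ x) = x * 3
cell (parameter p) = suc (p * 3)
cell (scratch d)   = suc (suc (d * 3))

nextCell : Cell → Cell
nextCell (variable′ x) = variable′ (suc x)
nextCell (parameter p) = parameter (suc p)
nextCell (scratch d)   = scratch (suc d)

-- A left inverse of `cell`, recursing in steps of three so that both sides compute and injectivity
-- requires no arithmetic.
uncell : ℕ → Cell
uncell 0                   = variable′ 0
uncell 1                   = parameter 0
uncell 2                   = scratch 0
uncell (suc (suc (suc r))) = nextCell (uncell r)

uncell-cell : ∀ a → uncell (cell a) ≡ a
uncell-cell (variable′ zero)    = refl
uncell-cell (variable′ (suc x)) = cong nextCell (uncell-cell (variable′ x))
uncell-cell (parameter zero)    = refl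
uncell-cell (parameter (suc x)) = cong nextCell (uncell-cell (parameter x))
uncell-cell (scratch zero)      = refl
uncell-cell (scratch (suc x))   = cong nextCell (uncell-cell (scratch x))

cell-injective : ∀ {a b} → cell a ≡ cell b → a ≡ b
cell-injective {a} {b} eq =
  trans (sym (uncell-cell a)) (trans (cong uncell eq) (uncell-cell b))

[↦]-same : ∀ (f : ℕ → ℕ) i a → (f [ i ↦ a ]) i ≡ a
[↦]-same f i a rewrite dec-true (i ℕ.≟ i) refl = refl

[↦]-other : ∀ (f : ℕ → ℕ) {i j} a → j ≢ i → (f [ i ↦ a ]) j ≡ f j
[↦]-other f {i} {j} a j≢i rewrite dec-false (j ℕ.≟ i) j≢i = refl

cell-other : ∀ (f : ℕ → ℕ) {a b} v → a ≢ b → (f [ cell b ↦ v ]) (cell a) ≡ f (cell a)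
cell-other f v a≢b = [↦]-other f v (a≢b ∘ cell-injective)

-- A power of two: the machine cannot multiply, but four doublings scale an index by 16.
Array : Set
Array = Fin 16

infixl 6 _⊞_ _⊟_
infixl 7 _⊠_
infixl 8 _⟦_⟧
infix  5 _←_ _⟦_⟧←_
infixr 4 _⨾_

-- In p ⊠ e and in loop x p c, the number p is the index of a parameter; hence
-- costs depend on the parameters only.
data Expr : Set where
  lit     : ℕ → Expr
  var par : ℕ → Expr
  _⊞_ _⊟_ : Expr → Expr → Expr
  _⊠_     : ℕ → Expr → Expr
  _⟦_⟧    : Array → Expr → Expr
  input   : Expr → Expr

data Cmd : Set where
  skip     : Cmd
  _←_     : ℕ → Expr → Cmd
  _⟦_⟧←_  : Array → Expr → Expr → Cmd
  _⨾_      : Cmd → Cmd → Cmd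
  ifₑ      : Expr → Cmd → Cmd → Cmd
  loop     : ℕ → ℕ → Cmd → Cmd
  out      : Expr → Cmd

when : Expr → Cmd → Cmd
when e c = ifₑ e c skip

record State : Set where
  no-eta-equality
  pattern
  constructor state
  field
    reg     : ℕ → ℕ
    arr     : Array → ℕ → ℕ
    written : Word

open State public

setReg : ℕ → ℕ → State → State
setReg x a s = state (reg s [ x ↦ a ]) (arr s) (written s)

setArr : Array → ℕ → ℕ → State → State
setArr i a v s =
  state (reg s) (λ j → if does (j Fin.≟ i) then arr s j [ a ↦ v ] else arr s j) (written s)

nonzero : ℕ → Bool
nonzero zero    = false
nonzero (suc _) = true

-- Unfolds at the last pass, so that an invariant of the first `k` passes is proved by recursion on
-- `k`.
iterate : ℕ → (ℕ → State → State) → State → State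
iterate zero    f s = s
iterate (suc k) f s = f k (iterate k f s)

module Semantics (inp ρ : ℕ → ℕ) where

  eval : Expr → State → ℕ
  eval (lit a)   s = a
  eval (var x)   s = reg s x
  eval (par p)   s = ρ p
  eval (e ⊞ e′)  s = eval e s + eval e′ s
  eval (e ⊟ e′)  s = eval e s ∸ eval e′ s
  eval (p ⊠ e)   s = ρ p * eval e s
  eval (i ⟦ e ⟧) s = arr s i (eval e s)
  eval (input e) s = inp (eval e s)

  run : Cmd → State → State
  run skip             s = s
  run (x ← e)         s = setReg x (eval e s) s
  run (i ⟦ e ⟧← e′)   s = setArr i (eval e s) (eval e′ s) s
  run (c ⨾ c′)         s = run c′ (run c s)
  run (ifₑ e c c′)     s = if nonzero (eval e s) then run c s else run c′ s
  run (loop x p c)     s = iterate (ρ p) (λ k s′ → run c (setReg x k s′)) s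
  run (out e)          s = state (reg s) (arr s) (written s ++ [ eval e s ])

-- Compilation to machine instructions

compileAddress : Array → ℕ → List Instr
compileAddress i d =
  (cell (scratch d) ≔ cell (scratch d) ⊕ cell (scratch d)) ∷
  (cell (scratch d) ≔ cell (scratch d) ⊕ cell (scratch d)) ∷
  (cell (scratch d) ≔ cell (scratch d) ⊕ cell (scratch d)) ∷
  (cell (scratch d) ≔ cell (scratch d) ⊕ cell (scratch d)) ∷
  (cell (scratch (suc d)) ≔ toℕ i) ∷
  (cell (scratch d) ≔ cell (scratch d) ⊕ cell (scratch (suc d))) ∷
  (cell (scratch d) ≔ cell (scratch d) ⊕ cell (parameter 1)) ∷ []

copy : Cell → Cell → List Instr
copy a b = (cell a ≔ 0) ∷ (cell a ≔ cell a ⊕ cell b) ∷ []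

addRepeatedly : Cell → Cell → Cell → Cell → Instr
addRepeatedly acc a counter one =
  while (cell counter)
    ((cell acc ≔ cell acc ⊕ cell a) ∷ (cell counter ≔ cell counter ⊖ cell one) ∷ [])

-- The value of the expression is left in scratch d, and no scratch register
-- below d is changed.
compileExpr : Expr → ℕ → List Instr
compileExpr (lit a)  d = (cell (scratch d) ≔ a) ∷ []
compileExpr (var x)  d = copy (scratch d) (variable′ x)
compileExpr (par p)  d = copy (scratch d) (parameter p)
compileExpr (e ⊞ e′) d =
  compileExpr e d ++ compileExpr e′ (suc d) ++
  (cell (scratch d) ≔ cell (scratch d) ⊕ cell (scratch (suc d))) ∷ []
compileExpr (e ⊟ e′) d =
  compileExpr e d ++ compileExpr e′ (suc d) ++
  (cell (scratch d) ≔ cell (scratch d) ⊖ cell (scratch (suc d))) ∷ []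
compileExpr (p ⊠ e) d =
  compileExpr e (suc d) ++ ((cell (scratch d) ≔ 0) ∷ []) ++
  copy (scratch (2 + d)) (parameter p) ++ ((cell (scratch (3 + d)) ≔ 1) ∷ []) ++
  addRepeatedly (scratch d) (scratch (suc d)) (scratch (2 + d)) (scratch (3 + d)) ∷ []
compileExpr (i ⟦ e ⟧) d =
  compileExpr e d ++ compileAddress i d ++ load (cell (scratch d)) (cell (scratch d)) ∷ []
compileExpr (input e) d =
  compileExpr e d ++ (cell (scratch (suc d)) ≔ cell (parameter 1) ⊖ cell (scratch d)) ∷
  branch (cell (scratch (suc d)))
    (load (cell (scratch d)) (cell (scratch d)) ∷ []) ((cell (scratch d) ≔ 0) ∷ []) ∷ []

-- A loop keeps two counters of its own in scratch registers, one running down for the test and one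
-- running up to supply `x`; its body is compiled above both. The body may thus overwrite `x`
-- without changing the number of passes.
compile : Cmd → ℕ → List Instr
compile skip           d = []
compile (x ← e)       d = compileExpr e d ++ copy (variable′ x) (scratch d)
compile (i ⟦ e ⟧← e′) d =
  compileExpr e d ++ compileAddress i d ++ compileExpr e′ (suc d) ++
  store (cell (scratch d)) (cell (scratch (suc d))) ∷ []
compile (c ⨾ c′)       d = compile c d ++ compile c′ d
compile (ifₑ e c c′)   d =
  compileExpr e d ++ branch (cell (scratch d)) (compile c d) (compile c′ d) ∷ []
compile (loop x p c)   d =
  copy (scratch d) (parameter p) ++ ((cell (scratch (suc d)) ≔ 0) ∷ []) ++
  while (cell (scratch d))
    (copy (variable′ x) (scratch (suc d)) ++ ((cell (scratch (2 + d)) ≔ 1) ∷ []) ++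
     ((cell (scratch (suc d)) ≔ cell (scratch (suc d)) ⊕ cell (scratch (2 + d))) ∷ []) ++
     ((cell (scratch d) ≔ cell (scratch d) ⊖ cell (scratch (2 + d))) ∷ []) ++
     compile c (2 + d)) ∷ []
compile (out e)        d = compileExpr e d ++ print (cell (scratch d)) ∷ []

-- Timed execution of code fragments

record Machine : Set where
  constructor machine
  field
    regs   : ℕ → ℕ
    memory : ℕ → ℕ
    buffer : Word

open Machine

config : List Instr → Machine → Config
config k (machine R M b) = ⟨ k , R , M , b ⟩

infixr 5 _▷_
_▷_ : ∀ {κ κ′ κ″ t t′} → κ ⟶⟨ t ⟩ κ′ → κ′ ⟶⟨ t′ ⟩ κ″ → κ ⟶⟨ t + t′ ⟩ κ″
done      ▷ q = q
more eq p ▷ q = more eq (p ▷ q)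

-- Total correctness with a time bound. Control is a stack, so fragments compose once each is known
-- to run in the same way above every continuation `k`.
record Exec (p : List Instr) (t : ℕ) (σ : Machine) (Q : Machine → Set) : Set where
  constructor exec
  field
    {time}  : ℕ
    time≤   : time ≤ t
    {final} : Machine
    steps   : ∀ k → config (p ++ k) σ ⟶⟨ time ⟩ config k final
    post    : Q final

exec-[] : ∀ {σ Q} → Q σ → Exec [] 0 σ Q
exec-[] q = exec z≤n (λ k → done) q

exec-≤ : ∀ {p t t′ σ} {Q Q′ : Machine → Set} → t ≤ t′ → (∀ σ′ → Q σ′ → Q′ σ′) →
         Exec p t σ Q → Exec p t′ σ Q′
exec-≤ t≤t′ f (exec le st q) = exec (ℕ.≤-trans le t≤t′) st (f _ q)

exec-map : ∀ {p t σ} {Q Q′ : Machine → Set} → (∀ σ′ → Q σ′ → Q′ σ′) →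
           Exec p t σ Q → Exec p t σ Q′
exec-map = exec-≤ ℕ.≤-refl

infixr 4 _⟫_
_⟫_ : ∀ {p q t t′ σ} {Q Q′ : Machine → Set} → Exec p t σ Q →
      (∀ {σ′} → Q σ′ → Exec q t′ σ′ Q′) → Exec (p ++ q) (t + t′) σ Q′
_⟫_ {p} {q} {σ = σ} (exec le st post) f with f post
... | exec le′ st′ post′ =
  exec (ℕ.+-mono-≤ le le′)
       (λ k → subst (λ r → config r σ ⟶⟨ _ ⟩ _) (sym (List.++-assoc p q k)) (st (q ++ k) ▷ st′ k))
       post′

record Changed (x : Cell) (v : ℕ) (σ σ′ : Machine) : Set where
  constructor changed
  field
    value   : regs σ′ (cell x) ≡ v
    others  : ∀ a → a ≢ x → regs σ′ (cell a) ≡ regs σ (cell a)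
    memory≡ : memory σ′ ≡ memory σ
    buffer≡ : buffer σ′ ≡ buffer σ

changed-by : ∀ x v {R M b} → Changed x v (machine R M b) (machine (R [ cell x ↦ v ]) M b)
changed-by x v {R} = changed ([↦]-same R (cell x) v) (λ a a≢x → cell-other R v a≢x) refl refl

exec-≔ : ∀ x a {σ} → Exec ((cell x ≔ a) ∷ []) 1 σ (Changed x a σ)
exec-≔ x a {machine R M b} = exec ℕ.≤-refl (λ k → more refl done) (changed-by x a)

exec-⊕ : ∀ x y z {a b σ} → regs σ (cell y) ≡ a → regs σ (cell z) ≡ b →
         Exec ((cell x ≔ cell y ⊕ cell z) ∷ []) 1 σ (Changed x (a + b) σ)
exec-⊕ x y z {σ = machine R M b} refl refl = exec ℕ.≤-refl (λ k → more refl done) (changed-by x _)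

exec-⊖ : ∀ x y z {a b σ} → regs σ (cell y) ≡ a → regs σ (cell z) ≡ b →
         Exec ((cell x ≔ cell y ⊖ cell z) ∷ []) 1 σ (Changed x (a ∸ b) σ)
exec-⊖ x y z {σ = machine R M b} refl refl = exec ℕ.≤-refl (λ k → more refl done) (changed-by x _)

exec-load : ∀ x y {a σ} → regs σ (cell y) ≡ a →
            Exec (load (cell x) (cell y) ∷ []) 1 σ (Changed x (memory σ a) σ)
exec-load x y {σ = machine R M b} refl = exec ℕ.≤-refl (λ k → more refl done) (changed-by x _)

changed-trans : ∀ {x v w σ σ′ σ″} → Changed x v σ σ′ → Changed x w σ′ σ″ → Changed x w σ σ″
changed-trans (changed _ o m b) (changed v′ o′ m′ b′) =
  changed v′ (λ a ne → trans (o′ a ne) (o a ne)) (trans m′ m) (trans b′ b)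

exec-copy : ∀ {x y a σ} → y ≢ x → regs σ (cell y) ≡ a →
            Exec (copy x y) 2 σ (Changed x a σ)
exec-copy {x} {y} y≢x eq =
  exec-≔ x 0 ⟫ λ ch →
  exec-map (λ _ → changed-trans ch)
    (exec-⊕ x x y (Changed.value ch) (trans (Changed.others ch y y≢x) eq))

branch-zero : ∀ {x p q k R M b} → R x ≡ 0 →
              step ⟨ branch x p q ∷ k , R , M , b ⟩ ≡ silent ⟨ q ++ k , R , M , b ⟩
branch-zero eq rewrite eq = refl

branch-suc : ∀ {x p q k R M b a} → R x ≡ suc a →
             step ⟨ branch x p q ∷ k , R , M , b ⟩ ≡ silent ⟨ p ++ k , R , M , b ⟩
branch-suc eq rewrite eq = refl

while-zero : ∀ {x p k R M b} → R x ≡ 0 →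
             step ⟨ while x p ∷ k , R , M , b ⟩ ≡ silent ⟨ k , R , M , b ⟩
while-zero eq rewrite eq = refl

while-suc : ∀ {x p k R M b a} → R x ≡ suc a →
            step ⟨ while x p ∷ k , R , M , b ⟩ ≡ silent ⟨ p ++ while x p ∷ k , R , M , b ⟩
while-suc eq rewrite eq = refl

-- The bound adds both branches instead of taking their maximum, so that costs are built from sums
-- and products alone.
exec-branch : ∀ {x p q t t′ σ Q} →
              (regs σ x ≢ 0 → Exec p t σ Q) → (regs σ x ≡ 0 → Exec q t′ σ Q) →
              Exec (branch x p q ∷ []) (suc (t + t′)) σ Q
exec-branch {x} {p} {q} {t} {t′} {machine R M b} f g with R x in eq
... | zero  = let exec le st post = g refl in
  exec (s≤s (ℕ.≤-trans le (ℕ.m≤n+m t′ t))) (λ k → more (branch-zero {x} {p} {q} eq) (st k)) post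
... | suc a = let exec le st post = f (λ ()) in
  exec (s≤s (ℕ.≤-trans le (ℕ.m≤m+n t t′))) (λ k → more (branch-suc {x} {p} {q} eq) (st k)) post

exec-while : ∀ {x p t} (I : ℕ → Machine → Set) →
             (∀ {m σ} → I m σ → regs σ x ≡ m) →
             (∀ {m σ} → I (suc m) σ → Exec p t σ (I m)) →
             ∀ m {σ} → I m σ → Exec (while x p ∷ []) (suc (m * suc t)) σ (I 0)
exec-while {x} {p} I reads body zero {machine R M b} i =
  exec (s≤s z≤n) (λ k → more (while-zero {x} {p} (reads i)) done) i
exec-while {x} {p} {t} I reads body (suc m) {σ@(machine R M b)} i =
  let exec le st i′ = body i
      exec le′ st′ i″ = exec-while I reads body m i′
  in exec (s≤s (ℕ.≤-trans (ℕ.+-mono-≤ le le′)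
                          (ℕ.≤-reflexive (ℕ.+-suc t (m * suc t)))))
          (λ k → more (while-suc {x} {p} (reads i)) (st (while x p ∷ k) ▷ st′ k)) i″

exec-addRepeatedly : ∀ {acc a counter one} →
  a ≢ acc → counter ≢ acc → one ≢ acc → a ≢ counter → acc ≢ counter → one ≢ counter →
  ∀ m {u v σ} → regs σ (cell acc) ≡ u → regs σ (cell a) ≡ v →
  regs σ (cell counter) ≡ m → regs σ (cell one) ≡ 1 →
  Exec (addRepeatedly acc a counter one ∷ []) (suc (m * 3)) σ
    (λ σ′ → regs σ′ (cell acc) ≡ u + m * v
          × (∀ b → b ≢ acc → b ≢ counter → regs σ′ (cell b) ≡ regs σ (cell b))
          × memory σ′ ≡ memory σ × buffer σ′ ≡ buffer σ)
exec-addRepeatedly {acc} {a} {counter} {one} a≢acc c≢acc o≢acc a≢c acc≢c o≢c m {u} {v} {σ} hacc ha hc ho =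
  exec-map finish (exec-while Inv (proj₁ ∘ proj₂) body m
    (cong (_+ m * v) hacc , hc , (λ b _ _ → refl) , refl , refl))
  where
  Inv : ℕ → Machine → Set
  Inv k σ′ = regs σ′ (cell acc) + k * v ≡ u + m * v × regs σ′ (cell counter) ≡ k
           × (∀ b → b ≢ acc → b ≢ counter → regs σ′ (cell b) ≡ regs σ (cell b))
           × memory σ′ ≡ memory σ × buffer σ′ ≡ buffer σ
  finish : ∀ σ′ → Inv 0 σ′ → _
  finish σ′ (i , _ , o , me , bu) = trans (sym (ℕ.+-identityʳ _)) i , o , me , bu
  body : ∀ {k σ′} → Inv (suc k) σ′ → Exec _ 2 σ′ (Inv k)
  body {k} {σ′} (i , c , o , me , bu) =
    exec-⊕ acc acc a refl (trans (o a a≢acc a≢c) ha) ⟫ λ ch →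
    exec-map (λ σ″ ch′ →
        trans (cong (_+ k * v) (trans (Changed.others ch′ acc acc≢c) (Changed.value ch)))
              (trans (ℕ.+-assoc _ v (k * v)) i)
      , Changed.value ch′
      , (λ b b≢acc b≢c → trans (Changed.others ch′ b b≢c) (trans (Changed.others ch b b≢acc) (o b b≢acc b≢c)))
      , trans (Changed.memory≡ ch′) (trans (Changed.memory≡ ch) me)
      , trans (Changed.buffer≡ ch′) (trans (Changed.buffer≡ ch) bu))
      (exec-⊖ counter counter one (trans (Changed.others ch counter c≢acc) c)
        (trans (Changed.others ch one o≢acc) (trans (o one o≢acc o≢c) ho)))

-- Variables and parameters count as below every depth; `Agree d` therefore protects them together
-- with the scratch registers below `d`.
Below : ℕ → Cell → Set
Below d (variable′ x) = ⊤
Below d (parameter p) = ⊤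
Below d (scratch e)   = e < d

below-≤ : ∀ {d e} → d ≤ e → ∀ a → Below d a → Below e a
below-≤ d≤e (variable′ x) b = tt
below-≤ d≤e (parameter p) b = tt
below-≤ d≤e (scratch x)   b = ℕ.≤-trans b d≤e

below⇒≢ : ∀ {d e} → d ≤ e → ∀ {a} → Below d a → a ≢ scratch e
below⇒≢ d≤e b refl = ℕ.<-irrefl refl (ℕ.≤-trans b d≤e)

record Agree (d : ℕ) (σ σ′ : Machine) : Set where
  constructor agree
  field
    below   : ∀ a → Below d a → regs σ′ (cell a) ≡ regs σ (cell a)
    memory≡ : memory σ′ ≡ memory σ
    buffer≡ : buffer σ′ ≡ buffer σ

agree-trans : ∀ {d σ σ′ σ″} → Agree d σ σ′ → Agree d σ′ σ″ → Agree d σ σ″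
agree-trans (agree b m o) (agree b′ m′ o′) =
  agree (λ a p → trans (b′ a p) (b a p)) (trans m′ m) (trans o′ o)

agree-≤ : ∀ {d e σ σ′} → d ≤ e → Agree e σ σ′ → Agree d σ σ′
agree-≤ d≤e (agree b m o) = agree (λ a p → b a (below-≤ d≤e a p)) m o

changed⇒agree : ∀ {d e v σ σ′} → d ≤ e → Changed (scratch e) v σ σ′ → Agree d σ σ′
changed⇒agree d≤e (changed _ o m b) = agree (λ a p → o a (below⇒≢ d≤e p)) m b

-- The arrays are interleaved with stride 16 above the input, which ends before `B`; this leaves
-- every array unbounded.
address : ℕ → Array → ℕ → ℕ
address B i a = a * 16 + toℕ i + B

exec-address : ∀ i d {a B σ} → regs σ (cell (scratch d)) ≡ a →
  regs σ (cell (parameter 1)) ≡ B →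
  Exec (compileAddress i d) 7 σ
    (λ σ′ → regs σ′ (cell (scratch d)) ≡ address B i a × Agree d σ σ′)
exec-address i d {a} {B} ha hB =
  exec-⊕ D D D ha ha ⟫ λ c₁ →
  exec-⊕ D D D (value c₁) (value c₁) ⟫ λ c₂ →
  exec-⊕ D D D (value c₂) (value c₂) ⟫ λ c₃ →
  exec-⊕ D D D (value c₃) (value c₃) ⟫ λ c₄ →
  exec-≔ D′ (toℕ i) ⟫ λ c₅ →
  exec-⊕ D D D′ (trans (others c₅ D (λ eq → ℕ.m≢1+n+m d {0} (scratch-injective eq))) (value c₄)) (value c₅) ⟫ λ c₆ →
  let ag = agree-trans (changed⇒agree ℕ.≤-refl c₁) (agree-trans (changed⇒agree ℕ.≤-refl c₂)
           (agree-trans (changed⇒agree ℕ.≤-refl c₃) (agree-trans (changed⇒agree ℕ.≤-refl c₄)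
           (agree-trans (changed⇒agree (ℕ.n≤1+n d) c₅) (changed⇒agree ℕ.≤-refl c₆)))))
  in exec-map (λ σ′ c₇ → trans (value c₇) (cong (λ z → z + toℕ i + B) (times16 a))
                       , agree-trans ag (changed⇒agree ℕ.≤-refl c₇))
       (exec-⊕ D D (parameter 1) (value c₆) (trans (Agree.below ag (parameter 1) tt) hB))
  where
  open Changed
  D  = scratch d
  D′ = scratch (suc d)
  scratch-injective : ∀ {x y} → scratch x ≡ scratch y → x ≡ y
  scratch-injective refl = refl
  times16 : ∀ a → a + a + (a + a) + (a + a + (a + a)) +
                  (a + a + (a + a) + (a + a + (a + a))) ≡ a * 16
  times16 = solve 1 (λ a → a :+ a :+ (a :+ a) :+ (a :+ a :+ (a :+ a)) :+
                  (a :+ a :+ (a :+ a) :+ (a :+ a :+ (a :+ a))) := a :* con 16) refl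
    where open +-*-Solver

address-injective : ∀ {B i j a b} → address B i a ≡ address B j b → i ≡ j × a ≡ b
address-injective {B} {i} {j} {a} {b} eq with 
  Fin.toℕ-injective (trans (sym (rem i a)) (trans (cong (_% 16) (ℕ.+-cancelʳ-≡ B (a * 16 + toℕ i) (b * 16 + toℕ j) eq)) (rem j b)))
  where
  rem : ∀ (i : Array) a → (a * 16 + toℕ i) % 16 ≡ toℕ i
  rem i a = trans (cong (_% 16) (ℕ.+-comm (a * 16) (toℕ i)))
                  (trans ([m+kn]%n≡m%n (toℕ i) a 16) (m<n⇒m%n≡m (Fin.toℕ<n i)))
... | refl = refl , ℕ.*-cancelʳ-≡ a b 16 (ℕ.+-cancelʳ-≡ (toℕ i) _ _ (ℕ.+-cancelʳ-≡ B _ _ eq))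

-- Correctness and cost of compiled commands

module Simulation (inp ρ : ℕ → ℕ) (inp-outside : ∀ y → ρ 1 ≤ y → inp y ≡ 0) where

  open Semantics inp ρ

  record Sim (σ : Machine) (s : State) : Set where
    constructor sim
    field
      variables  : ∀ x → regs σ (cell (variable′ x)) ≡ reg s x
      parameters : ∀ p → regs σ (cell (parameter p)) ≡ ρ p
      arrays     : ∀ i a → memory σ (address (ρ 1) i a) ≡ arr s i a
      inputs     : ∀ y → y < ρ 1 → memory σ y ≡ inp y
      outputs    : buffer σ ≡ written s

  open Sim

  sim-agree : ∀ {d σ σ′ s} → Agree d σ σ′ → Sim σ s → Sim σ′ s
  sim-agree (agree b m o) h = sim
    (λ x → trans (b (variable′ x) tt) (variables h x))
    (λ p → trans (b (parameter p) tt) (parameters h p))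
    (λ i a → trans (cong (λ f → f (address (ρ 1) i a)) m) (arrays h i a))
    (λ y y<B → trans (cong (λ f → f y) m) (inputs h y y<B))
    (trans o (outputs h))

  -- The sums are associated as `_⟫_` produces them, so the bounds in the correctness proof agree by
  -- computation.
  costExpr : Expr → ℕ
  costExpr (lit a)   = 1
  costExpr (var x)   = 2
  costExpr (par p)   = 2
  costExpr (e ⊞ e′)  = costExpr e + (costExpr e′ + 1)
  costExpr (e ⊟ e′)  = costExpr e + (costExpr e′ + 1)
  costExpr (p ⊠ e)   = costExpr e + (1 + (2 + (1 + suc (ρ p * 3))))
  costExpr (i ⟦ e ⟧) = costExpr e + (7 + 1)
  costExpr (input e) = costExpr e + (1 + 3)

  exec-compileExpr : ∀ e d {σ s} → Sim σ s →
    Exec (compileExpr e d) (costExpr e) σ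
      (λ σ′ → regs σ′ (cell (scratch d)) ≡ eval e s × Agree d σ σ′)

  exec-operands : ∀ {Q} {p} {t} e e′ d {σ s} → Sim σ s →
    (∀ {σ′} → regs σ′ (cell (scratch d)) ≡ eval e s →
       regs σ′ (cell (scratch (suc d))) ≡ eval e′ s → Agree d σ σ′ → Exec p t σ′ Q) →
    Exec (compileExpr e d ++ compileExpr e′ (suc d) ++ p) (costExpr e + (costExpr e′ + t)) σ Q
  exec-operands e e′ d h f =
    exec-compileExpr e d h ⟫ λ (v , ag) →
    exec-compileExpr e′ (suc d) (sim-agree ag h) ⟫ λ (v′ , ag′) →
    f (trans (Agree.below ag′ (scratch d) ℕ.≤-refl) v) v′
      (agree-trans ag (agree-≤ (ℕ.n≤1+n d) ag′))

  exec-compileExpr (lit a) d h =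
    exec-map (λ _ c → Changed.value c , changed⇒agree ℕ.≤-refl c) (exec-≔ (scratch d) a)
  exec-compileExpr (var x) d h =
    exec-map (λ _ c → Changed.value c , changed⇒agree ℕ.≤-refl c)
      (exec-copy {scratch d} {variable′ x} (λ ()) (variables h x))
  exec-compileExpr (par p) d h =
    exec-map (λ _ c → Changed.value c , changed⇒agree ℕ.≤-refl c)
      (exec-copy {scratch d} {parameter p} (λ ()) (parameters h p))
  exec-compileExpr (e ⊞ e′) d h = exec-operands e e′ d h λ v v′ ag →
    exec-map (λ _ c → Changed.value c , agree-trans ag (changed⇒agree ℕ.≤-refl c))
      (exec-⊕ (scratch d) (scratch d) (scratch (suc d)) v v′)
  exec-compileExpr (e ⊟ e′) d h = exec-operands e e′ d h λ v v′ ag →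
    exec-map (λ _ c → Changed.value c , agree-trans ag (changed⇒agree ℕ.≤-refl c))
      (exec-⊖ (scratch d) (scratch d) (scratch (suc d)) v v′)
  exec-compileExpr (p ⊠ e) d {s = s} h =
    exec-compileExpr e (suc d) h ⟫ λ (v , ag) →
    exec-≔ (scratch d) 0 ⟫ λ c₁ →
    exec-copy {scratch (2 + d)} {parameter p} (λ ())
      (trans (others c₁ (parameter p) (λ ())) (trans (Agree.below ag (parameter p) tt) (parameters h p))) ⟫ λ c₂ →
    exec-≔ (scratch (3 + d)) 1 ⟫ λ c₃ →
    exec-map (λ σ′ (v′ , o , m , b) → v′ ,
        agree-trans (agree-≤ (ℕ.n≤1+n d) ag) (agree-trans (changed⇒agree ℕ.≤-refl c₁)
        (agree-trans (changed⇒agree (ℕ.m≤n+m d 2) c₂) (agree-trans (changed⇒agree (ℕ.m≤n+m d 3) c₃)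
        (agree (λ a l → o a (below⇒≢ ℕ.≤-refl l) (below⇒≢ (ℕ.m≤n+m d 2) l)) m b)))))
      (exec-addRepeatedly {scratch d} {scratch (suc d)} {scratch (2 + d)} {scratch (3 + d)}
        (λ ()) (λ ()) (λ ()) (λ ()) (λ ()) (λ ()) (ρ p) {0} {eval e s}
        (trans (others c₃ (scratch d) (λ ())) (trans (others c₂ (scratch d) (λ ())) (value c₁)))
        (trans (others c₃ (scratch (suc d)) (λ ())) (trans (others c₂ (scratch (suc d)) (λ ())) (trans (others c₁ (scratch (suc d)) (λ ())) v)))
        (trans (others c₃ (scratch (2 + d)) (λ ())) (value c₂))
        (value c₃))
    where open Changed
  exec-compileExpr (i ⟦ e ⟧) d h =
    exec-compileExpr e d h ⟫ λ (v , ag) →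
    exec-address i d v (trans (Agree.below ag (parameter 1) tt) (parameters h 1)) ⟫ λ (v′ , ag′) →
    exec-map (λ σ′ c → trans (Changed.value c) (arrays (sim-agree (agree-trans ag ag′) h) i _)
                     , agree-trans ag (agree-trans ag′ (changed⇒agree ℕ.≤-refl c)))
      (exec-load (scratch d) (scratch d) v′)
  -- The memory from `ρ 1` on holds arrays, while the abstract input is 0 there; the sign of
  -- `ρ 1 ∸ e` decides whether the memory may be read.
  exec-compileExpr (input e) d {s = s} h =
    exec-compileExpr e d h ⟫ λ {σ₁} (v , ag) →
    exec-⊖ (scratch (suc d)) (parameter 1) (scratch d)
       (trans (Agree.below ag (parameter 1) tt) (parameters h 1)) v ⟫ λ {σ₂} c →
    let ag₂ = agree-trans ag (changed⇒agree (ℕ.n≤1+n d) c)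
        v₂  = trans (Changed.others c (scratch d) (λ ())) v
    in exec-branch
      (λ B∸e≢0 → exec-map
        (λ σ′ c′ → trans (Changed.value c′) (inputs (sim-agree ag₂ h) (eval e s)
                     (ℕ.m∸n≢0⇒n<m (B∸e≢0 ∘ trans (Changed.value c))))
                 , agree-trans ag₂ (changed⇒agree ℕ.≤-refl c′))
        (exec-load (scratch d) (scratch d) v₂))
      (λ B∸e≡0 → exec-map
        (λ σ′ c′ → trans (Changed.value c′) (sym (inp-outside (eval e s)
                     (ℕ.m∸n≡0⇒m≤n (trans (sym (Changed.value c)) B∸e≡0))))
                 , agree-trans ag₂ (changed⇒agree ℕ.≤-refl c′))
        (exec-≔ (scratch d) 0))

  cost : Cmd → ℕ
  cost skip           = 0
  cost (x ← e)       = costExpr e + 2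
  cost (i ⟦ e ⟧← e′) = costExpr e + (7 + (costExpr e′ + 1))
  cost (c ⨾ c′)       = cost c + cost c′
  cost (ifₑ e c c′)   = costExpr e + suc (cost c + cost c′)
  cost (loop x p c)   = 2 + (1 + suc (ρ p * suc (2 + (1 + (1 + (1 + cost c))))))
  cost (out e)        = costExpr e + 1

  -- The second component protects the counters of enclosing loops, which live in scratch registers
  -- below `d`.
  Simulates : ℕ → Machine → State → Machine → Set
  Simulates d σ s σ′ =
    Sim σ′ s × (∀ e → e < d → regs σ′ (cell (scratch e)) ≡ regs σ (cell (scratch e)))

  agree-scratch : ∀ {d σ σ′} → Agree d σ σ′ →
    ∀ e → e < d → regs σ′ (cell (scratch e)) ≡ regs σ (cell (scratch e))
  agree-scratch ag e e<d = Agree.below ag (scratch e) e<d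

  changed-variable : ∀ {x v σ σ′ s} → Sim σ s → Changed (variable′ x) v σ σ′ → Sim σ′ (setReg x v s)
  changed-variable {x} {v} {s = state r _ _} h (changed val o m b) = sim
    (λ y → case y ℕ.≟ x of λ
       { (yes refl) → trans val (sym ([↦]-same r x v))
       ; (no y≢x)   → trans (o (variable′ y) (λ { refl → y≢x refl }))
                            (trans (variables h y) (sym ([↦]-other r v y≢x))) })
    (λ p → trans (o (parameter p) (λ ())) (parameters h p))
    (λ i a → trans (cong (λ f → f (address (ρ 1) i a)) m) (arrays h i a))
    (λ y y<B → trans (cong (λ f → f y) m) (inputs h y y<B))
    (trans b (outputs h))

  sim-store : ∀ {i a v σ s} → Sim σ s →
    Sim (machine (regs σ) (memory σ [ address (ρ 1) i a ↦ v ]) (buffer σ))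
        (setArr i a v s)
  sim-store {i} {a} {v} {machine R M b} {state r m w} h = sim (variables h) (parameters h) arrs
    (λ y y<B → trans ([↦]-other M v (λ { refl → ℕ.≤⇒≯ (ℕ.m≤n+m (ρ 1) (a * 16 + toℕ i)) y<B }))
                     (inputs h y y<B))
    (outputs h)
    where
    arrs : ∀ j a′ → (M [ address (ρ 1) i a ↦ v ]) (address (ρ 1) j a′) ≡
                    (if does (j Fin.≟ i) then m j [ a ↦ v ] else m j) a′
    arrs j a′ with j Fin.≟ i
    ... | no j≢i = trans ([↦]-other M v (j≢i ∘ proj₁ ∘ address-injective {ρ 1} {j} {i} {a′} {a})) (arrays h j a′)
    ... | yes refl with a′ ℕ.≟ a
    ...   | yes refl = trans ([↦]-same M _ v) (sym ([↦]-same (m i) a v))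
    ...   | no a′≢a  = trans ([↦]-other M v (a′≢a ∘ proj₂ ∘ address-injective {ρ 1} {i} {i} {a′} {a}))
                           (trans (arrays h i a′) (sym ([↦]-other (m i) v a′≢a)))

  exec-compile : ∀ c d {σ s} → Sim σ s → Exec (compile c d) (cost c) σ (Simulates d σ (run c s))
  exec-compile skip d h = exec-[] (h , λ _ _ → refl)
  exec-compile (x ← e) d h =
    exec-compileExpr e d h ⟫ λ (v , ag) →
    exec-map (λ σ′ c → changed-variable (sim-agree ag h) c
                     , λ k k<d → trans (Changed.others c (scratch k) (λ ())) (agree-scratch ag k k<d))
      (exec-copy {variable′ x} {scratch d} (λ ()) v)
  exec-compile (i ⟦ e ⟧← e′) d {s = s} h =
    exec-compileExpr e d h ⟫ λ (v , ag) →
    exec-address i d v (trans (Agree.below ag (parameter 1) tt) (parameters h 1)) ⟫ λ (v₁ , ag₁) →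
    let ag₂ = agree-trans ag ag₁ in
    exec-compileExpr e′ (suc d) (sim-agree ag₂ h) ⟫ λ {σ₃} (v₃ , ag₃) →
    let ag₄ = agree-trans ag₂ (agree-≤ (ℕ.n≤1+n d) ag₃)
        v₄  = trans (Agree.below ag₃ (scratch d) ℕ.≤-refl) v₁
    in exec ℕ.≤-refl {machine (regs σ₃) (memory σ₃ [ regs σ₃ (cell (scratch d)) ↦ regs σ₃ (cell (scratch (suc d))) ]) (buffer σ₃)}
         (λ k → more refl done)
         ( subst₂ (λ a b → Sim (machine (regs σ₃) (memory σ₃ [ a ↦ b ]) (buffer σ₃)) (setArr i (eval e s) (eval e′ s) s))
             (sym v₄) (sym v₃) (sim-store (sim-agree ag₄ h))
         , agree-scratch ag₄)
  exec-compile (c ⨾ c′) d h =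
    exec-compile c d h ⟫ λ (h₁ , sc) →
    exec-map (λ σ′ (h₂ , sc′) → h₂ , λ e e<d → trans (sc′ e e<d) (sc e e<d)) (exec-compile c′ d h₁)
  exec-compile (ifₑ e c c′) d {σ} {s} h =
    exec-compileExpr e d h ⟫ λ {σ₁} (v , ag) →
    exec-branch
      (λ ne → exec-map (λ σ′ (h₂ , sc) →
           subst (Sim σ′) (sym (if-true (λ z → ne (trans v z)))) h₂
         , λ e e<d → trans (sc e e<d) (agree-scratch ag e e<d)) (exec-compile c d (sim-agree ag h)))
      (λ eq → exec-map (λ σ′ (h₂ , sc) →
           subst (Sim σ′) (sym (if-false (trans (sym v) eq))) h₂
         , λ e e<d → trans (sc e e<d) (agree-scratch ag e e<d)) (exec-compile c′ d (sim-agree ag h)))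
    where
    if-true : ∀ {a} {x y : State} → a ≢ 0 → (if nonzero a then x else y) ≡ x
    if-true {zero}  ne = contradiction refl ne
    if-true {suc a} ne = refl
    if-false : ∀ {a} {x y : State} → a ≡ 0 → (if nonzero a then x else y) ≡ y
    if-false refl = refl
  exec-compile (loop x p c) d {σ} {s} h =
    exec-copy {scratch d} {parameter p} (λ ()) (parameters h p) ⟫ λ c₁ →
    exec-≔ (scratch (suc d)) 0 ⟫ λ c₂ →
    let ag = agree-trans (changed⇒agree ℕ.≤-refl c₁) (changed⇒agree (ℕ.n≤1+n d) c₂) in
    exec-map (λ σ′ (_ , i , j+0≡ρ , _ , h′ , sc) →
        subst (λ k → Sim σ′ (iterate k body s)) (trans (sym (ℕ.+-identityʳ i)) j+0≡ρ) h′ , sc)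
      (exec-while Inv proj₁ step-body (ρ p)
        ( trans (Changed.others c₂ (scratch d) (λ ())) (Changed.value c₁)
        , 0 , refl , Changed.value c₂ , sim-agree ag h , agree-scratch ag))
    where
    open Changed
    body : ℕ → State → State
    body k s′ = run c (setReg x k s′)
    Inv : ℕ → Machine → Set
    Inv m σ′ = regs σ′ (cell (scratch d)) ≡ m
      × ∃[ k ] k + m ≡ ρ p × regs σ′ (cell (scratch (suc d))) ≡ k × Simulates d σ (iterate k body s) σ′
    step-body : ∀ {m σ′} → Inv (suc m) σ′ → Exec _ _ σ′ (Inv m)
    step-body {m} {σ′} (v , k , k+m , v′ , h′ , sc) =
      exec-copy {variable′ x} {scratch (suc d)} (λ ()) v′ ⟫ λ c₁ →
      exec-≔ (scratch (2 + d)) 1 ⟫ λ c₂ →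
      exec-⊕ (scratch (suc d)) (scratch (suc d)) (scratch (2 + d))
        (trans (others c₂ (scratch (suc d)) (λ ())) (trans (others c₁ (scratch (suc d)) (λ ())) v′)) (value c₂) ⟫ λ c₃ →
      exec-⊖ (scratch d) (scratch d) (scratch (2 + d))
        (trans (others c₃ (scratch d) (λ ())) (trans (others c₂ (scratch d) (λ ())) (trans (others c₁ (scratch d) (λ ())) v)))
        (trans (others c₃ (scratch (2 + d)) (λ ())) (value c₂)) ⟫ λ c₄ →
      let ag = agree-trans (changed⇒agree (ℕ.m≤n+m d 2) c₂) (agree-trans (changed⇒agree (ℕ.n≤1+n d) c₃) (changed⇒agree ℕ.≤-refl c₄))
      in exec-map (λ σ″ (h″ , sc″) →
            trans (sc″ d (ℕ.m<n+m d ℕ.0<1+n)) (value c₄)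
          , suc k , trans (sym (ℕ.+-suc k m)) k+m
          , trans (sc″ (suc d) ℕ.≤-refl) (trans (others c₄ (scratch (suc d)) (λ ())) (trans (value c₃) (ℕ.+-comm k 1)))
          , h″
          , λ e e<d → trans (sc″ e (ℕ.m≤n⇒m≤1+n (ℕ.m≤n⇒m≤1+n e<d))) (trans (agree-scratch ag e e<d)
                        (trans (others c₁ (scratch e) (λ ())) (sc e e<d))))
        (exec-compile c (2 + d) (sim-agree ag (changed-variable h′ c₁)))
  exec-compile (out e) d {s = state r m w} h =
    exec-compileExpr e d h ⟫ λ {σ₁} (v , ag) →
    let h₁ = sim-agree ag h in
    exec ℕ.≤-refl {machine (regs σ₁) (memory σ₁) (buffer σ₁ ++ [ regs σ₁ (cell (scratch d)) ])}
      (λ k → more refl done)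
      ( sim (variables h₁) (parameters h₁) (arrays h₁) (inputs h₁) (cong₂ (λ b a → b ++ [ a ]) (outputs h₁) v)
      , agree-scratch ag)

-- Frame conditions and loop invariants

writesReg : Cmd → ℕ → Bool
writesReg skip           y = false
writesReg (x ← e)        y = does (y ℕ.≟ x)
writesReg (i ⟦ e ⟧← e′)  y = false
writesReg (c ⨾ c′)       y = writesReg c y ∨ writesReg c′ y
writesReg (ifₑ e c c′)   y = writesReg c y ∨ writesReg c′ y
writesReg (loop x p c)   y = does (y ℕ.≟ x) ∨ writesReg c y
writesReg (out e)        y = false

writesArr : Cmd → Array → Bool
writesArr skip           j = false
writesArr (x ← e)        j = false
writesArr (i ⟦ e ⟧← e′)  j = does (j Fin.≟ i)
writesArr (c ⨾ c′)       j = writesArr c j ∨ writesArr c′ j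
writesArr (ifₑ e c c′)   j = writesArr c j ∨ writesArr c′ j
writesArr (loop x p c)   j = writesArr c j
writesArr (out e)        j = false

writesOut : Cmd → Bool
writesOut skip           = false
writesOut (x ← e)        = false
writesOut (i ⟦ e ⟧← e′)  = false
writesOut (c ⨾ c′)       = writesOut c ∨ writesOut c′
writesOut (ifₑ e c c′)   = writesOut c ∨ writesOut c′
writesOut (loop x p c)   = writesOut c
writesOut (out e)        = true

-- The premises are Boolean equations, so that for a concrete command they are discharged by `refl`.
record Frame (c : Cmd) (s s′ : State) : Set where
  constructor mkFrame
  field
    regs  : ∀ x → writesReg c x ≡ false → reg s′ x ≡ reg s x
    arrs  : ∀ i → writesArr c i ≡ false → arr s′ i ≡ arr s i
    outs  : writesOut c ≡ false → written s′ ≡ written s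

setReg-other : ∀ {x y} a s → does (y ℕ.≟ x) ≡ false → reg (setReg x a s) y ≡ reg s y
setReg-other {x} {y} a s eq rewrite eq = refl

setArr-other : ∀ {i j} a v s → does (j Fin.≟ i) ≡ false → arr (setArr i a v s) j ≡ arr s j
setArr-other a v s eq rewrite eq = refl

∨-falseˡ : ∀ {a b} → a ∨ b ≡ false → a ≡ false
∨-falseˡ = Bool.∨-conicalˡ _ _

∨-falseʳ : ∀ {a b} → a ∨ b ≡ false → b ≡ false
∨-falseʳ {a} = Bool.∨-conicalʳ a _

frame-refl : ∀ {c s} → Frame c s s
frame-refl = mkFrame (λ _ _ → refl) (λ _ _ → refl) (λ _ → refl)

frame-loop-step : ∀ {x p c k s s₁ s₂} → Frame (loop x p c) s s₁ →
                  Frame c (setReg x k s₁) s₂ → Frame (loop x p c) s s₂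
frame-loop-step {k = k} {s₁ = s₁} (mkFrame r a o) (mkFrame r′ a′ o′) = mkFrame
  (λ y eq → trans (r′ y (∨-falseʳ eq)) (trans (setReg-other k s₁ (∨-falseˡ eq)) (r y eq)))
  (λ i eq → trans (a′ i eq) (a i eq))
  (λ eq → trans (o′ eq) (o eq))

module Verification (inp ρ : ℕ → ℕ) where

  open Semantics inp ρ

  frame : ∀ c s → Frame c s (run c s)

  iterate-frame : ∀ x p c k s → Frame (loop x p c) s (iterate k (λ k s′ → run c (setReg x k s′)) s)
  iterate-frame x p c zero    s = frame-refl
  iterate-frame x p c (suc k) s =
    frame-loop-step (iterate-frame x p c k s) (frame c _)

  frame skip s          = frame-refl
  frame (x ← e) s       = mkFrame (λ y → setReg-other _ s) (λ _ _ → refl) (λ _ → refl)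
  frame (i ⟦ e ⟧← e′) s = mkFrame (λ _ _ → refl) (λ j → setArr-other _ _ s) (λ _ → refl)
  frame (c ⨾ c′) s with frame c s | frame c′ (run c s)
  ... | mkFrame r a o | mkFrame r′ a′ o′ = mkFrame
    (λ y eq → trans (r′ y (∨-falseʳ eq)) (r y (∨-falseˡ eq)))
    (λ i eq → trans (a′ i (∨-falseʳ eq)) (a i (∨-falseˡ eq)))
    (λ eq → trans (o′ (∨-falseʳ eq)) (o (∨-falseˡ eq)))
  frame (ifₑ e c c′) s with nonzero (eval e s)
  ... | true  = let mkFrame r a o = frame c s in
    mkFrame (λ y eq → r y (∨-falseˡ eq)) (λ i eq → a i (∨-falseˡ eq)) (λ eq → o (∨-falseˡ eq))
  ... | false = let mkFrame r a o = frame c′ s in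
    mkFrame (λ y eq → r y (∨-falseʳ eq)) (λ i eq → a i (∨-falseʳ eq)) (λ eq → o (∨-falseʳ eq))
  frame (loop x p c) s  = iterate-frame x p c (ρ p) s
  frame (out e) s       = mkFrame (λ _ _ → refl) (λ _ _ → refl) (λ ())

  -- The `Frame` handed to each pass says that whatever the loop never writes still has its value
  -- from before the loop, so an invariant has to mention only what changes.
  loop-rule : ∀ {x p c s} (I : ℕ → State → Set) → I 0 s →
    (∀ (k : Fin (ρ p)) s′ → Frame (loop x p c) s s′ → I (toℕ k) s′ →
       I (suc (toℕ k)) (run c (setReg x (toℕ k) s′))) →
    I (ρ p) (run (loop x p c) s)
  loop-rule {x} {p} {c} {s} I base advance = go (ρ p) ℕ.≤-refl
    where
    body : ℕ → State → State
    body k s′ = run c (setReg x k s′)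
    go : ∀ k → k ≤ ρ p → I k (iterate k body s)
    go zero    _   = base
    go (suc k) k<ρ =
      subst (λ j → I (suc j) (body j (iterate k body s))) (Fin.toℕ-fromℕ< k<ρ)
        (advance (fromℕ< k<ρ) _ (iterate-frame x p c k s)
          (subst (λ j → I j (iterate k body s)) (sym (Fin.toℕ-fromℕ< k<ρ)) (go k (ℕ.<⇒≤ k<ρ))))

  -- Counting the inner passes by `combine k l` agrees with the numbering of slots and of pairs of
  -- vertices, so invariants can speak of all slots or pairs below a number. `stable` covers the
  -- assignment to `x` that starts an outer pass.
  loop₂-rule : ∀ {x p y q c s} → writesReg (loop y q c) x ≡ false →
    (I : ℕ → State → Set) →
    (∀ {j s′} a → I j s′ → I j (setReg x a s′)) → I 0 s →
    (∀ (k : Fin (ρ p)) (l : Fin (ρ q)) s′ → Frame (loop x p (loop y q c)) s s′ →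
       reg s′ x ≡ toℕ k → I (toℕ (combine k l)) s′ →
       I (suc (toℕ (combine k l))) (run c (setReg y (toℕ l) s′))) →
    I (ρ p * ρ q) (run (loop x p (loop y q c)) s)
  loop₂-rule {x} {p} {y} {q} {c} {s} fresh I stable base advance =
    subst (λ j → I j (run (loop x p (loop y q c)) s)) (ℕ.*-comm (ρ q) (ρ p))
      (loop-rule {x} {p} {loop y q c} (λ k → I (ρ q * k))
        (subst (λ j → I j s) (sym (ℕ.*-zeroʳ (ρ q))) base)
        λ k s₁ fr i → subst (λ j → I j (run (loop y q c) (setReg x (toℕ k) s₁)))
          (trans (ℕ.+-comm (ρ q * toℕ k) (ρ q)) (sym (ℕ.*-suc (ρ q) (toℕ k))))
          (proj₁ (loop-rule {y} {q} {c} (λ l s₂ → I (ρ q * toℕ k + l) s₂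
                                         × reg s₂ x ≡ toℕ k)
            ( subst (λ j → I j (setReg x (toℕ k) s₁)) (sym (ℕ.+-identityʳ (ρ q * toℕ k))) (stable (toℕ k) i)
            , [↦]-same (reg s₁) x (toℕ k))
            λ l s₂ fr₂ (i₂ , x≡k) →
              subst (λ j → I j (run c (setReg y (toℕ l) s₂)))
                (trans (cong suc (Fin.toℕ-combine k l)) (sym (ℕ.+-suc (ρ q * toℕ k) (toℕ l))))
                (advance k l s₂ (frame-loop-step {k = toℕ k} fr fr₂) x≡k
                  (subst (λ j → I j s₂) (sym (Fin.toℕ-combine k l)) i₂))
            , trans (Frame.regs (frame c (setReg y (toℕ l) s₂)) x (∨-falseʳ fresh))
                (trans (setReg-other {y} {x} (toℕ l) s₂ (∨-falseˡ fresh)) x≡k))))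

-- Growth of costs

Grade : Set
Grade = ℕ × ℕ

infixl 6 _⊕ᵍ_
infixl 7 _⊗ᵍ_

constᵍ : ℕ → Grade
constᵍ a = a , 0

-- Adding two powers of b may cost a factor 2 ≤ b, hence the extra 1. The coefficients of `r` are
-- added even for a sum, where a maximum would do; the total nevertheless comes out as 1, because
-- parameter 3 bounds just one loop of the program.
_⊕ᵍ_ _⊗ᵍ_ : Grade → Grade → Grade
(k , d) ⊕ᵍ (k′ , d′) = suc (k + k′) , d + d′
(k , d) ⊗ᵍ (k′ , d′) = k + k′ , d + d′

-- A quantity of grade (k , d) is at most b ^ (k + d * r); parameter 3 alone may
-- be as large as b ^ (7 + r).
parameterGrade : ℕ → Grade
parameterGrade p = 7 , (if p ≡ᵇ 3 then 1 else 0)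

gradeExpr : Expr → Grade
gradeExpr (lit a)   = constᵍ 1
gradeExpr (var x)   = constᵍ 2
gradeExpr (par p)   = constᵍ 2
gradeExpr (e ⊞ e′)  = gradeExpr e ⊕ᵍ (gradeExpr e′ ⊕ᵍ constᵍ 1)
gradeExpr (e ⊟ e′)  = gradeExpr e ⊕ᵍ (gradeExpr e′ ⊕ᵍ constᵍ 1)
gradeExpr (p ⊠ e)   = gradeExpr e ⊕ᵍ (constᵍ 5 ⊕ᵍ parameterGrade p ⊗ᵍ constᵍ 3)
gradeExpr (i ⟦ e ⟧) = gradeExpr e ⊕ᵍ constᵍ 8
gradeExpr (input e) = gradeExpr e ⊕ᵍ constᵍ 4

grade : Cmd → Grade
grade skip           = constᵍ 0
grade (x ← e)        = gradeExpr e ⊕ᵍ constᵍ 2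
grade (i ⟦ e ⟧← e′)  = gradeExpr e ⊕ᵍ (constᵍ 7 ⊕ᵍ (gradeExpr e′ ⊕ᵍ constᵍ 1))
grade (c ⨾ c′)       = grade c ⊕ᵍ grade c′
grade (ifₑ e c c′)   = gradeExpr e ⊕ᵍ (constᵍ 1 ⊕ᵍ (grade c ⊕ᵍ grade c′))
grade (loop x p c)   = constᵍ 4 ⊕ᵍ parameterGrade p ⊗ᵍ (constᵍ 6 ⊕ᵍ grade c)
grade (out e)        = gradeExpr e ⊕ᵍ constᵍ 1

module Growth (inp ρ : ℕ → ℕ) (inp-outside : ∀ y → ρ 1 ≤ y → inp y ≡ 0)
              (b r : ℕ) (2≤b : 2 ≤ b) where

  open Simulation inp ρ inp-outside using (costExpr; cost)

  Bounded : ℕ → Grade → Set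
  Bounded t (k , d) = t ≤ b ^ (k + d * r)

  b^-mono : ∀ {x y} → x ≤ y → b ^ x ≤ b ^ y
  b^-mono = ℕ.^-monoʳ-≤ b {{>-nonZero (ℕ.≤-trans (s≤s z≤n) 2≤b)}}

  b^-+ : ∀ {t t′} x y → t ≤ b ^ x → t′ ≤ b ^ y → t + t′ ≤ b ^ suc (x + y)
  b^-+ {t} {t′} x y p q = begin
    t + t′                            ≤⟨ ℕ.+-mono-≤ (ℕ.≤-trans p (b^-mono (ℕ.m≤m+n x y)))
                                                    (ℕ.≤-trans q (b^-mono (ℕ.m≤n+m y x))) ⟩
    b ^ (x + y) + b ^ (x + y)         ≡⟨ cong (b ^ (x + y) +_) (sym (ℕ.+-identityʳ _)) ⟩
    2 * b ^ (x + y)                   ≤⟨ ℕ.*-monoˡ-≤ (b ^ (x + y)) 2≤b ⟩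
    b ^ suc (x + y)                   ∎
    where open ℕ.≤-Reasoning

  regroup : ∀ k d k′ d′ → k + d * r + (k′ + d′ * r) ≡ k + k′ + (d + d′) * r
  regroup = solve 5 (λ r k d k′ d′ → k :+ d :* r :+ (k′ :+ d′ :* r) := k :+ k′ :+ (d :+ d′) :* r) refl r
    where open +-*-Solver

  bounded-const : ∀ a → Bounded a (constᵍ a)
  bounded-const a = ℕ.≤-trans (go a) (b^-mono {a} {a + 0} (ℕ.≤-reflexive (sym (ℕ.+-identityʳ a))))
    where
    go : ∀ a → a ≤ b ^ a
    go zero    = z≤n
    go (suc a) = ℕ.≤-trans (ℕ.+-mono-≤ (b^-mono {0} {a} z≤n) (go a))
      (ℕ.≤-trans (ℕ.≤-reflexive (cong (b ^ a +_) (sym (ℕ.+-identityʳ _)))) (ℕ.*-monoˡ-≤ (b ^ a) 2≤b))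

  bounded-+ : ∀ {t t′} g g′ → Bounded t g → Bounded t′ g′ → Bounded (t + t′) (g ⊕ᵍ g′)
  bounded-+ (k , d) (k′ , d′) p q =
    ℕ.≤-trans (b^-+ (k + d * r) (k′ + d′ * r) p q)
              (ℕ.≤-reflexive (cong (λ e → b ^ suc e) (regroup k d k′ d′)))

  bounded-* : ∀ {t t′} g g′ → Bounded t g → Bounded t′ g′ → Bounded (t * t′) (g ⊗ᵍ g′)
  bounded-* (k , d) (k′ , d′) p q =
    ℕ.≤-trans (ℕ.*-mono-≤ p q)
      (ℕ.≤-reflexive (trans (sym (ℕ.^-distribˡ-+-* b (k + d * r) (k′ + d′ * r)))
                            (cong (b ^_) (regroup k d k′ d′))))

  module _ (parameter-bounded : ∀ p → Bounded (ρ p) (parameterGrade p)) where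

    costExpr-bounded : ∀ e → Bounded (costExpr e) (gradeExpr e)
    costExpr-bounded (lit a)   = bounded-const 1
    costExpr-bounded (var x)   = bounded-const 2
    costExpr-bounded (par p)   = bounded-const 2
    costExpr-bounded (e ⊞ e′)  = bounded-+ (gradeExpr e) (gradeExpr e′ ⊕ᵍ constᵍ 1) (costExpr-bounded e)
      (bounded-+ (gradeExpr e′) (constᵍ 1) (costExpr-bounded e′) (bounded-const 1))
    costExpr-bounded (e ⊟ e′)  = bounded-+ (gradeExpr e) (gradeExpr e′ ⊕ᵍ constᵍ 1) (costExpr-bounded e)
      (bounded-+ (gradeExpr e′) (constᵍ 1) (costExpr-bounded e′) (bounded-const 1))
    costExpr-bounded (p ⊠ e)   =
      bounded-+ (gradeExpr e) (constᵍ 5 ⊕ᵍ parameterGrade p ⊗ᵍ constᵍ 3) (costExpr-bounded e)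
        (bounded-+ (constᵍ 5) (parameterGrade p ⊗ᵍ constᵍ 3) (bounded-const 5)
          (bounded-* (parameterGrade p) (constᵍ 3) (parameter-bounded p) (bounded-const 3)))
    costExpr-bounded (i ⟦ e ⟧) = bounded-+ (gradeExpr e) (constᵍ 8) (costExpr-bounded e) (bounded-const 8)
    costExpr-bounded (input e) = bounded-+ (gradeExpr e) (constᵍ 4) (costExpr-bounded e) (bounded-const 4)

    cost-bounded : ∀ c → Bounded (cost c) (grade c)
    cost-bounded skip           = z≤n
    cost-bounded (x ← e)        = bounded-+ (gradeExpr e) (constᵍ 2) (costExpr-bounded e) (bounded-const 2)
    cost-bounded (i ⟦ e ⟧← e′)  =
      bounded-+ (gradeExpr e) (constᵍ 7 ⊕ᵍ (gradeExpr e′ ⊕ᵍ constᵍ 1)) (costExpr-bounded e)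
        (bounded-+ (constᵍ 7) (gradeExpr e′ ⊕ᵍ constᵍ 1) (bounded-const 7)
          (bounded-+ (gradeExpr e′) (constᵍ 1) (costExpr-bounded e′) (bounded-const 1)))
    cost-bounded (c ⨾ c′)       = bounded-+ (grade c) (grade c′) (cost-bounded c) (cost-bounded c′)
    cost-bounded (ifₑ e c c′)   =
      bounded-+ (gradeExpr e) (constᵍ 1 ⊕ᵍ (grade c ⊕ᵍ grade c′)) (costExpr-bounded e)
        (bounded-+ (constᵍ 1) (grade c ⊕ᵍ grade c′) (bounded-const 1)
          (bounded-+ (grade c) (grade c′) (cost-bounded c) (cost-bounded c′)))
    cost-bounded (loop x p c)   =
      bounded-+ (constᵍ 4) (parameterGrade p ⊗ᵍ (constᵍ 6 ⊕ᵍ grade c)) (bounded-const 4)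
        (bounded-* (parameterGrade p) (constᵍ 6 ⊕ᵍ grade c) (parameter-bounded p)
          (bounded-+ (constᵍ 6) (grade c) (bounded-const 6) (cost-bounded c)))
    cost-bounded (out e)        = bounded-+ (gradeExpr e) (constᵍ 1) (costExpr-bounded e) (bounded-const 1)

-- Matchings

total : ∀ {m} → (Fin m → ℕ) → ℕ
total {zero}  f = 0
total {suc m} f = f zero + total (f ∘ suc)

total-cong : ∀ {m} {f g : Fin m → ℕ} → (∀ s → f s ≡ g s) → total f ≡ total g
total-cong {zero}  eq = refl
total-cong {suc m} eq = cong₂ _+_ (eq zero) (total-cong (eq ∘ suc))

total-suc : ∀ {m} {f g : Fin m → ℕ} s → g s ≡ suc (f s) → (∀ t → t ≢ s → g t ≡ f t) →
            total g ≡ suc (total f)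
total-suc zero eq same = cong₂ _+_ eq (total-cong λ t → same (suc t) λ ())
total-suc {f = f} (suc s) eq same =
  trans (cong₂ _+_ (same zero λ ()) (total-suc s eq λ t t≢s → same (suc t) (t≢s ∘ Fin.suc-injective)))
        (ℕ.+-suc (f zero) _)

total-≤ : ∀ {m} {f : Fin m → ℕ} b → (∀ s → f s ≤ b) → total f ≤ m * b
total-≤ {zero}  b le = z≤n
total-≤ {suc m} b le = ℕ.+-mono-≤ (le zero) (total-≤ b (le ∘ suc))

just-injective : ∀ {A : Set} {x y : A} → just x ≡ just y → x ≡ y
just-injective refl = refl

-- Directed from slots to jobs, like the arrays of the program, so that no slot can serve two jobs.
-- Jobs in `waived` may lack a slot, which describes matchings under repair.
record Matching {J : Set} {N : ℕ} (job : J → Set) (U : J → Fin N → Set) (waived : J → Set) : Set where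
  constructor matching
  field
    at       : Fin N → Maybe J
    sound    : ∀ {s j} → at s ≡ just j → job j × U j s
    unique   : ∀ {s t j} → at s ≡ just j → at t ≡ just j → s ≡ t
    complete : ∀ {j} → job j → waived j ⊎ ∃[ s ] at s ≡ just j

Nobody : ∀ {J : Set} → J → Set
Nobody _ = ⊥

slotOf : ∀ {J N job U} (g : Matching {J} {N} job U Nobody) {j} → job j → ∃[ s ] Matching.at g s ≡ just j
slotOf g q with Matching.complete g q
... | inj₂ x = x

matching-mono : ∀ {J N job U U′ W} → (∀ {j s} → U j s → U′ j s) →
                Matching {J} {N} job U W → Matching job U′ W
matching-mono f (matching at so un co) =
  matching at (λ e → proj₁ (so e) , f (proj₂ (so e))) un co

-- An auction: a job without a slot takes a cheapest usable slot, raising its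
-- price by one and displacing the job holding it.
module Auction {J : Set} {N : ℕ} (job : J → Set) (U : J → Fin N → Set) where

  -- `slack` is the approximate complementary slackness of auction algorithms: a job holds a slot
  -- whose price is within one of the cheapest it could use. `D` contains the jobs started so far,
  -- and `current` is the one waiting for a slot, if any.
  record Inv (D : J → Set) (price : Fin N → ℕ) (at : Fin N → Maybe J) (current : Maybe J) : Set where
    constructor inv
    field
      sound   : ∀ {s j} → at s ≡ just j → job j × U j s
      unique  : ∀ {s t j} → at s ≡ just j → at t ≡ just j → s ≡ t
      isJob   : ∀ {j} → current ≡ just j → job j
      free    : ∀ {s j} → current ≡ just j → at s ≢ just j
      empty   : ∀ {s} → at s ≡ nothing → price s ≡ 0
      slack   : ∀ {s t j} → at s ≡ just j → U j t → price s ≤ suc (price t)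
      bounded : ∀ s → price s ≤ N
      placed  : ∀ {j} → D j → job j → (∃[ s ] at s ≡ just j) ⊎ current ≡ just j

  inv-start : ∀ {price at} → (∀ s → price s ≡ 0) → (∀ s → at s ≡ nothing) → Inv (λ _ → ⊥) price at nothing
  inv-start p≡0 e = inv
    (λ {s} eq → case trans (sym (e s)) eq of λ ())
    (λ {s} eq → case trans (sym (e s)) eq of λ ())
    (λ ()) (λ ()) (λ {s} _ → p≡0 s)
    (λ {s} {t} _ _ → ℕ.≤-trans (ℕ.≤-reflexive (p≡0 s)) z≤n)
    (λ s → ℕ.≤-trans (ℕ.≤-reflexive (p≡0 s)) z≤n)
    (λ ())

  inv-begin : ∀ {D D′ price at j} → Inv D price at nothing → job j →
              (∀ {s} → at s ≢ just j) → (∀ {k} → D′ k → D k ⊎ k ≡ j) →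
              Inv D′ price at (just j)
  inv-begin (inv so un ij fr em sl bo pl) q notHeld D′⊆ = inv so un
    (λ { refl → q }) (λ { refl → notHeld }) em sl bo
    (λ d r → case D′⊆ d of λ
       { (inj₂ refl) → inj₂ refl
       ; (inj₁ d′)   → case pl d′ r of λ { (inj₁ x) → inj₁ x ; (inj₂ ()) } })

  inv-D : ∀ {D D′ price at c} → (∀ {k} → D′ k → job k → D k) → Inv D price at c → Inv D′ price at c
  inv-D f (inv so un ij fr em sl bo pl) = inv so un ij fr em sl bo (λ d q → pl (f d q) q)

  -- Prices never fall, so `slack` survives for the old holders; for `j` it holds because `s` was
  -- cheapest before its price rose by one.
  inv-step : ∀ {D price price′ at at′ j} s → Inv D price at (just j) → U j s →
    (∀ t → U j t → price s ≤ price t) → price s < N →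
    price′ s ≡ suc (price s) → (∀ t → t ≢ s → price′ t ≡ price t) →
    at′ s ≡ just j → (∀ t → t ≢ s → at′ t ≡ at t) →
    Inv D price′ at′ (at s)
  inv-step {D} {price} {price′} {at} {at′} {j} s (inv so un ij fr em sl bo pl) us least p<N p′s p′t a′s a′t =
    inv sound′ unique′ (proj₁ ∘ so) free′ empty′ slack′ bounded′ placed′
    where
    old : ∀ {t} → t ≢ s → ∀ {m} → at′ t ≡ m → at t ≡ m
    old t≢s eq = trans (sym (a′t _ t≢s)) eq
    new : ∀ {k} → at′ s ≡ just k → j ≡ k
    new eq = just-injective (trans (sym a′s) eq)
    price≤ : ∀ t → price t ≤ price′ t
    price≤ t with t Fin.≟ s
    ... | yes refl = subst (price s ≤_) (sym p′s) (ℕ.n≤1+n _)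
    ... | no t≢s   = ℕ.≤-reflexive (sym (p′t t t≢s))
    sound′ : ∀ {t k} → at′ t ≡ just k → job k × U k t
    sound′ {t} eq with t Fin.≟ s
    ... | yes refl = subst (λ k → job k × U k s) (new eq) (ij refl , us)
    ... | no t≢s   = so (old t≢s eq)
    unique′ : ∀ {t u k} → at′ t ≡ just k → at′ u ≡ just k → t ≡ u
    unique′ {t} {u} eq eq′ with t Fin.≟ s | u Fin.≟ s
    ... | yes refl | yes refl = refl
    ... | yes refl | no u≢s   = contradiction (trans (old u≢s eq′) (cong just (sym (new eq)))) (fr refl)
    ... | no t≢s   | yes refl = contradiction (trans (old t≢s eq) (cong just (sym (new eq′)))) (fr refl)
    ... | no t≢s   | no u≢s   = un (old t≢s eq) (old u≢s eq′)
    free′ : ∀ {t k} → at s ≡ just k → at′ t ≢ just k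
    free′ {t} eq eq′ with t Fin.≟ s
    ... | yes refl = fr refl (trans eq (cong just (sym (new eq′))))
    ... | no t≢s   = t≢s (un (old t≢s eq′) eq)
    empty′ : ∀ {t} → at′ t ≡ nothing → price′ t ≡ 0
    empty′ {t} eq with t Fin.≟ s
    ... | yes refl = case trans (sym a′s) eq of λ ()
    ... | no t≢s   = trans (p′t t t≢s) (em (old t≢s eq))
    slack′ : ∀ {t u k} → at′ t ≡ just k → U k u → price′ t ≤ suc (price′ u)
    slack′ {t} {u} {k} eq uk with t Fin.≟ s
    ... | yes refl = subst (_≤ suc (price′ u)) (sym p′s)
                       (s≤s (ℕ.≤-trans (least u (subst (λ i → U i u) (sym (new eq)) uk)) (price≤ u)))
    ... | no t≢s   = subst (_≤ suc (price′ u)) (sym (p′t t t≢s))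
                       (ℕ.≤-trans (sl (old t≢s eq) uk) (s≤s (price≤ u)))
    bounded′ : ∀ t → price′ t ≤ N
    bounded′ t with t Fin.≟ s
    ... | yes refl = subst (_≤ N) (sym p′s) p<N
    ... | no t≢s   = subst (_≤ N) (sym (p′t t t≢s)) (bo t)
    placed′ : ∀ {k} → D k → job k → (∃[ t ] at′ t ≡ just k) ⊎ at s ≡ just k
    placed′ d q with pl d q
    ... | inj₂ refl = inj₁ (s , a′s)
    ... | inj₁ (t , eq) with t Fin.≟ s
    ...   | yes refl = inj₂ eq
    ...   | no t≢s   = inj₁ (t , trans (a′t t t≢s) eq)

  inv-finish : ∀ {D price at} → (∀ {j} → job j → D j) → Inv D price at nothing → Matching job U Nobody
  inv-finish {at = at} d (inv so un _ _ _ _ _ pl) = matching at so un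
    (λ q → case pl (d q) q of λ { (inj₁ x) → inj₂ x ; (inj₂ ()) })

  -- Starting from the slot that a perfect matching g gives to the stuck job,
  -- go from a slot to the slot that g gives to its holder.  Prices drop by at
  -- most one per step, so N + 1 slots are visited; none is repeated.
  inv-stuck : ∀ {D price at j} → Inv D price at (just j) → (∀ s → U j s → N ≤ price s) →
              ¬ Matching job U Nobody
  inv-stuck {D} {price} {at} {j} (inv so un ij fr em sl bo pl) full g =
    let a , b , a<b , eq = Fin.pigeonhole (ℕ.n<1+n N) (chain ∘ toℕ)
    in distinct (toℕ a) (toℕ b) a<b (s≤s⁻¹ (Fin.toℕ<n b)) eq
    where
    module G = Matching g
    follow : ∀ s (m : Maybe J) → at s ≡ m → Fin N
    follow s (just k) eq = proj₁ (slotOf g (proj₁ (so eq)))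
    follow s nothing  eq = s
    chain : ℕ → Fin N
    chain zero    = proj₁ (slotOf g (ij refl))
    chain (suc i) = follow (chain i) (at (chain i)) refl
    follow-spec : ∀ s m (eq : at s ≡ m) → 0 < price s →
                  ∃[ k ] at s ≡ just k × G.at (follow s m eq) ≡ just k
    follow-spec s (just k) eq _ = k , eq , proj₂ (slotOf g (proj₁ (so eq)))
    follow-spec s nothing  eq 0<p = contradiction (em eq) (ℕ.m<n⇒n≢0 0<p)
    high : ∀ i → i ≤ N → N ≤ price (chain i) + i
    holder : ∀ i → i < N → ∃[ k ] at (chain i) ≡ just k × G.at (chain (suc i)) ≡ just k
    holder i i<N = follow-spec (chain i) _ refl
      (ℕ.+-cancelʳ-< i 0 _ (ℕ.≤-trans i<N (high i (ℕ.<⇒≤ i<N))))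
    high zero _ = ℕ.≤-trans (full (chain 0) (proj₂ (G.sound (proj₂ (slotOf g (ij refl))))))
                            (ℕ.m≤m+n _ 0)
    high (suc i) i<N = let k , held , next-held = holder i i<N in
      ℕ.≤-trans (high i (ℕ.<⇒≤ i<N))
        (ℕ.≤-trans (ℕ.+-monoˡ-≤ i (sl held (proj₂ (G.sound next-held))))
                   (ℕ.≤-reflexive (sym (ℕ.+-suc _ i))))
    distinct : ∀ a b → a < b → b ≤ N → chain a ≢ chain b
    distinct zero (suc b) _ b<N eq = let k , held , next-held = holder b b<N in
      fr refl (trans held (trans (sym next-held) (trans (cong G.at (sym eq)) (proj₂ (slotOf g (ij refl))))))
    distinct (suc a) (suc b) (s≤s a<b) b<N eq =
      let k , held , next-held = holder a (ℕ.<-trans a<b b<N)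
          l , held′ , next-held′ = holder b b<N
      in distinct a b a<b (ℕ.<⇒≤ b<N)
           (un held (trans held′ (trans (sym next-held′) (trans (cong G.at (sym eq)) next-held))))

-- Jobs without a slot are moved to the slots that g gives them, displacing the
-- jobs there, which are moved in turn.  Each move that displaces a job makes
-- one more slot agree with g; each other move uses one new slot.
module Exchange {J : Set} (_≟_ : (i j : J) → Dec (i ≡ j)) {N n : ℕ} (job : J → Set)
  (ok : J → Fin N → Set) (owner : Fin N → Fin n) (Y : Fin n → Set)
  (g : Matching job (λ j s → ok j s × Y (owner s)) Nobody) where

  private module G = Matching g

  Within : (Fin n → Set) → J → Fin N → Set
  Within X j s = ok j s × X (owner s)

  Result : (Fin n → Set) → ℕ → Set
  Result X k = ∃[ Z ] length Z ≤ k × (∀ {w} → w List.∈ Z → Y w)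
             × Matching job (Within (λ w → X w ⊎ w List.∈ Z)) Nobody

  result-≤ : ∀ {X k l} → k ≤ l → Result X k → Result X l
  result-≤ k≤l (Z , le , rest) = Z , ℕ.≤-trans le k≤l , rest

  result-∷ : ∀ {X k} w → Y w → Result (λ x → X x ⊎ x ≡ w) k → Result X (suc k)
  result-∷ w Yw (Z , le , inY , m) =
    w ∷ Z , s≤s le , (λ { (here refl) → Yw ; (there z) → inY z }) ,
    matching-mono (λ { (o , inj₁ (inj₁ x)) → o , inj₁ x
                     ; (o , inj₁ (inj₂ e)) → o , inj₂ (here e)
                     ; (o , inj₂ z)        → o , inj₂ (there z) }) m

  _≟ᴹ_ : (a b : Maybe J) → Dec (a ≡ b)
  _≟ᴹ_ = Maybe.≡-dec _≟_

  differs : (Fin N → Maybe J) → Fin N → ℕ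
  differs at s = if does (at s ≟ᴹ G.at s) then 0 else 1

  differs≤1 : ∀ at s → differs at s ≤ 1
  differs≤1 at s with does (at s ≟ᴹ G.at s)
  ... | true  = z≤n
  ... | false = ℕ.≤-refl

  put : (Fin N → Maybe J) → Fin N → J → Fin N → Maybe J
  put at s j t = if does (t Fin.≟ s) then just j else at t

  put-same : ∀ at s j → put at s j s ≡ just j
  put-same at s j rewrite dec-true (s Fin.≟ s) refl = refl

  put-other : ∀ at {s} j {t} → t ≢ s → put at s j t ≡ at t
  put-other at {s} j {t} t≢s rewrite dec-false (t Fin.≟ s) t≢s = refl

  -- The move of `j` to the slot that `g` gives it. If another job is displaced, the owner of the
  -- slot already lies in `X`; only a free slot can force `X` to grow to `X′`.
  settle : ∀ {X W} (m : Matching job (Within X) W) {j W′} → (q : job j) →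
    (∀ s → Matching.at m s ≢ just j) →
    (∀ k → W k → k ≡ j ⊎ W′ k) →
    (∀ k → Matching.at m (proj₁ (slotOf g q)) ≡ just k → W′ k) →
    ∀ {X′ : Fin n → Set} → (∀ {w} → X w → X′ w) → X′ (owner (proj₁ (slotOf g q))) →
    Matching job (Within X′) W′
  settle {X} (matching at so un co) {j} {W′} q notHeld W⊆ displaced {X′} X⊆ X′s =
    matching (put at s j) sound′ unique′ complete′
    where
    s = proj₁ (slotOf g q)
    sound′ : ∀ {t k} → put at s j t ≡ just k → job k × Within X′ k t
    sound′ {t} {k} eq with t Fin.≟ s
    ... | yes refl = subst (λ k → job k × Within X′ k s) (just-injective eq)
                       (q , proj₁ (proj₂ (G.sound (proj₂ (slotOf g q)))) , X′s)
    ... | no t≢s   = let r , o , x = so eq in r , o , X⊆ x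
    unique′ : ∀ {t u k} → put at s j t ≡ just k → put at s j u ≡ just k → t ≡ u
    unique′ {t} {u} eq eq′ with t Fin.≟ s | u Fin.≟ s
    ... | yes refl | yes refl = refl
    ... | yes refl | no _     = contradiction (trans eq′ (sym eq)) (notHeld u)
    ... | no _     | yes refl = contradiction (trans eq (sym eq′)) (notHeld t)
    ... | no _     | no _     = un eq eq′
    complete′ : ∀ {k} → job k → W′ k ⊎ ∃[ t ] put at s j t ≡ just k
    complete′ {k} r with co r
    ... | inj₁ w = case W⊆ k w of λ
          { (inj₁ refl) → inj₂ (s , put-same at s j) ; (inj₂ w′) → inj₁ w′ }
    ... | inj₂ (t , eq) with t Fin.≟ s
    ...   | yes refl = inj₁ (displaced k eq)
    ...   | no t≢s   = inj₂ (t , trans (put-other at j t≢s) eq)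

  -- A displacement keeps the number of pending jobs and lowers the number of slots on which the
  -- matching differs from `g`, bounded by `fuel`. Use of a free slot lowers the number of pending
  -- jobs and adds one vertex. Hence one vertex per job suffices.
  exchange-∷ : ∀ {X} j js fuel (m : Matching job (Within X) (List._∈ (j ∷ js))) →
    (∀ {k} → k List.∈ (j ∷ js) → job k) → total (differs (Matching.at m)) ≤ fuel →
    Result X (suc (length js))

  exchange : ∀ {X} js (m : Matching job (Within X) (List._∈ js)) →
    (∀ {k} → k List.∈ js → job k) → Result X (length js)
  exchange {X} [] m q = [] , z≤n , (λ ()) ,
    matching-mono {U = Within X} (λ (o , x) → o , inj₁ x)
      (matching M.at M.sound M.unique (λ r → case M.complete r of λ { (inj₁ ()) ; (inj₂ x) → inj₂ x }))
    where module M = Matching m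
  exchange {X} (j ∷ js) m q = exchange-∷ {X} j js (N * 1) m q (total-≤ 1 (differs≤1 (Matching.at m)))

  exchange-∷ {X} j js fuel m q le with Fin.any? (λ s → Matching.at m s ≟ᴹ just j)
  -- Being waived does not exclude holding a slot; a job that holds one is simply dropped from the
  -- list.
  ... | yes (s , eq) = result-≤ {X} (ℕ.n≤1+n _) (exchange {X} js
          (matching M.at M.sound M.unique (λ {k} r → case M.complete r of λ
            { (inj₁ (here refl)) → inj₂ (s , eq) ; (inj₁ (there k∈)) → inj₁ k∈ ; (inj₂ x) → inj₂ x }))
          (q ∘ there))
    where module M = Matching m
  ... | no notHeld with Matching.at m (proj₁ (slotOf g (q (here refl)))) in eq
  ...   | nothing = result-∷ {X} (owner s) (proj₂ (proj₂ (G.sound (proj₂ (slotOf g qj)))))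
          (exchange {λ x → X x ⊎ x ≡ owner s} js (settle {X} m qj (λ t e → notHeld (t , e))
             (λ { k (here e) → inj₁ e ; k (there k∈) → inj₂ k∈ })
             (λ k e → case trans (sym eq) e of λ ())
             {λ x → X x ⊎ x ≡ owner s} inj₁ (inj₂ refl)) (q ∘ there))
    where qj = q (here refl)
          s  = proj₁ (slotOf g qj)
  ...   | just k = recurse fuel le
    where
    module M = Matching m
    qj = q (here refl)
    s  = proj₁ (slotOf g qj)
    m′ : Matching job (Within X) (List._∈ (k ∷ js))
    m′ = settle {X} m qj (λ t e → notHeld (t , e))
             (λ { i (here e) → inj₁ e ; i (there i∈) → inj₂ (there i∈) })
             (λ i e → here (sym (just-injective (trans (sym eq) e))))
             {X} id (proj₂ (proj₂ (M.sound eq)))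
    differs-s : differs M.at s ≡ suc (differs (put M.at s j) s)
    differs-s rewrite proj₂ (slotOf g qj) | put-same M.at s j
                    | dec-false (M.at s ≟ᴹ just j) (λ e → notHeld (s , e))
                    | dec-true (j ≟ j) refl = refl
    decrease : total (differs M.at) ≡ suc (total (differs (put M.at s j)))
    decrease = total-suc s differs-s
      (λ t t≢s → cong (λ a → if does (a ≟ᴹ G.at t) then 0 else 1) (sym (put-other M.at j t≢s)))
    recurse : ∀ fuel → total (differs M.at) ≤ fuel → Result X (suc (length js))
    recurse zero    le = contradiction (trans (sym decrease) (ℕ.n≤0⇒n≡0 le)) λ ()
    recurse (suc f) le = exchange-∷ {X} k js f m′
      (λ { (here refl) → proj₁ (M.sound eq) ; (there i∈) → q (there i∈) })
      (s≤s⁻¹ (subst (_≤ suc f) decrease le))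

-- Covers and dominating sets as matchings

-- At a member of `p` this is its rank in `p`. Ranks turn the jobs served by one vertex into
-- distinct slot numbers; the recursion also matches a program counting entries one by one.
countBelow : ∀ {m} → Subset m → ℕ → ℕ
countBelow []      k       = 0
countBelow (b ∷ p) zero    = 0
countBelow (b ∷ p) (suc k) = bit b + countBelow p k

countBelow-zero : ∀ {m} (p : Subset m) → countBelow p 0 ≡ 0
countBelow-zero []      = refl
countBelow-zero (_ ∷ _) = refl

countBelow-suc : ∀ {m} (p : Subset m) i →
                 countBelow p (suc (toℕ i)) ≡ countBelow p (toℕ i) + bit (lookup p i)
countBelow-suc (b ∷ p) zero    = 
  trans (cong (bit b +_) (countBelow-zero p)) (ℕ.+-identityʳ (bit b))
countBelow-suc (b ∷ p) (suc i) =
  trans (cong (bit b +_) (countBelow-suc p i)) (sym (ℕ.+-assoc (bit b) _ _))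

countBelow-all : ∀ {m} (p : Subset m) → countBelow p m ≡ ∣ p ∣
countBelow-all []          = refl
countBelow-all (true ∷ p)  = cong suc (countBelow-all p)
countBelow-all (false ∷ p) = countBelow-all p

countBelow-mono : ∀ {m} (p : Subset m) {k l} → k ≤ l → countBelow p k ≤ countBelow p l
countBelow-mono []      k≤l       = z≤n
countBelow-mono (b ∷ p) z≤n       = z≤n
countBelow-mono (b ∷ p) (s≤s k≤l) = ℕ.+-monoʳ-≤ (bit b) (countBelow-mono p k≤l)

∈⇒lookup : ∀ {m} {p : Subset m} {i} → i ∈ p → lookup p i ≡ true
∈⇒lookup = Vec.[]=⇒lookup

lookup⇒∈ : ∀ {m} {p : Subset m} {i} → lookup p i ≡ true → i ∈ p
lookup⇒∈ {p = p} {i} = Vec.lookup⇒[]= i p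

∈-tabulate⁺ : ∀ {m} {f : Fin m → Bool} {i} → f i ≡ true → i ∈ tabulate f
∈-tabulate⁺ {f = f} {i} eq = lookup⇒∈ (trans (Vec.lookup∘tabulate f i) eq)

∈-tabulate⁻ : ∀ {m} {f : Fin m → Bool} {i} → i ∈ tabulate f → f i ≡ true
∈-tabulate⁻ {f = f} {i} i∈ = trans (sym (Vec.lookup∘tabulate f i)) (∈⇒lookup i∈)

∈-preimage⁺ : ∀ {m n} {f : Fin m → Fin n} {v i} → f i ≡ v → i ∈ preimage f v
∈-preimage⁺ {f = f} {v} {i} eq = ∈-tabulate⁺ (dec-true (f i Fin.≟ v) eq)

∈-preimage⁻ : ∀ {m n} {f : Fin m → Fin n} {v i} → i ∈ preimage f v → f i ≡ v
∈-preimage⁻ {f = f} {v} {i} i∈ with f i Fin.≟ v | ∈-tabulate⁻ {f = λ i → does (f i Fin.≟ v)} i∈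
... | yes eq | _ = eq

countBelow-< : ∀ {m} (p : Subset m) {i k} → i ∈ p → toℕ i < k → countBelow p (toℕ i) < countBelow p k
countBelow-< p {i} i∈p i<k = ℕ.≤-trans
  (ℕ.≤-reflexive (sym (trans (countBelow-suc p i)
     (trans (cong (λ b → countBelow p (toℕ i) + bit b) (∈⇒lookup i∈p)) (ℕ.+-comm _ 1)))))
  (countBelow-mono p i<k)

rank-< : ∀ {m} (p : Subset m) {i} → i ∈ p → countBelow p (toℕ i) < ∣ p ∣
rank-< p {i} i∈p = subst (countBelow p (toℕ i) <_) (countBelow-all p) (countBelow-< p i∈p (Fin.toℕ<n i))

rank-injective : ∀ {m} (p : Subset m) {i j} → i ∈ p → j ∈ p →
                 countBelow p (toℕ i) ≡ countBelow p (toℕ j) → i ≡ j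
rank-injective p {i} {j} i∈p j∈p eq with ℕ.<-cmp (toℕ i) (toℕ j)
... | tri< i<j _ _ = contradiction eq (ℕ.<⇒≢ (countBelow-< p i∈p i<j))
... | tri≈ _ i≡j _ = Fin.toℕ-injective i≡j
... | tri> _ _ j<i = contradiction (sym eq) (ℕ.<⇒≢ (countBelow-< p j∈p j<i))

member : ∀ {m} (p : Subset m) → Fin ∣ p ∣ → Fin m
member (true ∷ p)  zero    = zero
member (true ∷ p)  (suc x) = suc (member p x)
member (false ∷ p) x       = suc (member p x)

member-∈ : ∀ {m} (p : Subset m) x → member p x ∈ p
member-∈ (true ∷ p)  zero    = Vec.here
member-∈ (true ∷ p)  (suc x) = Vec.there (member-∈ p x)
member-∈ (false ∷ p) x       = Vec.there (member-∈ p x)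

member-injective : ∀ {m} (p : Subset m) {x y} → member p x ≡ member p y → x ≡ y
member-injective (true ∷ p)  {zero}  {zero}  eq = refl
member-injective (true ∷ p)  {suc x} {suc y} eq = cong suc (member-injective p (Fin.suc-injective eq))
member-injective (false ∷ p) eq = member-injective p (Fin.suc-injective eq)

∣∣-injection : ∀ {m} (p : Subset m) k (g : Fin m → ℕ) → (∀ {i} → i ∈ p → g i < k) →
               (∀ {i j} → i ∈ p → j ∈ p → g i ≡ g j → i ≡ j) → ∣ p ∣ ≤ k
∣∣-injection p k g g<k inj = Fin.injective⇒≤ {f = λ x → fromℕ< (g<k (member-∈ p x))}
  λ {x} {y} eq → member-injective p (inj (member-∈ p x) (member-∈ p y)
    (Fin.fromℕ<-injective _ _ (g<k (member-∈ p x)) (g<k (member-∈ p y)) eq))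

lookup-injective : ∀ {A : Set} {xs : List A} → Unique xs →
                   ∀ i j → List.lookup xs i ≡ List.lookup xs j → i ≡ j
lookup-injective (x∉ ∷ u) zero    zero    eq = refl
lookup-injective (x∉ ∷ u) zero    (suc j) eq = contradiction eq (All.lookup x∉ (List.∈-lookup j))
lookup-injective (x∉ ∷ u) (suc i) zero    eq = contradiction (sym eq) (All.lookup x∉ (List.∈-lookup i))
lookup-injective (x∉ ∷ u) (suc i) (suc j) eq = cong suc (lookup-injective u i j eq)

T⇒≡ : ∀ {b} → T b → b ≡ true
T⇒≡ {true} _ = refl

-- A common shape that one program can handle: jobs are pairs of vertices, slots are pairs of a
-- vertex and an index below `K`, and `combine` numbers both.
record AssignmentProblem (n K : ℕ) : Set₁ where
  field
    Job  : Fin n → Fin n → Set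
    Ok   : Fin n → Fin n → Fin n → Fin K → Set
    job? : ∀ u v → Dec (Job u v)

  owner : Fin (n * K) → Fin n
  owner s = proj₁ (remQuot {n} K s)

  index : Fin (n * K) → Fin K
  index s = proj₂ (remQuot {n} K s)

  IsJob : Fin n × Fin n → Set
  IsJob (u , v) = Job u v

  OkSlot : Fin n × Fin n → Fin (n * K) → Set
  OkSlot (u , v) s = Ok u v (owner s) (index s)

  Usable : Subset n → Fin n × Fin n → Fin (n * K) → Set
  Usable S j s = OkSlot j s × owner s ∈ S

  Feasible : Subset n → Set
  Feasible S = Matching IsJob (Usable S) Nobody

  feasible-mono : ∀ {S S′} → S ⊆ S′ → Feasible S → Feasible S′
  feasible-mono S⊆S′ = matching-mono (λ (o , x) → o , S⊆S′ x)

  slot-injective : ∀ {s t} → owner s ≡ owner t → index s ≡ index t → s ≡ t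
  slot-injective {s} {t} eq eq′ = trans (sym (Fin.combine-remQuot {n} K s))
    (trans (cong₂ combine eq eq′) (Fin.combine-remQuot {n} K t))

  owner-combine : ∀ w (i : Fin K) → owner (combine w i) ≡ w
  owner-combine w i = cong proj₁ (Fin.remQuot-combine w i)

  index-combine : ∀ w (i : Fin K) → index (combine w i) ≡ i
  index-combine w i = cong proj₂ (Fin.remQuot-combine w i)

  -- Inverts an injective assignment of slots to jobs into the slot-to-job form of `Matching`. The
  -- holder of a slot is found by exhaustive search over the pairs of vertices.
  module FromFunction {S : Subset n}
    (w  : ∀ u v → Job u v → Fin n) (i : ∀ u v → Job u v → Fin K)
    (ok : ∀ {u v} (q : Job u v) → Ok u v (w u v q) (i u v q))
    (w∈ : ∀ {u v} (q : Job u v) → w u v q ∈ S)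
    (inj : ∀ {u v u′ v′} (q : Job u v) (q′ : Job u′ v′) →
           w u v q ≡ w u′ v′ q′ → i u v q ≡ i u′ v′ q′ → (u , v) ≡ (u′ , v′)) where

    slot : ∀ u v → Dec (Job u v) → Maybe (Fin (n * K))
    slot u v (yes q) = just (combine (w u v q) (i u v q))
    slot u v (no _)  = nothing

    slot-job : ∀ {u v s} (d : Dec (Job u v)) → slot u v d ≡ just s →
               Σ[ q ∈ Job u v ] combine (w u v q) (i u v q) ≡ s
    slot-job (yes q) eq = q , just-injective eq

    slot-defined : ∀ {u v} (d : Dec (Job u v)) → Job u v → ∃[ s ] slot u v d ≡ just s
    slot-defined (yes q) _  = _ , refl
    slot-defined (no ¬q) q = contradiction q ¬q

    Holds : Fin (n * K) → Fin n × Fin n → Set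
    Holds s (u , v) = slot u v (job? u v) ≡ just s

    search : ∀ s → Dec (∃[ u ] ∃[ v ] Holds s (u , v))
    search s = Fin.any? λ u → Fin.any? λ v → Maybe.≡-dec Fin._≟_ (slot u v (job? u v)) (just s)

    holderOf : ∀ {s} → Dec (∃[ u ] ∃[ v ] Holds s (u , v)) → Maybe (Fin n × Fin n)
    holderOf (yes (u , v , _)) = just (u , v)
    holderOf (no _)            = nothing

    holder-holds : ∀ {s j} (d : Dec (∃[ u ] ∃[ v ] Holds s (u , v))) → holderOf d ≡ just j → Holds s j
    holder-holds (yes (u , v , h)) refl = h

    holds-unique : ∀ {s j j′} → Holds s j → Holds s j′ → j ≡ j′
    holds-unique {s} {u , v} {u′ , v′} h h′ =
      let q , eq = slot-job (job? u v) h
          q′ , eq′ = slot-job (job? u′ v′) h′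
          e₁ , e₂ = Fin.combine-injective _ _ _ _ (trans eq (sym eq′))
      in inj q q′ e₁ e₂

    holder-complete : ∀ {s j} (d : Dec (∃[ u ] ∃[ v ] Holds s (u , v))) → Holds s j → holderOf d ≡ just j
    holder-complete (yes (u , v , h)) h′ = cong just (holds-unique h h′)
    holder-complete (no ¬h)           h  = contradiction (_ , _ , h) ¬h

    feasible : Feasible S
    feasible = matching (λ s → holderOf (search s)) sound unique complete
      where
      sound : ∀ {s j} → holderOf (search s) ≡ just j → IsJob j × Usable S j s
      sound {s} {u , v} eq with slot-job (job? u v) (holder-holds (search s) eq)
      ... | q , refl = q ,
        subst₂ (Ok u v) (sym (owner-combine (w u v q) (i u v q)))
                        (sym (index-combine (w u v q) (i u v q))) (ok q) ,
        subst (_∈ S) (sym (owner-combine (w u v q) (i u v q))) (w∈ q)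
      unique : ∀ {s t j} → holderOf (search s) ≡ just j → holderOf (search t) ≡ just j → s ≡ t
      unique {s} {t} eq eq′ = just-injective
        (trans (sym (holder-holds (search s) eq)) (holder-holds (search t) eq′))
      complete : ∀ {j} → IsJob j → ⊥ ⊎ ∃[ s ] holderOf (search s) ≡ just j
      complete {u , v} q = let s , h = slot-defined (job? u v) q in inj₂ (s , holder-complete (search s) h)

-- The slots of a vertex are numbered 0 … K − 1; the first c w of them carry the
-- edges covered by w.
vertexCoverProblem : ∀ {n} → Graph n → Capacity n → (K : ℕ) → AssignmentProblem n K
vertexCoverProblem G c K = record
  { Job  = λ u v → u Fin.< v × Adjacent G u v
  ; Ok   = λ u v w i → toℕ i < c w × (w ≡ u ⊎ w ≡ v)
  ; job? = λ u v → (u Fin.<? v) ×-dec T? (adj G u v)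
  }

-- The pairs (u , u) stand for the vertices u.  Slot 0 of w can only be taken by
-- w itself, which is how the members of the set are exempt from domination; the
-- next c w slots carry the vertices dominated by w.
dominatingSetProblem : ∀ {n} → Graph n → Capacity n → (K : ℕ) → AssignmentProblem n K
dominatingSetProblem G c K = record
  { Job  = λ u v → u ≡ v
  ; Ok   = λ u v w i → (toℕ i ≡ 0 × w ≡ u) ⊎ (0 < toℕ i × toℕ i ≤ c w × Adjacent G u w)
  ; job? = Fin._≟_
  }

-- This is `min {c w, degree w} ≤ r` for every `w`, phrased for direct use with a workload `x`.
SlotsSuffice : ∀ {n} → Graph n → Capacity n → ℕ → Set
SlotsSuffice G c r = ∀ w {x} → x ≤ c w → x ≤ degree G w → x ≤ r

-- Capacitated vertex covers

module VertexCover {n} (G : Graph n) (c : Capacity n) (r : ℕ) (enough : SlotsSuffice G c r) where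

  open AssignmentProblem (vertexCoverProblem G c (suc r))

  ends-edge : ∀ e → let (u , v) = ends G e in Job u v
  ends-edge e = proj₂ (List.∈-filter⁻ (λ (u , v) → job? u v)
    {xs = cartesianProduct (allFin n) (allFin n)} (List.∈-lookup e))

  ends-injective : ∀ {e e′} → ends G e ≡ ends G e′ → e ≡ e′
  ends-injective = lookup-injective
    (Unique.filter⁺ (λ (u , v) → job? u v)
      (Unique.cartesianProduct⁺ (Unique.allFin⁺ n) (Unique.allFin⁺ n))) _ _

  edge∈ : ∀ {u v} → Job u v → (u , v) List.∈ edges G
  edge∈ {u} {v} q = List.∈-filter⁺ (λ (u , v) → job? u v)
    (List.∈-cartesianProduct⁺ (List.∈-allFin u) (List.∈-allFin v)) q

  edge : ∀ {u v} → Job u v → Edge G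
  edge q = Any.index (edge∈ q)

  ends-edge≡ : ∀ {u v} (q : Job u v) → (u , v) ≡ ends G (edge q)
  ends-edge≡ q = Any.lookup-index (edge∈ q)

  -- An edge assigned to `v` is determined by its other end, a neighbour of `v`; the rank of this
  -- end among the neighbours injects the edges into the numbers below the degree.
  workload≤degree : (α : Edge G → Fin n) → (∀ e → α e ≡ proj₁ (ends G e) ⊎ α e ≡ proj₂ (ends G e)) →
                ∀ v → ∣ preimage α v ∣ ≤ degree G v
  workload≤degree α incident v = ∣∣-injection (preimage α v) (degree G v)
    (λ e → countBelow (tabulate (adj G v)) (toℕ (other e)))
    (λ e∈ → rank-< (tabulate (adj G v)) (other∈ _ (∈-preimage⁻ {f = α} e∈)))
    (λ {e} {e′} e∈ e′∈ eq → let a = ∈-preimage⁻ {f = α} e∈ ; a′ = ∈-preimage⁻ {f = α} e′∈ in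
       other-injective e e′ a a′
         (rank-injective (tabulate (adj G v)) (other∈ e a) (other∈ e′ a′) eq))
    where
    other : Edge G → Fin n
    other e = if does (proj₁ (ends G e) Fin.≟ v) then proj₂ (ends G e) else proj₁ (ends G e)
    other-cases : ∀ e → α e ≡ v → (proj₁ (ends G e) ≡ v × proj₂ (ends G e) ≡ other e)
                                ⊎ (proj₂ (ends G e) ≡ v × proj₁ (ends G e) ≡ other e)
    other-cases e eq with proj₁ (ends G e) Fin.≟ v | incident e
    ... | yes u≡v | _        = inj₁ (u≡v , refl)
    ... | no u≢v  | inj₁ αe = contradiction (trans (sym αe) eq) u≢v
    ... | no u≢v  | inj₂ αe = inj₂ (trans (sym αe) eq , refl)
    other∈ : ∀ e → α e ≡ v → other e ∈ tabulate (adj G v)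
    other∈ e eq with other-cases e eq
    ... | inj₁ (p , q) = ∈-tabulate⁺ (T⇒≡ (subst₂ (Adjacent G) p q (proj₂ (ends-edge e))))
    ... | inj₂ (p , q) = ∈-tabulate⁺ (trans (symmetric G v (other e))
                           (T⇒≡ (subst₂ (Adjacent G) q p (proj₂ (ends-edge e)))))
    other-injective : ∀ e e′ → α e ≡ v → α e′ ≡ v → other e ≡ other e′ → e ≡ e′
    other-injective e e′ a a′ eq with other-cases e a | other-cases e′ a′
    ... | inj₁ (p , q) | inj₁ (p′ , q′) = ends-injective (cong₂ _,_ (trans p (sym p′)) (trans q (trans eq (sym q′))))
    ... | inj₂ (p , q) | inj₂ (p′ , q′) = ends-injective (cong₂ _,_ (trans q (trans eq (sym q′))) (trans p (sym p′)))
    -- One edge lists `v` first and the other lists it second, yet each lists its smaller end first.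
    ... | inj₁ (p , q) | inj₂ (p′ , q′) = contradiction
      (subst₂ Fin._<_ p (trans q (trans eq (sym q′))) (proj₁ (ends-edge e)))
      (ℕ.<-asym (subst (proj₁ (ends G e′) Fin.<_) p′ (proj₁ (ends-edge e′))))
    ... | inj₂ (p , q) | inj₁ (p′ , q′) = contradiction
      (subst₂ Fin._<_ p′ (trans q′ (trans (sym eq) (sym q))) (proj₁ (ends-edge e′)))
      (ℕ.<-asym (subst (proj₁ (ends G e) Fin.<_) p (proj₁ (ends-edge e))))

  to : ∀ {S} → IsCapacitatedVertexCover G c S → Feasible S
  to {S} (α , α∈ , incident , workload) = FromFunction.feasible w i ok
    (λ q → α∈ (edge q)) inj
    where
    w : ∀ u v → Job u v → Fin n
    w u v q = α (edge q)
    -- The edges assigned to one vertex occupy its slots in the order of their ranks among each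
    -- other.
    rk : ∀ {u v} → Job u v → ℕ
    rk {u} {v} q = countBelow (preimage α (w u v q)) (toℕ (edge q))
    rk< : ∀ {u v} (q : Job u v) → rk q < ∣ preimage α (w u v q) ∣
    rk< {u} {v} q = rank-< (preimage α (w u v q)) (∈-preimage⁺ {f = α} refl)
    rk<K : ∀ {u v} (q : Job u v) → rk q < suc r
    rk<K {u} {v} q = ℕ.m≤n⇒m≤1+n (ℕ.≤-trans (rk< q)
      (enough (w u v q) (workload _ (α∈ (edge q))) (workload≤degree α incident (w u v q))))
    i : ∀ u v → Job u v → Fin (suc r)
    i u v q = fromℕ< (rk<K q)
    ok : ∀ {u v} (q : Job u v) → toℕ (i u v q) < c (w u v q) × (w u v q ≡ u ⊎ w u v q ≡ v)
    ok q rewrite Fin.toℕ-fromℕ< (rk<K q) = ℕ.≤-trans (rk< q) (workload _ (α∈ (edge q))) ,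
      subst (λ (u , v) → α (edge q) ≡ u ⊎ α (edge q) ≡ v) (sym (ends-edge≡ q)) (incident (edge q))
    inj : ∀ {u v u′ v′} (q : Job u v) (q′ : Job u′ v′) →
          w u v q ≡ w u′ v′ q′ → i u v q ≡ i u′ v′ q′ → (u , v) ≡ (u′ , v′)
    inj q q′ eq eq′ = trans (ends-edge≡ q) (trans (cong (ends G)
      (rank-injective (preimage α (α (edge q))) (∈-preimage⁺ {f = α} refl) (∈-preimage⁺ {f = α} (sym eq))
        (trans (Fin.fromℕ<-injective _ _ (rk<K q) (rk<K q′) eq′)
               (cong (λ x → countBelow (preimage α x) (toℕ (edge q′))) (sym eq)))))
      (sym (ends-edge≡ q′)))

  from : ∀ {S} → Feasible S → IsCapacitatedVertexCover G c S
  from {S} m = α , (λ e → proj₂ (proj₂ (here! e))) , (λ e → proj₂ (proj₁ (proj₂ (here! e)))) , workload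
    where
    module M = Matching m
    slotOf! : ∀ e → ∃[ s ] M.at s ≡ just (ends G e)
    slotOf! e = slotOf m (ends-edge e)
    here! : ∀ e → Job _ _ × Usable S (ends G e) (proj₁ (slotOf! e))
    here! e = M.sound (proj₂ (slotOf! e))
    α : Edge G → Fin n
    α e = owner (proj₁ (slotOf! e))
    workload : ∀ v → v ∈ S → ∣ preimage α v ∣ ≤ c v
    workload v v∈S = ∣∣-injection (preimage α v) (c v) (λ e → toℕ (index (proj₁ (slotOf! e))))
      (λ {e} e∈ → subst (λ x → _ < c x) (∈-preimage⁻ {f = α} e∈) (proj₁ (proj₁ (proj₂ (here! e)))))
      (λ {e} {e′} e∈ e′∈ eq → ends-injective (just-injective (trans (sym (proj₂ (slotOf! e)))
         (trans (cong M.at (slot-injective (trans (∈-preimage⁻ {f = α} e∈) (sym (∈-preimage⁻ {f = α} e′∈)))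
                                           (Fin.toℕ-injective eq)))
                (proj₂ (slotOf! e′))))))

-- Capacitated dominating sets

module DominatingSet {n} (G : Graph n) (c : Capacity n) (r : ℕ) (enough : SlotsSuffice G c r) where

  open AssignmentProblem (dominatingSetProblem G c (suc r))

  to : ∀ {S} → IsCapacitatedDominatingSet G c S → Feasible S
  to {S} (β , β∈ , βadj , workload) = FromFunction.feasible w i ok w∈ inj
    where
    clients : Fin n → Subset n
    clients x = ∁ S ∩ preimage β x
    client : ∀ {u} → u ∉ S → u ∈ clients (β u)
    client u∉ = Subset.x∈p∩q⁺ (Subset.x∉p⇒x∈∁p u∉ , ∈-preimage⁺ {f = β} refl)
    rk : Fin n → ℕ
    rk u = countBelow (clients (β u)) (toℕ u)
    workload≤degree : ∀ x → ∣ clients x ∣ ≤ degree G x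
    workload≤degree x = Subset.p⊆q⇒∣p∣≤∣q∣ λ {u} u∈ →
      let u∈∁S , u∈pre = Subset.x∈p∩q⁻ (∁ S) (preimage β x) u∈ in
      ∈-tabulate⁺ (trans (symmetric G x u)
        (T⇒≡ (subst (Adjacent G u) (∈-preimage⁻ {f = β} u∈pre) (βadj u (Subset.x∈∁p⇒x∉p u∈∁S)))))
    rk< : ∀ {u} → u ∉ S → rk u < ∣ clients (β u) ∣
    rk< {u} u∉ = rank-< (clients (β u)) (client u∉)
    -- Ranks are shifted up by one, since slot 0 of a vertex is reserved for the vertex itself.
    rk<r : ∀ {u} → u ∉ S → suc (rk u) < suc r
    rk<r {u} u∉ = s≤s (ℕ.≤-trans (rk< u∉) (enough (β u) (workload _ (β∈ u u∉)) (workload≤degree (β u))))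
    owner′ : ∀ u → Dec (u ∈ S) → Fin n
    owner′ u (yes _) = u
    owner′ u (no _)  = β u
    index′ : ∀ u → Dec (u ∈ S) → Fin (suc r)
    index′ u (yes _)  = zero
    index′ u (no u∉) = fromℕ< (rk<r u∉)
    w : ∀ u v → u ≡ v → Fin n
    w u v _ = owner′ u (u Subset.∈? S)
    i : ∀ u v → u ≡ v → Fin (suc r)
    i u v _ = index′ u (u Subset.∈? S)
    ok : ∀ {u v} (q : u ≡ v) → (toℕ (i u v q) ≡ 0 × w u v q ≡ u) ⊎
         (0 < toℕ (i u v q) × toℕ (i u v q) ≤ c (w u v q) × Adjacent G u (w u v q))
    ok {u} q with u Subset.∈? S
    ... | yes u∈ = inj₁ (refl , refl)
    ... | no u∉  rewrite Fin.toℕ-fromℕ< (rk<r u∉) =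
      inj₂ (s≤s z≤n , ℕ.≤-trans (rk< u∉) (workload _ (β∈ u u∉)) , βadj u u∉)
    w∈ : ∀ {u v} (q : u ≡ v) → w u v q ∈ S
    w∈ {u} q with u Subset.∈? S
    ... | yes u∈ = u∈
    ... | no u∉  = β∈ u u∉
    inj : ∀ {u v u′ v′} (q : u ≡ v) (q′ : u′ ≡ v′) →
          w u v q ≡ w u′ v′ q′ → i u v q ≡ i u′ v′ q′ → (u , v) ≡ (u′ , v′)
    inj {u} {_} {u′} refl refl eq eq′ with u Subset.∈? S | u′ Subset.∈? S
    ... | yes _ | yes _ = cong₂ _,_ eq eq
    ... | yes _ | no u′∉ = case trans (cong toℕ eq′) (Fin.toℕ-fromℕ< (rk<r u′∉)) of λ ()
    ... | no u∉ | yes _  = case trans (sym (cong toℕ eq′)) (Fin.toℕ-fromℕ< (rk<r u∉)) of λ ()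
    ... | no u∉ | no u′∉ = cong₂ _,_ same same
      where
      same : u ≡ u′
      same = rank-injective (clients (β u)) (client u∉) (subst (λ x → u′ ∈ clients x) (sym eq) (client u′∉))
        (trans (ℕ.suc-injective (Fin.fromℕ<-injective _ _ (rk<r u∉) (rk<r u′∉) eq′))
               (cong (λ x → countBelow (clients x) (toℕ u′)) (sym eq)))

  from : ∀ {S} → Feasible S → IsCapacitatedDominatingSet G c S
  from {S} m = β , (λ v v∉ → proj₂ (proj₂ (here! v))) , (λ v v∉ → proj₂ (proj₂ (proj₂ (dominated v v∉)))) , workload
    where
    module M = Matching m
    slotOf! : ∀ u → ∃[ s ] M.at s ≡ just (u , u)
    slotOf! u = slotOf m refl
    here! : ∀ u → u ≡ u × Usable S (u , u) (proj₁ (slotOf! u))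
    here! u = M.sound (proj₂ (slotOf! u))
    β : Fin n → Fin n
    β u = owner (proj₁ (slotOf! u))
    position : Fin n → ℕ
    position u = toℕ (index (proj₁ (slotOf! u)))
    dominated : ∀ u → u ∉ S → u ≡ u × 0 < position u × position u ≤ c (β u) × Adjacent G u (β u)
    dominated u u∉ with here! u
    -- Slot 0 would be owned by `u` itself, but owners of used slots lie in `S`.
    ... | _ , inj₁ (_ , eq) , w∈ = contradiction (subst (_∈ S) eq w∈) u∉
    ... | _ , inj₂ x        , w∈ = refl , x
    workload : ∀ w → w ∈ S → ∣ ∁ S ∩ preimage β w ∣ ≤ c w
    -- The clients of `w` sit in slots 1 to `c w`; shifting down by one fits them below `c w`.
    workload w w∈S = ∣∣-injection (∁ S ∩ preimage β w) (c w) (λ u → pred (position u))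
      (λ {u} u∈ → let u∉ , eq = split u∈ ; _ , 0<p , p≤c , _ = dominated u u∉ in
         subst (pred (position u) <_) (cong c eq) (ℕ.≤-trans (ℕ.≤-reflexive (suc-pred! 0<p)) p≤c))
      (λ {u} {u′} u∈ u′∈ eq →
         let u∉ , e = split u∈ ; u′∉ , e′ = split u′∈
             _ , 0<p , _ = dominated u u∉ ; _ , 0<p′ , _ = dominated u′ u′∉ in
         cong proj₁ (just-injective (trans (sym (proj₂ (slotOf! u)))
           (trans (cong M.at (slot-injective (trans e (sym e′))
             (Fin.toℕ-injective (trans (sym (suc-pred! 0<p)) (trans (cong suc eq) (suc-pred! 0<p′))))))
             (proj₂ (slotOf! u′))))))
      where
      split : ∀ {u} → u ∈ ∁ S ∩ preimage β w → u ∉ S × β u ≡ w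
      split u∈ = let a , b = Subset.x∈p∩q⁻ (∁ S) (preimage β w) u∈ in
        Subset.x∈∁p⇒x∉p a , ∈-preimage⁻ {f = β} b
      suc-pred! : ∀ {x} → 0 < x → suc (pred x) ≡ x
      suc-pred! (s≤s _) = refl

-- The search program and its correctness

-- Truth is being nonzero. Truncated subtraction provides negation as `lit 1 ⊟ e`, and conjunction
-- follows by De Morgan.
andₑ : Expr → Expr → Expr
andₑ e e′ = lit 1 ⊟ ((lit 1 ⊟ e) ⊞ (lit 1 ⊟ e′))

Decides : ℕ → Set → Set
Decides a P = (P → a ≢ 0) × (a ≢ 0 → P)

not-suc : ∀ {a} → a ≢ 0 → 1 ∸ a ≡ 0
not-suc {zero}  a≢0 = contradiction refl a≢0
not-suc {suc a} _   = ℕ.0∸n≡0 a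

not-suc⁻ : ∀ {a} → 1 ∸ a ≡ 0 → a ≢ 0
not-suc⁻ {suc a} _ ()

decides-and : ∀ {a b P Q} → Decides a P → Decides b Q → Decides (1 ∸ ((1 ∸ a) + (1 ∸ b))) (P × Q)
decides-and {a} {b} (f , g) (f′ , g′) =
  (λ (p , q) → subst (λ x → 1 ∸ x ≢ 0) (sym (cong₂ _+_ (not-suc (f p)) (not-suc (f′ q)))) λ ()) ,
  λ ne → g (not-suc⁻ (ℕ.m+n≡0⇒m≡0 (1 ∸ a) (sum≡0 ne))) , g′ (not-suc⁻ (ℕ.m+n≡0⇒n≡0 (1 ∸ a) (sum≡0 ne)))
  where
  sum≡0 : ∀ {x} → 1 ∸ x ≢ 0 → x ≡ 0
  sum≡0 {zero}  _  = refl
  sum≡0 {suc x} ne = contradiction (ℕ.0∸n≡0 x) ne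

decides-or : ∀ {a b P Q} → Decides a P → Decides b Q → Decides (a + b) (P ⊎ Q)
decides-or {zero} (f , g) (f′ , g′) =
  (λ { (inj₁ p) → contradiction refl (f p) ; (inj₂ q) → f′ q }) , inj₂ ∘ g′
decides-or {suc a} (f , g) _ = (λ _ ()) , λ _ → inj₁ (g λ ())

decides-< : ∀ a b → Decides (b ∸ a) (a < b)
decides-< a b = (λ a<b → ℕ.m>n⇒m∸n≢0 a<b) , ℕ.m∸n≢0⇒n<m

decides-bit : ∀ b → Decides (bit b) (T b)
decides-bit true  = (λ _ ()) , (λ _ → tt)
decides-bit false = (λ ()) , (λ ne → contradiction refl ne)

decides-map : ∀ {a P Q} → (P → Q) → (Q → P) → Decides a P → Decides a Q
decides-map f g (h , k) = h ∘ g , f ∘ k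

price held heldᵤ heldᵥ chosen current visited queue powers : Array
price   = # 0
held    = # 1
heldᵤ   = # 2
heldᵥ   = # 3
chosen  = # 4
current = # 5
visited = # 6
queue   = # 7
powers  = # 8

slotₑ slotsₑ : Expr
slotₑ  = 2 ⊠ var 3 ⊞ var 4
slotsₑ = 0 ⊠ par 2

-- `swap` carries out a bid: the waiting job takes the slot in register 11 at a price one above that
-- in register 10, and the former content of the slot becomes the waiting job.
clear swap : Cmd
clear = loop 3 0 (loop 4 2 (price ⟦ slotₑ ⟧← lit 0 ⨾ held ⟦ slotₑ ⟧← lit 0))
swap  =
  12 ← held ⟦ var 11 ⟧ ⨾ 13 ← heldᵤ ⟦ var 11 ⟧ ⨾ 14 ← heldᵥ ⟦ var 11 ⟧ ⨾
  held ⟦ var 11 ⟧← lit 1 ⨾ heldᵤ ⟦ var 11 ⟧← var 7 ⨾ heldᵥ ⟦ var 11 ⟧← var 8 ⨾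
  price ⟦ var 11 ⟧← var 10 ⊞ lit 1 ⨾
  6 ← var 12 ⨾ 7 ← var 13 ⨾ 8 ← var 14

-- B is where the arrays start in memory, K the number of slots per vertex,
-- P = n ^ K the number of K-tuples of vertices, and T exceeds (n K)².
environment : (n B K P T : ℕ) → ℕ → ℕ
environment n B K P T 0 = n
environment n B K P T 1 = B
environment n B K P T 2 = K
environment n B K P T 3 = P
environment n B K P T 4 = T
environment n B K P T _ = 0

Represents : ∀ {n} → (ℕ → ℕ) → Subset n → Set
Represents a S = ∀ u → a (toℕ u) ≡ bit (lookup S u)

bit≢0 : ∀ {b} → bit b ≢ 0 → b ≡ true
bit≢0 {true}  _  = refl
bit≢0 {false} ne = contradiction refl ne

decides-∈ : ∀ {n} {a} {S : Subset n} → Represents a S → ∀ u → Decides (a (toℕ u)) (u ∈ S)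
decides-∈ {a = a} {S} rep u =
  (λ u∈ eq → case trans (sym (cong bit (∈⇒lookup u∈))) (trans (sym (rep u)) eq) of λ ()) ,
  (λ ne → lookup⇒∈ (bit≢0 (ne ∘ trans (rep u))))

[↦]-at : ∀ (f : ℕ → ℕ) {i j} a → j ≡ i → (f [ i ↦ a ]) j ≡ a
[↦]-at f a refl = [↦]-same f _ a

-- Subsets, tuples and lists of subsets as numbers and arrays

infixl 6 _∖_
_∖_ : ∀ {n} → Subset n → Fin n → Subset n
S ∖ u = S [ u ]≔ false

∈-update-other : ∀ {n} {S : Subset n} {u v b} → v ≢ u → v ∈ S → v ∈ S [ u ]≔ b
∈-update-other {S = S} {u} {v} {b} v≢u v∈ = lookup⇒∈ (trans (Vec.lookup∘update′ v≢u S b) (∈⇒lookup v∈))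

∈-update-other⁻ : ∀ {n} {S : Subset n} {u v b} → v ≢ u → v ∈ S [ u ]≔ b → v ∈ S
∈-update-other⁻ {S = S} {u} {v} {b} v≢u v∈ =
  lookup⇒∈ (trans (sym (Vec.lookup∘update′ v≢u S b)) (∈⇒lookup v∈))

∈-insert : ∀ {n} (S : Subset n) u → u ∈ S [ u ]≔ true
∈-insert S u = lookup⇒∈ (Vec.lookup∘update u S true)

∉-∖ : ∀ {n} (S : Subset n) u → u ∉ S ∖ u
∉-∖ S u u∈ = case trans (sym (∈⇒lookup u∈)) (Vec.lookup∘update u S false) of λ ()

∈-∖⁻ : ∀ {n} {S : Subset n} {u v} → v ∈ S ∖ u → v ∈ S × v ≢ u
∈-∖⁻ {S = S} {u} {v} v∈ = let v≢u = λ { refl → ∉-∖ S u v∈ } in ∈-update-other⁻ v≢u v∈ , v≢u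

∖-⊆ : ∀ {n} {S : Subset n} {u} → S ∖ u ⊆ S
∖-⊆ {S = S} v∈ = proj₁ (∈-∖⁻ {S = S} v∈)

∖-mono : ∀ {n} {S S′ : Subset n} {u} → S ⊆ S′ → S ∖ u ⊆ S′ ∖ u
∖-mono {S = S} {S′} S⊆S′ v∈ = let v∈S , v≢u = ∈-∖⁻ {S = S} v∈ in ∈-update-other v≢u (S⊆S′ v∈S)

⊆-∖ : ∀ {n} {S S′ : Subset n} {u} → S′ ⊆ S → u ∉ S′ → S′ ⊆ S ∖ u
⊆-∖ S′⊆S u∉ v∈ = ∈-update-other (λ { refl → u∉ v∈ }) (S′⊆S v∈)

represents-update : ∀ {n} {a : ℕ → ℕ} {S : Subset n} u b → Represents a S →
                    Represents (a [ toℕ u ↦ bit b ]) (S [ u ]≔ b)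
represents-update {a = a} {S} u b rep v with v Fin.≟ u
... | yes refl = trans ([↦]-same a (toℕ u) (bit b)) (cong bit (sym (Vec.lookup∘update u S b)))
... | no v≢u   = trans ([↦]-other a (bit b) (v≢u ∘ Fin.toℕ-injective))
                       (trans (rep v) (cong bit (sym (Vec.lookup∘update′ v≢u S b))))

insertAll : ∀ {n k} → Vec (Fin n) k → Subset n → Subset n
insertAll []       S = S
insertAll (d ∷ ds) S = insertAll ds (S [ d ]≔ true)

-- The value of `ds` as a numeral in base n, most significant digit first. A loop over `n ^ K`
-- thereby runs through all K-tuples of vertices.
horner : ∀ {n k} → Vec (Fin n) k → ℕ
horner []                   = 0
horner {n} {suc k} (d ∷ ds) = n ^ k * toℕ d + horner ds

numeral : ∀ {n k} → Vec (Fin n) k → Fin (n ^ k)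
numeral []       = zero
numeral (d ∷ ds) = combine d (numeral ds)

toℕ-numeral : ∀ {n k} (ds : Vec (Fin n) k) → toℕ (numeral ds) ≡ horner ds
toℕ-numeral []       = refl
toℕ-numeral {n} {suc k} (d ∷ ds) =
  trans (Fin.toℕ-combine d (numeral ds)) (cong (n ^ k * toℕ d +_) (toℕ-numeral ds))

horner-< : ∀ {n k} (ds : Vec (Fin n) k) → horner ds < n ^ k
horner-< ds = subst (_< _) (toℕ-numeral ds) (Fin.toℕ<n (numeral ds))

digits : ∀ {n} k → Fin (n ^ k) → Vec (Fin n) k
digits zero    t = []
digits {n} (suc k) t = proj₁ (remQuot {n} (n ^ k) t) ∷ digits k (proj₂ (remQuot {n} (n ^ k) t))

horner-digits : ∀ {n} k (t : Fin (n ^ k)) → horner (digits k t) ≡ toℕ t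
horner-digits zero    zero = refl
horner-digits {n} (suc k) t = trans
  (cong (n ^ k * toℕ (proj₁ (remQuot {n} (n ^ k) t)) +_) (horner-digits k (proj₂ (remQuot {n} (n ^ k) t))))
  (trans (sym (Fin.toℕ-combine (proj₁ (remQuot {n} (n ^ k) t)) (proj₂ (remQuot {n} (n ^ k) t))))
         (cong toℕ (Fin.combine-remQuot {n} (n ^ k) t)))

horner-injective : ∀ {n k} {ds es : Vec (Fin n) k} → horner ds ≡ horner es → ds ≡ es
horner-injective {ds = []}     {[]}     eq = refl
horner-injective {ds = d ∷ ds} {e ∷ es} eq with Fin.combine-injective d (numeral ds) e (numeral es)
  (Fin.toℕ-injective (trans (toℕ-numeral (d ∷ ds)) (trans eq (sym (toℕ-numeral (e ∷ es))))))
... | refl , eq′ = cong (d ∷_) (horner-injective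
  (trans (sym (toℕ-numeral ds)) (trans (cong toℕ eq′) (toℕ-numeral es))))

characteristic : ∀ {n} → Subset n → ℕ → ℕ
characteristic S = contents (encodeSubset S)

characteristic-lookup : ∀ {n} (S : Subset n) u → characteristic S (toℕ u) ≡ bit (lookup S u)
characteristic-lookup (b ∷ S) zero    = refl
characteristic-lookup (b ∷ S) (suc u) = characteristic-lookup S u

binary : (ℕ → ℕ) → ℕ → ℕ
binary f zero    = 0
binary f (suc k) = binary f k + binary f k + f k

-- An address in the array `visited`. The machine obtains it by doubling and adding, one vertex at a
-- time.
code : ∀ {n} → Subset n → ℕ
code {n} S = binary (characteristic S) n

double-bit-injective : ∀ a b x y → a + a + bit x ≡ b + b + bit y → a ≡ b × x ≡ y
double-bit-injective a b x y eq = go x y (trans (sym (form a x)) (trans eq (form b y)))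
  where
  form : ∀ a x → a + a + bit x ≡ bit x + 2 * a
  form a x = trans (ℕ.+-comm (a + a) (bit x)) (cong (λ z → bit x + (a + z)) (sym (ℕ.+-identityʳ a)))
  go : ∀ x y → bit x + 2 * a ≡ bit y + 2 * b → a ≡ b × x ≡ y
  go false false e = ℕ.*-cancelˡ-≡ a b 2 e , refl
  go true  true  e = ℕ.*-cancelˡ-≡ a b 2 (ℕ.suc-injective e) , refl
  go false true  e = contradiction e (ℕ.even≢odd a b)
  go true  false e = contradiction (sym e) (ℕ.even≢odd b a)

code-injective : ∀ {n} {S S′ : Subset n} → code S ≡ code S′ → S ≡ S′
code-injective {n} {S} {S′} eq = Subset.⊆-antisym
  (λ {u} u∈ → lookup⇒∈ (trans (sym (same u)) (∈⇒lookup u∈)))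
  (λ {u} u∈ → lookup⇒∈ (trans (same u) (∈⇒lookup u∈)))
  where
  agree-below : ∀ k → k ≤ n → binary (characteristic S) k ≡ binary (characteristic S′) k →
                ∀ u → toℕ u < k → lookup S u ≡ lookup S′ u
  agree-below (suc k) k<n eq u u≤k =
    let v = fromℕ< k<n
        at : ∀ S → characteristic S k ≡ bit (lookup S v)
        at S = trans (cong (characteristic S) (sym (Fin.toℕ-fromℕ< k<n))) (characteristic-lookup S v)
        e , e′ = double-bit-injective _ _ (lookup S v) (lookup S′ v)
          (trans (cong (binary (characteristic S) k + binary (characteristic S) k +_) (sym (at S)))
            (trans eq (cong (binary (characteristic S′) k + binary (characteristic S′) k +_) (at S′))))
    in case ℕ.m<1+n⇒m<n∨m≡n u≤k of λ
      { (inj₁ u<k) → agree-below k (ℕ.<⇒≤ k<n) e u u<k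
      ; (inj₂ u≡k) → subst (λ w → lookup S w ≡ lookup S′ w)
                       (Fin.toℕ-injective (trans (Fin.toℕ-fromℕ< k<n) (sym u≡k))) e′ }
  same : ∀ u → lookup S u ≡ lookup S′ u
  same u = agree-below n ℕ.≤-refl eq u (Fin.toℕ<n u)

-- The queue is one array in which row i starts at entry n * i; the index is the row at which the
-- list begins.
data Rows {n} (a : ℕ → ℕ) : ℕ → List (Subset n) → Set where
  []  : ∀ {k} → Rows a k []
  _∷_ : ∀ {k S L} → (∀ u → a (n * k + toℕ u) ≡ bit (lookup S u)) → Rows a (suc k) L → Rows a k (S ∷ L)

rows-∷ʳ : ∀ {n} {a a′ : ℕ → ℕ} {k S} (L : List (Subset n)) →
          (∀ x → x < n * (k + length L) → a′ x ≡ a x) →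
          (∀ u → a′ (n * (k + length L) + toℕ u) ≡ bit (lookup S u)) →
          Rows a k L → Rows a′ k (L ++ [ S ])
rows-∷ʳ {n} {a′ = a′} {k} [] same row [] =
  (λ u → trans (cong (λ j → a′ (n * j + toℕ u)) (sym (ℕ.+-identityʳ k))) (row u)) ∷ []
rows-∷ʳ {n} {a} {a′} {k} (S ∷ L) same row (r ∷ rs) =
  (λ u → trans (same _ (ℕ.≤-trans (ℕ.+-monoʳ-< (n * k) (Fin.toℕ<n u))
                 (ℕ.≤-trans (ℕ.≤-reflexive (trans (ℕ.+-comm (n * k) n) (sym (ℕ.*-suc n k))))
                            (ℕ.*-monoʳ-≤ n (ℕ.≤-trans (ℕ.m≤m+n (suc k) (length L)) (ℕ.≤-reflexive (sym (ℕ.+-suc k (length L)))))))))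
               (r u))
  ∷ rows-∷ʳ L (λ x lt → same x (ℕ.≤-trans lt (ℕ.≤-reflexive (cong (n *_) (sym (ℕ.+-suc k (length L)))))))
              (λ u → trans (cong (λ j → a′ (n * j + toℕ u)) (sym (ℕ.+-suc k (length L)))) (row u)) rs

rows-lookup : ∀ {n} {a : ℕ → ℕ} {k S} (L : List (Subset n)) {L′} → Rows a k (L ++ S ∷ L′) →
              ∀ u → a (n * (k + length L) + toℕ u) ≡ bit (lookup S u)
rows-lookup {n} {a} {k} {S} [] (r ∷ _) u =
  trans (cong (λ j → a (n * j + toℕ u)) (ℕ.+-identityʳ k)) (r u)
rows-lookup {n} {a} {k} (_ ∷ L) (_ ∷ rs) u =
  trans (cong (λ j → a (n * j + toℕ u)) (ℕ.+-suc k (length L))) (rows-lookup L rs u)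

-- There is no division, so the digits of the number in register 21 are found by subtracting the
-- power `n ^ (K ∸ (j + 1))` while it fits. A digit is below n, so n attempts suffice. Each digit
-- names a vertex to insert.
extend : Cmd
extend =
  22 ← var 21 ⨾
  loop 24 2
    (23 ← lit 0 ⨾
     loop 25 0 (when (var 22 ⊞ lit 1 ⊟ powers ⟦ par 2 ⊟ (var 24 ⊞ lit 1) ⟧)
                  (22 ← var 22 ⊟ powers ⟦ par 2 ⊟ (var 24 ⊞ lit 1) ⟧ ⨾ 23 ← var 23 ⊞ lit 1)) ⨾
     chosen ⟦ var 23 ⟧← lit 1)

enqueue : Cmd
enqueue =
  16 ← lit 0 ⨾
  loop 17 0 (16 ← var 16 ⊞ var 16 ⊞ chosen ⟦ var 17 ⟧) ⨾
  ifₑ (visited ⟦ var 16 ⟧) skip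
    (visited ⟦ var 16 ⟧← lit 1 ⨾
     loop 17 0 (queue ⟦ 0 ⊠ var 18 ⊞ var 17 ⟧← chosen ⟦ var 17 ⟧) ⨾
     18 ← var 18 ⊞ lit 1)

dequeue : Cmd
dequeue = loop 17 0 (current ⟦ var 17 ⟧← queue ⟦ 0 ⊠ var 19 ⊞ var 17 ⟧ ⨾ out (current ⟦ var 17 ⟧))

-- The expressions jobₑ and okₑ decide whether the pair in registers 1 and 2 is
-- a job, and whether the job in registers 7 and 8 may take the slot of the
-- vertex in register 3 whose number is in register 4.  Register 5 is set when a
-- set is found infeasible; register 6 tells whether 7 and 8 hold a job without a
-- slot; 10 and 11 hold the best price and slot found so far.  Registers 18 and
-- 19 count the solutions stored in the queue and those already processed, and
-- register 0 is their difference.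
module Programs (jobₑ okₑ : Expr) where

  scan round attempt feasible : Cmd
  scan = when (andₑ okₑ (andₑ (chosen ⟦ var 3 ⟧) (var 10 ⊟ price ⟦ slotₑ ⟧)))
              (10 ← price ⟦ slotₑ ⟧ ⨾ 11 ← slotₑ)
  round = 10 ← slotsₑ ⨾ loop 3 0 (loop 4 2 scan) ⨾ when (slotsₑ ⊟ var 10) swap
  attempt =
    6 ← lit 1 ⨾ 7 ← var 1 ⨾ 8 ← var 2 ⨾
    loop 9 4 (when (var 6) round) ⨾
    when (var 6) (5 ← lit 1)
  feasible =
    (5 ← lit 0 ⨾ 6 ← lit 0) ⨾ clear ⨾
    loop 1 0 (loop 2 0 (when (andₑ jobₑ (lit 1 ⊟ var 5)) attempt))

  minimise attempt-insert process advance-search start-search : Cmd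
  minimise = loop 15 0 (when (chosen ⟦ var 15 ⟧)
    (chosen ⟦ var 15 ⟧← lit 0 ⨾ feasible ⨾ when (var 5) (chosen ⟦ var 15 ⟧← lit 1)))
  attempt-insert = feasible ⨾ ifₑ (var 5) skip (minimise ⨾ enqueue)
  process = loop 20 0 (when (current ⟦ var 20 ⟧)
    (loop 21 3 (loop 17 0 (chosen ⟦ var 17 ⟧← current ⟦ var 17 ⟧) ⨾
                chosen ⟦ var 20 ⟧← lit 0 ⨾ extend ⨾ attempt-insert)))
  advance-search = 19 ← var 19 ⊞ lit 1 ⨾ process ⨾ 0 ← var 18 ⊟ var 19
  start-search = loop 17 0 (chosen ⟦ var 17 ⟧← lit 1) ⨾ attempt-insert ⨾ 0 ← var 18 ⊟ var 19

-- Bounds on codes, and padded tuples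

binary-< : ∀ f k → (∀ i → i < k → f i ≤ 1) → binary f k < 2 ^ k
binary-< f zero    bits = s≤s z≤n
binary-< f (suc k) bits = begin-strict
  binary f k + binary f k + f k       ≤⟨ ℕ.+-monoʳ-≤ _ (bits k ℕ.≤-refl) ⟩
  binary f k + binary f k + 1         <⟨ ℕ.≤-reflexive (regroup (binary f k)) ⟩
  suc (binary f k) + (suc (binary f k) + 0) ≤⟨ ℕ.*-monoʳ-≤ 2 (binary-< f k (λ i i<k → bits i (ℕ.m≤n⇒m≤1+n i<k))) ⟩
  2 ^ suc k                           ∎
  where
  open ℕ.≤-Reasoning
  regroup : ∀ b → suc (b + b + 1) ≡ suc b + (suc b + 0)
  regroup = solve 1 (λ b → con 1 :+ (b :+ b :+ con 1) := con 1 :+ b :+ (con 1 :+ b :+ con 0)) refl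
    where open +-*-Solver

bit≤1 : ∀ b → bit b ≤ 1
bit≤1 true  = ℕ.≤-refl
bit≤1 false = z≤n

code-< : ∀ {n} (S : Subset n) → code S < 2 ^ n
code-< {n} S = binary-< (characteristic S) n λ i i<n →
  subst (_≤ 1) (trans (sym (characteristic-lookup S (fromℕ< i<n))) (cong (characteristic S) (Fin.toℕ-fromℕ< i<n)))
    (bit≤1 (lookup S (fromℕ< i<n)))

-- This bounds the number of passes of the main loop, and hence proves its termination.
unique-length : ∀ {n} {L : List (Subset n)} → Unique L → length L ≤ 2 ^ n
unique-length {n} {L} u = Fin.injective⇒≤ {f = λ i → fromℕ< (code-< (List.lookup L i))}
  λ {i} {j} eq → lookup-injective u i j
    (code-injective (Fin.fromℕ<-injective _ _ (code-< (List.lookup L i)) (code-< (List.lookup L j)) eq))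

applyUpTo-characteristic : ∀ {n} (S : Subset n) → applyUpTo (characteristic S) n ≡ encodeSubset S
applyUpTo-characteristic []      = refl
applyUpTo-characteristic (b ∷ S) = cong (bit b ∷_) (applyUpTo-characteristic S)

∈-mapMaybe : ∀ {A C : Set} (f : A → Maybe C) {xs x y} → x List.∈ xs → f x ≡ just y → y List.∈ mapMaybe f xs
∈-mapMaybe f {x ∷ xs} (here refl) eq with f x
∈-mapMaybe f {x ∷ xs} (here refl) refl | just y = here refl
∈-mapMaybe f {x ∷ xs} (there x∈) eq with f x
... | just _  = there (∈-mapMaybe f x∈ eq)
... | nothing = ∈-mapMaybe f x∈ eq

∈-mapMaybe⁻ : ∀ {A C : Set} (f : A → Maybe C) xs {y} → y List.∈ mapMaybe f xs → ∃[ x ] f x ≡ just y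
∈-mapMaybe⁻ f (x ∷ xs) y∈ with f x in eq
∈-mapMaybe⁻ f (x ∷ xs) (here refl) | just _  = x , eq
∈-mapMaybe⁻ f (x ∷ xs) (there y∈)  | just _  = ∈-mapMaybe⁻ f xs y∈
∈-mapMaybe⁻ f (x ∷ xs) y∈          | nothing = ∈-mapMaybe⁻ f xs y∈

-- The program tries tuples of exactly K vertices. A shorter list of replacements from Y is filled
-- up with a vertex `z` of Y, which keeps the tuple inside Y.
pad : ∀ {A : Set} → A → ∀ k → List A → Vec A k
pad z zero    xs       = []
pad z (suc k) []       = z ∷ pad z k []
pad z (suc k) (x ∷ xs) = x ∷ pad z k xs

insert-⊆ : ∀ {n} {S : Subset n} {u} z → u ∈ S [ z ]≔ true → u ∈ S ⊎ u ≡ z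
insert-⊆ {S = S} {u} z u∈ with u Fin.≟ z
... | yes eq = inj₂ eq
... | no ne  = inj₁ (∈-update-other⁻ ne u∈)

⊆-insert : ∀ {n} (S : Subset n) {u} z → u ∈ S → u ∈ S [ z ]≔ true
⊆-insert S {u} z u∈ with u Fin.≟ z
... | yes refl = ∈-insert S z
... | no ne    = ∈-update-other ne u∈

⊆-insertAll : ∀ {n k} (ds : Vec (Fin n) k) (S : Subset n) {u} → u ∈ S → u ∈ insertAll ds S
⊆-insertAll []       S u∈ = u∈
⊆-insertAll (d ∷ ds) S u∈ = ⊆-insertAll ds (S [ d ]≔ true) (⊆-insert S d u∈)

pad-within : ∀ {n} (Y : Fin n → Set) {z} k xs (S : Subset n) {u} → Y z → (∀ {x} → x List.∈ xs → Y x) →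
             u ∈ insertAll (pad z k xs) S → u ∈ S ⊎ Y u
pad-within Y zero xs S Yz Yxs u∈ = inj₁ u∈
pad-within Y {z} (suc k) [] S Yz Yxs u∈ with pad-within Y k [] (S [ z ]≔ true) Yz Yxs u∈
... | inj₂ y = inj₂ y
... | inj₁ s with insert-⊆ {S = S} z s
...   | inj₁ s′   = inj₁ s′
...   | inj₂ refl = inj₂ Yz
pad-within Y (suc k) (x ∷ xs) S Yz Yxs u∈ with pad-within Y k xs (S [ x ]≔ true) Yz (Yxs ∘ there) u∈
... | inj₂ y = inj₂ y
... | inj₁ s with insert-⊆ {S = S} x s
...   | inj₁ s′   = inj₁ s′
...   | inj₂ refl = inj₂ (Yxs (here refl))

pad-covers : ∀ {n} {z : Fin n} k xs (S : Subset n) {u} → length xs ≤ k → u List.∈ xs →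
             u ∈ insertAll (pad z k xs) S
pad-covers (suc k) (x ∷ xs) S le (here refl) = ⊆-insertAll (pad _ k xs) (S [ x ]≔ true) (∈-insert S x)
pad-covers (suc k) (x ∷ xs) S (s≤s le) (there u∈) = pad-covers k xs (S [ x ]≔ true) le u∈

-- Connectivity of the solution graph

module Connectivity {n K} (A : AssignmentProblem n K) where

  open AssignmentProblem A

  -- What processing X guarantees. Which subset the greedy shrinking finds is left open, as
  -- containment is all that `reach` uses.
  Explored : Subset n → List (Subset n) → Set
  Explored X L = ∀ w → w ∈ X → ∀ (ds : Vec (Fin n) K) → Feasible (insertAll ds (X ∖ w)) →
                 ∃[ Y ] Y List.∈ L × Y ⊆ insertAll ds (X ∖ w)

  -- Removing `v` strands only the jobs in its K slots, and the exchange spends at most one vertex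
  -- of Y on each of them.
  replacement : ∀ {X Y} v → Feasible X → Feasible Y → 
    ∃[ Z ] length Z ≤ K × (∀ {w} → w List.∈ Z → w ∈ Y)
         × Matching IsJob (λ j s → OkSlot j s × (owner s ∈ X ∖ v ⊎ owner s List.∈ Z)) Nobody
  replacement {X} {Y} v f g =
    let Z , le , rest = E.exchange {_∈ (X ∖ v)} pending remaining isJob
    in Z , ℕ.≤-trans le (ℕ.≤-trans (List.length-mapMaybe M.at slots)
           (ℕ.≤-reflexive (trans (List.length-map (combine v) (allFin K)) (List.length-tabulate id)))) , rest
    where
    module E = Exchange (Product.≡-dec Fin._≟_ Fin._≟_) IsJob OkSlot owner (_∈ Y) g
    module M = Matching f
    slots : List (Fin (n * K))
    slots = map (combine v) (allFin K)
    pending : List (Fin n × Fin n)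
    pending = mapMaybe M.at slots
    isJob : ∀ {j} → j List.∈ pending → IsJob j
    isJob j∈ = proj₁ (M.sound (proj₂ (∈-mapMaybe⁻ M.at slots j∈)))
    at′ : Fin (n * K) → Maybe (Fin n × Fin n)
    at′ s = if does (owner s Fin.≟ v) then nothing else M.at s
    at′⇒at : ∀ {s j} → at′ s ≡ just j → owner s ≢ v × M.at s ≡ just j
    at′⇒at {s} eq with owner s Fin.≟ v
    ... | no ne = ne , eq
    remaining : Matching IsJob (E.Within (_∈ (X ∖ v))) (List._∈ pending)
    remaining = matching at′
      (λ eq → let ne , e = at′⇒at eq ; q , o , x = M.sound e in q , o , ∈-update-other ne x)
      (λ eq eq′ → M.unique (proj₂ (at′⇒at eq)) (proj₂ (at′⇒at eq′)))
      complete
      where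
      complete : ∀ {j} → IsJob j → j List.∈ pending ⊎ ∃[ s ] at′ s ≡ just j
      complete {j} q = let s , eq = slotOf f q in helper s eq
        where
        helper : ∀ s → M.at s ≡ just j → j List.∈ pending ⊎ ∃[ s ] at′ s ≡ just j
        helper s eq with owner s Fin.≟ v
        ... | yes refl = inj₁ (∈-mapMaybe M.at {x = s}
                (subst (List._∈ slots) (Fin.combine-remQuot {n} K s) (List.∈-map⁺ (combine v) (List.∈-allFin (index s)))) eq)
        ... | no ne    = inj₂ (s , subst (λ b → (if b then nothing else M.at s) ≡ just j)
                                     (sym (dec-false (owner s Fin.≟ v) ne)) eq)

  -- Exchanging a vertex v of X outside Y for at most K vertices of Y shrinks
  -- the part of X outside Y.
  reach : ∀ L → (∀ {X} → X List.∈ L → Explored X L) → (∀ {X} → X List.∈ L → Minimal Feasible X) →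
          ∀ {Y} → Minimal Feasible Y → ∀ m {X} → X List.∈ L → ∣ X ∩ ∁ Y ∣ ≤ m → Y List.∈ L
  reach L explored sound {Y} (fY , minY) m {X} X∈ le
    with Fin.any? (λ v → v Subset.∈? X ×-dec Dec.¬? (v Subset.∈? Y))
  ... | no ¬v = subst (List._∈ L) (Subset.⊆-antisym X⊆Y Y⊆X) X∈
    where
    X⊆Y : X ⊆ Y
    X⊆Y {u} u∈ with u Subset.∈? Y
    ... | yes u∈Y = u∈Y
    ... | no u∉Y  = contradiction (u , u∈ , u∉Y) ¬v
    Y⊆X : Y ⊆ X
    Y⊆X {u} u∈ with u Subset.∈? X
    ... | yes u∈X = u∈X
    ... | no u∉X  = contradiction (proj₁ (sound X∈)) (minY X (X⊆Y , u , u∈ , u∉X))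
  ... | yes (v , v∈X , v∉Y) = go m le
    where
    fX   = proj₁ (sound X∈)
    minX = proj₂ (sound X∈)
    smaller : ∃[ X′ ] X′ List.∈ L × ∣ X′ ∩ ∁ Y ∣ < ∣ X ∩ ∁ Y ∣
    smaller with replacement v fX fY
    -- Without any replacement `X ∖ v` would be feasible, against minimality. So there is a vertex
    -- `z` of Y to pad with.
    ... | [] , _ , _ , m′ = contradiction
            (matching-mono (λ { (o , inj₁ x) → o , x ; (o , inj₂ ()) }) m′)
            (minX (X ∖ v) (∖-⊆ {S = X} , v , v∈X , ∉-∖ X v))
    ... | z ∷ zs , len , ZY , m′ =
      let X′ , X′∈ , X′⊆ = explored X∈ v v∈X ds
            (matching-mono (λ { (o , inj₁ x) → o , ⊆-insertAll ds (X ∖ v) x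
                              ; (o , inj₂ x) → o , pad-covers K (z ∷ zs) (X ∖ v) len x }) m′)
          inside : ∀ {u} → u ∈ X′ → u ∈ X ∖ v ⊎ u ∈ Y
          inside u∈ = pad-within (_∈ Y) K (z ∷ zs) (X ∖ v) (ZY (here refl)) ZY (X′⊆ u∈)
      in X′ , X′∈ , Subset.p⊂q⇒∣p∣<∣q∣
           ( (λ u∈ → let a , b = Subset.x∈p∩q⁻ X′ (∁ Y) u∈ in case inside a of λ
                { (inj₁ x) → Subset.x∈p∩q⁺ (∖-⊆ {S = X} x , b)
                ; (inj₂ y) → contradiction y (Subset.x∈∁p⇒x∉p b) })
           , v , Subset.x∈p∩q⁺ (v∈X , Subset.x∉p⇒x∈∁p v∉Y)
           , λ v∈ → case inside (proj₁ (Subset.x∈p∩q⁻ X′ (∁ Y) v∈)) of λ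
                { (inj₁ x) → ∉-∖ X v x ; (inj₂ y) → v∉Y y })
      where
      ds = pad z K (z ∷ zs)
    go : ∀ m → ∣ X ∩ ∁ Y ∣ ≤ m → Y List.∈ L
    go m le = let X′ , X′∈ , lt = smaller in descend m X′ X′∈ (ℕ.≤-trans lt le)
      where
      descend : ∀ m X′ → X′ List.∈ L → ∣ X′ ∩ ∁ Y ∣ < m → Y List.∈ L
      descend (suc m) X′ X′∈ lt = reach L explored sound (fY , minY) m X′∈ (s≤s⁻¹ lt)

-- Correctness of the search commands

module Search
  {n K : ℕ} (A : AssignmentProblem n K) (inp : ℕ → ℕ) (B R : ℕ) (jobₑ okₑ : Expr)
  (enough : n * K * (n * K) < R)
  (job-spec : ∀ s (u v : Fin n) → reg s 1 ≡ toℕ u → reg s 2 ≡ toℕ v →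
     Decides (Semantics.eval inp (environment n B K (n ^ K) R) jobₑ s) (AssignmentProblem.Job A u v))
  (ok-spec : ∀ s (u v w : Fin n) (i : Fin K) → reg s 7 ≡ toℕ u → reg s 8 ≡ toℕ v →
     reg s 3 ≡ toℕ w → reg s 4 ≡ toℕ i →
     Decides (Semantics.eval inp (environment n B K (n ^ K) R) okₑ s) (AssignmentProblem.Ok A u v w i))
  where

  open AssignmentProblem A
  open Semantics inp (environment n B K (n ^ K) R)
  open Verification inp (environment n B K (n ^ K) R)
  open Programs jobₑ okₑ
  open Connectivity A

  if-rule : ∀ {e c c′ s} (Q : State → Set) → (eval e s ≢ 0 → Q (run c s)) →
            (eval e s ≡ 0 → Q (run c′ s)) → Q (run (ifₑ e c c′) s)
  if-rule {e} {s = s} Q f g with eval e s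
  ... | zero  = g refl
  ... | suc _ = f (λ ())

  N : ℕ
  N = n * K

  -- For an empty slot the last two entries are unconstrained, which is why `clear` resets `held`
  -- but leaves `heldᵤ` and `heldᵥ`.
  Holder : ℕ → ℕ → ℕ → Maybe (Fin n × Fin n) → Set
  Holder a b c nothing        = a ≡ 0
  Holder a b c (just (u , v)) = a ≡ 1 × b ≡ toℕ u × c ≡ toℕ v

  holder-subst : ∀ {a b c a′ b′ c′} m → a′ ≡ a → b′ ≡ b → c′ ≡ c → Holder a b c m → Holder a′ b′ c′ m
  holder-subst m refl refl refl h = h

  prices : State → Fin N → ℕ
  prices s σ = arr s price (toℕ σ)

  module _ (S : Subset n) where

    open Auction {N = N} IsJob (Usable S)

    -- Ties arrays and registers to a state of the auction. By `known` only jobs already started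
    -- occur in slots, so the next job to start cannot hold one.
    record Reached (D : Fin n × Fin n → Set) (s : State) (cur : Maybe (Fin n × Fin n)) : Set where
      constructor reached
      field
        at       : Fin N → Maybe (Fin n × Fin n)
        holders  : ∀ σ → Holder (arr s held (toℕ σ)) (arr s heldᵤ (toℕ σ)) (arr s heldᵥ (toℕ σ)) (at σ)
        known    : ∀ {σ j} → at σ ≡ just j → D j
        active   : Holder (reg s 6) (reg s 7) (reg s 8) cur
        known′   : ∀ {j} → cur ≡ just j → D j
        auction  : Inv D (prices s) at cur

    Stuck : State → Fin n × Fin n → Set
    Stuck s j = ∀ σ → Usable S j σ → N ≤ prices s σ

    Cheapest : State → Fin n × Fin n → Set
    Cheapest s j = (reg s 10 ≡ N ⊎ (∃[ σ ] Usable S j σ × reg s 11 ≡ toℕ σ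
                                    × reg s 10 ≡ prices s σ × prices s σ < N))

    -- Register 10 starts at N and only strictly cheaper slots replace it. A value still equal to N
    -- thus signals that every usable slot costs at least N, the hypothesis of `inv-stuck`.
    scan-correct : ∀ s j → reg s 7 ≡ toℕ (proj₁ j) → reg s 8 ≡ toℕ (proj₂ j) →
      Represents (arr s chosen) S → reg s 10 ≡ N →
      let s′ = run (loop 3 0 (loop 4 2 scan)) s in
      Cheapest s′ j × (∀ σ → Usable S j σ → reg s′ 10 ≤ prices s′ σ ⊎ N ≤ prices s′ σ)
    scan-correct s j@(u , v) cu cv rep r10 =
      let cheapest , least = loop₂-rule {3} {0} {4} {2} {scan} {s} refl I (λ _ x → x)
            (inj₁ r10 , λ σ ()) advance
      in cheapest , λ σ us → least σ (Fin.toℕ<n σ) us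
      where
      I : ℕ → State → Set
      I k s′ = Cheapest s′ j × (∀ σ → toℕ σ < k → Usable S j σ → reg s′ 10 ≤ prices s′ σ ⊎ N ≤ prices s′ σ)
      advance : ∀ (w : Fin n) (i : Fin K) s′ → Frame (loop 3 0 (loop 4 2 scan)) s s′ →
        reg s′ 3 ≡ toℕ w → I (toℕ (combine w i)) s′ →
        I (suc (toℕ (combine w i))) (run scan (setReg 4 (toℕ i) s′))
      advance w i s′ fr r3 (cheapest , least) =
        if-rule {andₑ okₑ (andₑ (chosen ⟦ var 3 ⟧) (var 10 ⊟ price ⟦ slotₑ ⟧))}
          {10 ← price ⟦ slotₑ ⟧ ⨾ 11 ← slotₑ} {skip} {s₁}
          (I (suc (toℕ σ)))
          (λ ne → let o , w∈ , lt = proj₂ decide ne in take o w∈ lt)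
          (λ eq → cheapest , λ τ τ≤σ us → case ℕ.m<1+n⇒m<n∨m≡n τ≤σ of λ
            { (inj₁ τ<σ) → least τ τ<σ us
            ; (inj₂ τ≡σ) → skip-slot (Fin.toℕ-injective τ≡σ) us eq })
        where
        σ = combine w i
        s₁ = setReg 4 (toℕ i) s′
        slot≡ : eval slotₑ s₁ ≡ toℕ σ
        slot≡ = trans (cong (λ x → K * x + toℕ i) r3) (sym (Fin.toℕ-combine w i))
        rep′ : Represents (arr s₁ chosen) S
        rep′ = subst (λ a → Represents a S) (sym (Frame.arrs fr chosen refl)) rep
        decide : Decides (eval (andₑ okₑ (andₑ (chosen ⟦ var 3 ⟧) (var 10 ⊟ price ⟦ slotₑ ⟧))) s₁)
                         (Ok u v w i × w ∈ S × arr s₁ price (eval slotₑ s₁) < reg s₁ 10)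
        decide = decides-and
          (ok-spec s₁ u v w i (trans (Frame.regs fr 7 refl) cu) (trans (Frame.regs fr 8 refl) cv) r3 refl)
          (decides-and (subst (λ x → Decides (arr s₁ chosen x) (w ∈ S)) (sym r3) (decides-∈ {a = arr s₁ chosen} {S} rep′ w))
                       (decides-< _ _))
        price≡ : arr s₁ price (eval slotₑ s₁) ≡ prices s′ σ
        price≡ = cong (arr s′ price) slot≡
        best≤N : Cheapest s′ j → reg s′ 10 ≤ N
        best≤N (inj₁ eq)                    = ℕ.≤-reflexive eq
        best≤N (inj₂ (_ , _ , _ , eq , lt)) = ℕ.≤-trans (ℕ.≤-reflexive eq) (ℕ.<⇒≤ lt)
        take : Ok u v w i → w ∈ S → arr s₁ price (eval slotₑ s₁) < reg s₁ 10 →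
               I (suc (toℕ σ)) (run (10 ← price ⟦ slotₑ ⟧ ⨾ 11 ← slotₑ) s₁)
        take o w∈ lt =
          inj₂ (σ , (subst₂ (Ok u v) (sym (owner-combine w i)) (sym (index-combine w i)) o ,
                     subst (_∈ S) (sym (owner-combine w i)) w∈)
                  , slot≡ , price≡ , ℕ.≤-trans (ℕ.≤-trans (s≤s (ℕ.≤-reflexive (sym price≡))) lt) (best≤N cheapest)) ,
          λ τ τ≤σ us → case ℕ.m<1+n⇒m<n∨m≡n τ≤σ of λ
            { (inj₁ τ<σ) → case least τ τ<σ us of λ
                { (inj₁ le) → inj₁ (ℕ.≤-trans (ℕ.<⇒≤ lt) le) ; (inj₂ le) → inj₂ le }
            ; (inj₂ τ≡σ) → inj₁ (ℕ.≤-reflexive (trans price≡ (cong (arr s′ price) (sym τ≡σ)))) }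
        skip-slot : ∀ {τ} → τ ≡ σ → Usable S j τ →
                    eval (andₑ okₑ (andₑ (chosen ⟦ var 3 ⟧) (var 10 ⊟ price ⟦ slotₑ ⟧))) s₁ ≡ 0 →
                    reg s′ 10 ≤ prices s′ τ ⊎ N ≤ prices s′ τ
        skip-slot refl (o , w∈) eq with reg s′ 10 ℕ.≤? prices s′ σ
        ... | yes le = inj₁ le
        ... | no ¬le = contradiction eq (proj₁ decide
          ( subst₂ (Ok u v) (owner-combine w i) (index-combine w i) o
          , subst (_∈ S) (owner-combine w i) w∈
          , ℕ.≤-trans (s≤s (ℕ.≤-reflexive price≡)) (ℕ.≰⇒> ¬le)))

    -- The sum of all prices measures progress: a round that finds an affordable slot raises it by
    -- exactly one, whether or not a job is displaced.
    round-correct : ∀ {D j} s → Represents (arr s chosen) S → Reached D s (just j) →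
      let s′ = run round s in
      (Stuck s′ j × Reached D s′ (just j)) ⊎
      (∃[ cur ] Reached D s′ cur × total (prices s′) ≡ suc (total (prices s)))
    round-correct {D} {j} s rep (reached at holders known active@(_ , cu , cv) known′ auction) =
      if-rule {slotsₑ ⊟ var 10} {swap} {skip} {s₁} Q exchange-slot stuck
      where
      s₀ = run (10 ← slotsₑ) s
      s₁ = run (loop 3 0 (loop 4 2 scan)) s₀
      fr : Frame (loop 3 0 (loop 4 2 scan)) s₀ s₁
      fr = frame (loop 3 0 (loop 4 2 scan)) s₀
      Q : State → Set
      Q s′ = (Stuck s′ j × Reached D s′ (just j)) ⊎
             (∃[ cur ] Reached D s′ cur × total (prices s′) ≡ suc (total (prices s)))
      scanned = scan-correct s₀ j cu cv rep refl
      arr≡ : ∀ i → writesArr (loop 3 0 (loop 4 2 scan)) i ≡ false → ∀ x → arr s₁ i x ≡ arr s i x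
      arr≡ i eq x = cong (λ f → f x) (Frame.arrs fr i eq)
      reg≡ : ∀ x → writesReg (loop 3 0 (loop 4 2 scan)) x ≡ false → does (x ℕ.≟ 10) ≡ false → reg s₁ x ≡ reg s x
      reg≡ x eq ne = trans (Frame.regs fr x eq) (setReg-other {10} {x} _ s ne)
      inv₁ : Inv D (prices s₁) at (just j)
      inv₁ = subst (λ f → Inv D (λ σ → f (toℕ σ)) at (just j)) (sym (Frame.arrs fr price refl)) auction
      holders₁ : ∀ σ → Holder (arr s₁ held (toℕ σ)) (arr s₁ heldᵤ (toℕ σ)) (arr s₁ heldᵥ (toℕ σ)) (at σ)
      holders₁ σ = holder-subst (at σ) (arr≡ held refl _) (arr≡ heldᵤ refl _) (arr≡ heldᵥ refl _) (holders σ)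
      stuck : eval (slotsₑ ⊟ var 10) s₁ ≡ 0 → Q s₁
      stuck eq = inj₁ ((λ σ us → case proj₂ scanned σ us of λ
                          { (inj₁ le) → ℕ.≤-trans (ℕ.m∸n≡0⇒m≤n eq) le ; (inj₂ le) → le })
                      , reached at holders₁ known
                          (holder-subst (just j) (reg≡ 6 refl refl) (reg≡ 7 refl refl) (reg≡ 8 refl refl) active)
                          known′ inv₁)
      exchange-slot : eval (slotsₑ ⊟ var 10) s₁ ≢ 0 → Q (run swap s₁)
      exchange-slot ne with proj₁ scanned
      ... | inj₁ eq = contradiction (trans (cong (N ∸_) eq) (ℕ.n∸n≡0 N)) ne
      ... | inj₂ (σ , us , r11 , r10 , lt) =
        inj₂ (at σ , reached at′ holders′ known-at′ active′ known auction′
                   , trans (total-suc σ price-σ price-τ)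
                           (cong suc (total-cong {f = prices s₁} {prices s} (λ τ → arr≡ price refl (toℕ τ)))))
        where
        s₂ = run swap s₁
        at′ : Fin N → Maybe (Fin n × Fin n)
        at′ τ = if does (τ Fin.≟ σ) then just j else at τ
        other : ∀ {τ} → τ ≢ σ → toℕ τ ≢ reg s₁ 11
        other ne eq = ne (Fin.toℕ-injective (trans eq r11))
        price-σ : prices s₂ σ ≡ suc (prices s₁ σ)
        price-σ = trans ([↦]-at (arr s₁ price) _ (sym r11)) (trans (ℕ.+-comm _ 1) (cong suc r10))
        price-τ : ∀ τ → τ ≢ σ → prices s₂ τ ≡ prices s₁ τ
        price-τ τ ne = [↦]-other (arr s₁ price) _ (other ne)
        holders′ : ∀ τ → Holder (arr s₂ held (toℕ τ)) (arr s₂ heldᵤ (toℕ τ)) (arr s₂ heldᵥ (toℕ τ)) (at′ τ)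
        holders′ τ with τ Fin.≟ σ
        ... | yes refl = [↦]-at (arr s₁ held) _ (sym r11)
                       , trans ([↦]-at (arr s₁ heldᵤ) _ (sym r11)) (trans (reg≡ 7 refl refl) cu)
                       , trans ([↦]-at (arr s₁ heldᵥ) _ (sym r11)) (trans (reg≡ 8 refl refl) cv)
        ... | no τ≢σ   = holder-subst (at τ) ([↦]-other (arr s₁ held) _ (other τ≢σ))
                           ([↦]-other (arr s₁ heldᵤ) _ (other τ≢σ)) ([↦]-other (arr s₁ heldᵥ) _ (other τ≢σ)) (holders₁ τ)
        known-at′ : ∀ {τ k} → at′ τ ≡ just k → D k
        known-at′ {τ} eq with τ Fin.≟ σ
        ... | yes refl = subst D (just-injective eq) (known′ refl)
        ... | no _     = known eq
        active′ : Holder (reg s₂ 6) (reg s₂ 7) (reg s₂ 8) (at σ)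
        active′ = holder-subst (at σ) (cong (arr s₁ held) r11) (cong (arr s₁ heldᵤ) r11) (cong (arr s₁ heldᵥ) r11) (holders₁ σ)
        auction′ : Inv D (prices s₂) at′ (at σ)
        auction′ = inv-step σ inv₁ us
          (λ τ uτ → case proj₂ scanned τ uτ of λ
            { (inj₁ le) → ℕ.≤-trans (ℕ.≤-reflexive (sym r10)) le
            ; (inj₂ le) → ℕ.≤-trans (ℕ.<⇒≤ lt) le })
          lt price-σ price-τ at-σ at-τ
          where
          at-σ : at′ σ ≡ just j
          at-σ rewrite dec-true (σ Fin.≟ σ) refl = refl
          at-τ : ∀ τ → τ ≢ σ → at′ τ ≡ at τ
          at-τ τ ne rewrite dec-false (τ Fin.≟ σ) ne = refl

    Processed : ℕ → Fin n × Fin n → Set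
    Processed k (u , v) = toℕ (combine u v) < k

    -- While a job waits and nobody is stuck, k rounds force the prices to sum to at least k. The
    -- sum never exceeds N * N < R, so a job still waiting after R rounds refutes feasibility.
    attempt-correct : ∀ u v s → Job u v → reg s 1 ≡ toℕ u → reg s 2 ≡ toℕ v →
      Represents (arr s chosen) S → reg s 5 ≡ 0 →
      Reached (Processed (toℕ (combine u v))) s nothing →
      let s′ = run attempt s in
      (reg s′ 5 ≡ 0 × Reached (Processed (suc (toℕ (combine u v)))) s′ nothing) ⊎
      (reg s′ 5 ≡ 1 × ¬ Feasible S)
    attempt-correct u v s q r1 r2 rep r5 (reached at holders known _ _ auction) =
      let cur , r , progress = loop-rule {9} {4} {body} {s₀} I
            (just (u , v) , reached at holders (ℕ.m≤n⇒m≤1+n ∘ known) (refl , r1 , r2)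
               (λ { refl → ℕ.≤-refl })
               (inv-begin auction q (λ eq → ℕ.<-irrefl refl (known eq)) latest)
            , inj₂ (inj₂ z≤n))
            advance
      in if-rule {var 6} {5 ← lit 1} {skip} {s₁} Q (failure cur r progress) (success cur r)
      where
      D = Processed (suc (toℕ (combine u v)))
      body = when (var 6) round
      s₀ = run (6 ← lit 1 ⨾ 7 ← var 1 ⨾ 8 ← var 2) s
      s₁ = run (loop 9 4 body) s₀
      Q : State → Set
      Q s′ = (reg s′ 5 ≡ 0 × Reached D s′ nothing) ⊎ (reg s′ 5 ≡ 1 × ¬ Feasible S)
      latest : ∀ {k} → D k → Processed (toℕ (combine u v)) k ⊎ k ≡ (u , v)
      latest {u′ , v′} d with ℕ.m<1+n⇒m<n∨m≡n d
      ... | inj₁ lt = inj₁ lt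
      ... | inj₂ eq = let e , e′ = Fin.combine-injective u′ v′ u v (Fin.toℕ-injective eq)
                      in inj₂ (cong₂ _,_ e e′)
      I : ℕ → State → Set
      I k s′ = ∃[ cur ] Reached D s′ cur × (cur ≡ nothing ⊎ ¬ Feasible S ⊎ k ≤ total (prices s′))
      advance : ∀ (k : Fin R) s′ → Frame (loop 9 4 body) s₀ s′ → I (toℕ k) s′ →
                I (suc (toℕ k)) (run body (setReg 9 (toℕ k) s′))
      advance k s′ fr (nothing , r , _) =
        if-rule {var 6} {round} {skip} {setReg 9 (toℕ k) s′} (I (suc (toℕ k)))
          (λ ne → contradiction (Reached.active r) ne)
          (λ _ → nothing , reached (Reached.at r) (Reached.holders r) (Reached.known r)
                             (Reached.active r) (λ ()) (Reached.auction r) , inj₁ refl)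
      advance k s′ fr (just j , reached a h kn ac kn′ au , progress) =
        if-rule {var 6} {round} {skip} {setReg 9 (toℕ k) s′} (I (suc (toℕ k)))
          (λ _ → case round-correct (setReg 9 (toℕ k) s′)
                   (subst (λ a → Represents a S) (sym (Frame.arrs fr chosen refl)) rep)
                   (reached a h kn ac kn′ au) of λ
            { (inj₁ (stuck , r′)) → just j , r′ , inj₂ (inj₁ (inv-stuck (Reached.auction r′) stuck))
            ; (inj₂ (cur , r′ , eq)) → cur , r′ , (case progress of λ
                { (inj₁ ())
                ; (inj₂ (inj₁ ¬f)) → inj₂ (inj₁ ¬f)
                ; (inj₂ (inj₂ le)) → inj₂ (inj₂ (ℕ.≤-trans (s≤s le) (ℕ.≤-reflexive (sym eq)))) }) })
          (λ eq → case trans (sym (proj₁ ac)) eq of λ ())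
      r5₁ : reg s₁ 5 ≡ 0
      r5₁ = trans (Frame.regs (frame (loop 9 4 body) s₀) 5 refl) r5
      success : ∀ cur → Reached D s₁ cur → reg s₁ 6 ≡ 0 → Q s₁
      success nothing  r eq = inj₁ (r5₁ , r)
      success (just j) r eq = case trans (sym (proj₁ (Reached.active r))) eq of λ ()
      failure : ∀ cur → Reached D s₁ cur → cur ≡ nothing ⊎ ¬ Feasible S ⊎ R ≤ total (prices s₁) →
                reg s₁ 6 ≢ 0 → Q (run (5 ← lit 1) s₁)
      failure cur r (inj₁ refl)       ne = contradiction (Reached.active r) ne
      failure cur r (inj₂ (inj₁ ¬f)) ne = inj₂ (refl , ¬f)
      failure cur r (inj₂ (inj₂ le)) ne = contradiction enough
        (ℕ.≤⇒≯ (ℕ.≤-trans le (total-≤ N (Inv.bounded (Reached.auction r)))))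

    clear-correct : ∀ s → let s′ = run clear s in
      ∀ (σ : Fin N) → arr s′ price (toℕ σ) ≡ 0 × arr s′ held (toℕ σ) ≡ 0
    clear-correct s σ = loop₂-rule {3} {0} {4} {2} {body} {s} refl
      (λ k s′ → ∀ (σ : Fin N) → toℕ σ < k → arr s′ price (toℕ σ) ≡ 0 × arr s′ held (toℕ σ) ≡ 0)
      (λ _ x → x) (λ _ ()) advance σ (Fin.toℕ<n σ)
      where
      body = price ⟦ slotₑ ⟧← lit 0 ⨾ held ⟦ slotₑ ⟧← lit 0
      reset : ∀ (f : ℕ → ℕ) {a} x → (x ≢ a → f x ≡ 0) → (f [ a ↦ 0 ]) x ≡ 0
      reset f {a} x h with x ℕ.≟ a
      ... | yes refl = [↦]-same f a 0
      ... | no x≢a   = trans ([↦]-other f 0 x≢a) (h x≢a)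
      advance : ∀ (w : Fin n) (i : Fin K) s′ → Frame (loop 3 0 (loop 4 2 body)) s s′ → reg s′ 3 ≡ toℕ w →
        (∀ (σ : Fin N) → toℕ σ < toℕ (combine w i) → arr s′ price (toℕ σ) ≡ 0 × arr s′ held (toℕ σ) ≡ 0) →
        ∀ (σ : Fin N) → toℕ σ < suc (toℕ (combine w i)) →
          arr (run body (setReg 4 (toℕ i) s′)) price (toℕ σ) ≡ 0 ×
          arr (run body (setReg 4 (toℕ i) s′)) held (toℕ σ) ≡ 0
      advance w i s′ fr r3 h σ le =
        reset (arr s′ price) (toℕ σ) (λ ne → proj₁ (h σ (earlier ne))) ,
        reset (arr s′ held) (toℕ σ) (λ ne → proj₂ (h σ (earlier ne)))
        where
        slot≡ : eval slotₑ (setReg 4 (toℕ i) s′) ≡ toℕ (combine w i)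
        slot≡ = trans (cong (λ x → K * x + toℕ i) r3) (sym (Fin.toℕ-combine w i))
        earlier : toℕ σ ≢ eval slotₑ (setReg 4 (toℕ i) s′) → toℕ σ < toℕ (combine w i)
        earlier ne = ℕ.≤∧≢⇒< (s≤s⁻¹ le) (λ eq → ne (trans eq (sym slot≡)))

    feasible-correct : ∀ s → Represents (arr s chosen) S →
      let s′ = run feasible s in
      (reg s′ 5 ≡ 0 × Feasible S) ⊎ (reg s′ 5 ≡ 1 × ¬ Feasible S)
    feasible-correct s rep = case loop₂-rule {1} {0} {2} {0} {body} {s₁} refl I stable
        (inj₁ (Frame.regs (frame clear s₀) 5 refl , reached (λ _ → nothing) (λ σ → proj₂ (clear-correct s₀ σ)) (λ ())
           (Frame.regs (frame clear s₀) 6 refl) (λ ())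
           (inv-D (λ ()) (inv-start (λ σ → proj₁ (clear-correct s₀ σ)) (λ _ → refl)))))
        advance of λ
      { (inj₁ (r5 , r)) → inj₁ (r5 , inv-finish (λ {(u , v)} _ → Fin.toℕ<n (combine u v)) (Reached.auction r))
      ; (inj₂ x)        → inj₂ x }
      where
      body = when (andₑ jobₑ (lit 1 ⊟ var 5)) attempt
      s₀ = run (5 ← lit 0 ⨾ 6 ← lit 0) s
      s₁ = run clear s₀
      I : ℕ → State → Set
      I k s′ = (reg s′ 5 ≡ 0 × Reached (Processed k) s′ nothing) ⊎ (reg s′ 5 ≡ 1 × ¬ Feasible S)
      stable : ∀ {k s′} a → I k s′ → I k (setReg 1 a s′)
      stable a (inj₁ (r5 , reached at h kn ac kn′ au)) = inj₁ (r5 , reached at h kn ac kn′ au)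
      stable a (inj₂ x) = inj₂ x
      advance : ∀ (u v : Fin n) s′ → Frame (loop 1 0 (loop 2 0 body)) s₁ s′ → reg s′ 1 ≡ toℕ u →
        I (toℕ (combine u v)) s′ → I (suc (toℕ (combine u v))) (run body (setReg 2 (toℕ v) s′))
      advance u v s′ fr r1 i =
        if-rule {andₑ jobₑ (lit 1 ⊟ var 5)} {attempt} {skip} {s₂} (I (suc (toℕ (combine u v)))) (attempted i) (skipped i)
        where
        s₂ = setReg 2 (toℕ v) s′
        decide : Decides (eval (andₑ jobₑ (lit 1 ⊟ var 5)) s₂) (Job u v × ¬ (reg s′ 5 ≡ 1))
        decide = decides-and (job-spec s₂ u v r1 refl) (fails i)
          where
          fails : ∀ {k} → I k s′ → Decides (1 ∸ reg s′ 5) (¬ (reg s′ 5 ≡ 1))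
          fails (inj₁ (eq , _)) = subst (λ x → Decides (1 ∸ x) (¬ (x ≡ 1))) (sym eq) ((λ _ ()) , λ _ ())
          fails (inj₂ (eq , _)) = subst (λ x → Decides (1 ∸ x) (¬ (x ≡ 1))) (sym eq)
            ((λ ne _ → ne refl) , λ ne _ → ne refl)
        attempted : I (toℕ (combine u v)) s′ → eval (andₑ jobₑ (lit 1 ⊟ var 5)) s₂ ≢ 0 →
                    I (suc (toℕ (combine u v))) (run attempt s₂)
        attempted (inj₁ (r5 , reached at h kn ac kn′ au)) ne =
          attempt-correct u v s₂ (proj₁ (proj₂ decide ne)) r1 refl
            (subst (λ a → Represents a S) (sym (trans (Frame.arrs fr chosen refl)
              (trans (Frame.arrs (frame clear s₀) chosen refl) refl))) rep)
            r5 (reached at h kn ac kn′ au)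
        attempted (inj₂ (r5 , _)) ne = contradiction r5 (proj₂ (proj₂ decide ne))
        skipped : I (toℕ (combine u v)) s′ → eval (andₑ jobₑ (lit 1 ⊟ var 5)) s₂ ≡ 0 →
                  I (suc (toℕ (combine u v))) s₂
        skipped (inj₂ x) eq = inj₂ x
        -- As no failure was recorded, the test can only have failed because the pair is no job; it
        -- then counts as processed.
        skipped (inj₁ (r5 , reached at h kn ac kn′ au)) eq =
          inj₁ (r5 , reached at h (ℕ.m≤n⇒m≤1+n ∘ kn) ac (λ ()) (inv-D new au))
          where
          new : ∀ {k} → Processed (suc (toℕ (combine u v))) k → IsJob k → Processed (toℕ (combine u v)) k
          new {u′ , v′} d q with ℕ.m<1+n⇒m<n∨m≡n d
          ... | inj₁ lt = lt
          ... | inj₂ e with Fin.combine-injective u′ v′ u v (Fin.toℕ-injective e)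
          ...   | refl , refl = contradiction eq (proj₁ decide (q , λ r5≡1 → case trans (sym r5) r5≡1 of λ ()))

  -- Feasibility is upward closed, so testing the removal of single vertices covers all proper
  -- subsets.
  minimal-if : ∀ {S} → Feasible S → (∀ u → u ∈ S → ¬ Feasible (S ∖ u)) → Minimal Feasible S
  minimal-if {S} f h = f , λ S′ (S′⊆S , u , u∈S , u∉S′) f′ →
    h u u∈S (feasible-mono (⊆-∖ {S = S} {S′} {u} S′⊆S u∉S′) f′)

  -- One pass is enough: the set only shrinks, so by monotonicity a vertex whose removal once failed
  -- never becomes removable.
  minimise-correct : ∀ s S → Represents (arr s chosen) S → Feasible S →
    ∃[ S′ ] Represents (arr (run minimise s) chosen) S′ × S′ ⊆ S × Minimal Feasible S′
  minimise-correct s S rep f =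
    let S′ , rep′ , sub , f′ , h = loop-rule {15} {0} {body} {s} I
          (S , rep , id , f , λ u ()) advance
    in S′ , rep′ , sub , minimal-if f′ (λ u → h u (Fin.toℕ<n u))
    where
    shrink = chosen ⟦ var 15 ⟧← lit 0 ⨾ feasible ⨾ when (var 5) (chosen ⟦ var 15 ⟧← lit 1)
    body = when (chosen ⟦ var 15 ⟧) shrink
    I : ℕ → State → Set
    I k s′ = ∃[ S′ ] Represents (arr s′ chosen) S′ × S′ ⊆ S × Feasible S′
           × (∀ u → toℕ u < k → u ∈ S′ → ¬ Feasible (S′ ∖ u))
    advance : ∀ (u : Fin n) s′ → Frame (loop 15 0 body) s s′ → I (toℕ u) s′ →
              I (suc (toℕ u)) (run body (setReg 15 (toℕ u) s′))
    advance u s′ fr (S′ , rep , sub , f , h) =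
      if-rule {chosen ⟦ var 15 ⟧} {shrink} {skip} {s₀} (I (suc (toℕ u)))
        (λ ne → if-rule {var 5} {chosen ⟦ var 15 ⟧← lit 1} {skip} {s₂} (I (suc (toℕ u)))
          (λ ne₅ → S′ , restored (proj₂ (decides-∈ {a = arr s′ chosen} {S′} rep u) ne) , sub , f , λ v v≤u v∈ → case ℕ.m<1+n⇒m<n∨m≡n v≤u of λ
            { (inj₁ v<u) → h v v<u v∈
            ; (inj₂ v≡u) → subst (λ w → ¬ Feasible (S′ ∖ w)) (sym (Fin.toℕ-injective v≡u)) (infeasible ne₅) })
          (λ eq₅ → S′ ∖ u , rep₂ , (λ v∈ → sub (∖-⊆ {S = S′} v∈)) , feasible′ eq₅ ,
            λ v v≤u v∈ fv → case ℕ.m<1+n⇒m<n∨m≡n v≤u of λ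
            { (inj₁ v<u) → h v v<u (∖-⊆ {S = S′} v∈)
                             (feasible-mono (∖-mono {S = S′ ∖ u} {S′} {v} (∖-⊆ {S = S′})) fv)
            ; (inj₂ v≡u) → ∉-∖ S′ u (subst (_∈ (S′ ∖ u)) (Fin.toℕ-injective v≡u) v∈) }))
        (λ eq → S′ , rep , sub , f , λ v v≤u v∈ → case ℕ.m<1+n⇒m<n∨m≡n v≤u of λ
            { (inj₁ v<u) → h v v<u v∈
            ; (inj₂ v≡u) → contradiction eq (proj₁ (decides-∈ {a = arr s′ chosen} {S′} rep u)
                             (subst (_∈ S′) (Fin.toℕ-injective v≡u) v∈)) })
      where
      s₀ = setReg 15 (toℕ u) s′
      s₁ = run (chosen ⟦ var 15 ⟧← lit 0) s₀
      s₂ = run feasible s₁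
      rep₁ : Represents (arr s₁ chosen) (S′ ∖ u)
      rep₁ = represents-update {a = arr s′ chosen} {S′} u false rep
      arr₂ : arr s₂ chosen ≡ arr s₁ chosen
      arr₂ = Frame.arrs (frame feasible s₁) chosen refl
      rep₂ : Represents (arr s₂ chosen) (S′ ∖ u)
      rep₂ = subst (λ a → Represents a (S′ ∖ u)) (sym arr₂) rep₁
      decision = feasible-correct (S′ ∖ u) s₁ rep₁
      infeasible : reg s₂ 5 ≢ 0 → ¬ Feasible (S′ ∖ u)
      infeasible ne = case decision of λ { (inj₁ (eq , _)) → contradiction eq ne ; (inj₂ (_ , ¬f)) → ¬f }
      feasible′ : reg s₂ 5 ≡ 0 → Feasible (S′ ∖ u)
      feasible′ eq = case decision of λ
        { (inj₁ (_ , f)) → f ; (inj₂ (eq′ , _)) → case trans (sym eq′) eq of λ () }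
      restored : u ∈ S′ → Represents (arr (run (chosen ⟦ var 15 ⟧← lit 1) s₂) chosen) S′
      restored u∈ v with v Fin.≟ u
      ... | yes refl = trans ([↦]-at (arr s₂ chosen) 1 (sym r15)) (sym (cong bit (∈⇒lookup u∈)))
        where r15 = Frame.regs (frame feasible s₁) 15 refl
      ... | no v≢u   = trans ([↦]-other (arr s₂ chosen) 1 (λ eq → v≢u (Fin.toℕ-injective (trans eq r15))))
                             (trans (rep₂ v) (cong bit (Vec.lookup∘update′ v≢u S′ false)))
        where r15 = Frame.regs (frame feasible s₁) 15 refl

  -- By injectivity of `code`, one marked entry of `visited` stands for one subset; `unique` rests
  -- on this.
  record Store (s : State) (L : List (Subset n)) : Set where
    constructor store′
    field
      size    : reg s 18 ≡ length L
      rows    : Rows (arr s queue) 0 L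
      seen    : ∀ S → Decides (arr s visited (code S)) (S List.∈ L)
      unique  : Unique L
      sound   : ∀ {S} → S List.∈ L → Minimal Feasible S

  store-frame : ∀ {s s′ L} → reg s′ 18 ≡ reg s 18 → arr s′ queue ≡ arr s queue →
                arr s′ visited ≡ arr s visited → Store s L → Store s′ L
  store-frame {L = L} e₁ e₂ e₃ (store′ si ro se un so) =
    store′ (trans e₁ si) (subst (λ a → Rows a 0 L) (sym e₂) ro)
           (λ S → subst (λ a → Decides (a (code S)) (S List.∈ L)) (sym e₃) (se S)) un so

  Inserted : State → List (Subset n) → Subset n → Set
  Inserted s L S = ∃[ new ] Store s (L ++ new) × (∃[ Y ] Y List.∈ (L ++ new) × Y ⊆ S)

  enqueue-correct : ∀ s S L → Represents (arr s chosen) S → Minimal Feasible S → Store s L →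
                    Inserted (run enqueue s) L S
  enqueue-correct s S L rep min st =
    if-rule {visited ⟦ var 16 ⟧} {skip} {push} {s₁} (λ s′ → Inserted s′ L S)
      (λ ne → [] , subst (Store s₁) (sym (List.++-identityʳ L)) st₁ ,
              S , subst (S List.∈_) (sym (List.++-identityʳ L)) (proj₂ (seen₁ S) (ne ∘ trans (cong (arr s₁ visited) code≡))) , id)
      (λ eq → [ S ] , pushed (trans (cong (arr s₁ visited) (sym code≡)) eq) , S , List.∈-++⁺ʳ L (here refl) , id)
    where
    encode-loop = loop 17 0 (16 ← var 16 ⊞ var 16 ⊞ chosen ⟦ var 17 ⟧)
    copy-loop   = loop 17 0 (queue ⟦ 0 ⊠ var 18 ⊞ var 17 ⟧← chosen ⟦ var 17 ⟧)
    push        = visited ⟦ var 16 ⟧← lit 1 ⨾ copy-loop ⨾ 18 ← var 18 ⊞ lit 1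
    s₀ = run (16 ← lit 0) s
    s₁ = run encode-loop s₀
    fr₁ = frame encode-loop s₀
    st₁ : Store s₁ L
    st₁ = store-frame (Frame.regs fr₁ 18 refl) (Frame.arrs fr₁ queue refl) (Frame.arrs fr₁ visited refl) st
    seen₁ = Store.seen st₁
    code≡ : reg s₁ 16 ≡ code S
    code≡ = loop-rule {17} {0} {16 ← var 16 ⊞ var 16 ⊞ chosen ⟦ var 17 ⟧} {s₀}
      (λ k s′ → reg s′ 16 ≡ binary (characteristic S) k) refl
      λ u s′ fr eq → cong₂ _+_ (cong₂ _+_ eq eq)
        (trans (cong (λ f → f (toℕ u)) (Frame.arrs fr chosen refl)) (trans (rep u) (sym (characteristic-lookup S u))))
    pushed : arr s₁ visited (code S) ≡ 0 → Store (run push s₁) (L ++ [ S ])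
    pushed unseen = store′ size′ rows′ seen′ unique′ sound′
      where
      module St = Store st₁
      fresh : ¬ S List.∈ L
      fresh S∈ = proj₁ (seen₁ S) S∈ unseen
      s₂ = run (visited ⟦ var 16 ⟧← lit 1) s₁
      s₃ = run copy-loop s₂
      fr₃ = frame copy-loop s₂
      size′ : reg s₃ 18 + 1 ≡ length (L ++ [ S ])
      size′ = trans (cong (_+ 1) (trans (Frame.regs fr₃ 18 refl) St.size)) (sym (List.length-++ L))
      copied : (∀ x → x < n * length L → arr s₃ queue x ≡ arr s₂ queue x) ×
               (∀ u → toℕ u < n → arr s₃ queue (n * length L + toℕ u) ≡ bit (lookup S u))
      copied = loop-rule {17} {0} {queue ⟦ 0 ⊠ var 18 ⊞ var 17 ⟧← chosen ⟦ var 17 ⟧} {s₂}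
        (λ k s′ → (∀ x → x < n * length L → arr s′ queue x ≡ arr s₂ queue x) ×
                  (∀ u → toℕ u < k → arr s′ queue (n * length L + toℕ u) ≡ bit (lookup S u)))
        ((λ _ _ → refl) , λ _ ())
        λ u s′ fr (old , new) →
          let position : n * reg s′ 18 + toℕ u ≡ n * length L + toℕ u
              position = cong (λ x → n * x + toℕ u) (trans (Frame.regs fr 18 refl) St.size)
          in (λ x lt → trans ([↦]-other (arr s′ queue) _ (λ eq → ℕ.<⇒≢
                 (ℕ.≤-trans lt (ℕ.m≤m+n (n * length L) (toℕ u))) (trans eq position))) (old x lt))
           , λ v v≤u → case v Fin.≟ u of λ
               { (yes refl) → trans ([↦]-at (arr s′ queue) _ (sym position))
                   (trans (cong (λ f → f (toℕ v)) (trans (Frame.arrs fr chosen refl) (Frame.arrs fr₁ chosen refl))) (rep v))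
               ; (no v≢u) → trans ([↦]-other (arr s′ queue) _
                     (λ eq → v≢u (Fin.toℕ-injective (ℕ.+-cancelˡ-≡ (n * length L) _ _ (trans eq position)))))
                   (new v (ℕ.≤∧≢⇒< (s≤s⁻¹ v≤u) (v≢u ∘ Fin.toℕ-injective))) }
      rows′ : Rows (arr s₃ queue) 0 (L ++ [ S ])
      rows′ = rows-∷ʳ L (proj₁ copied) (λ u → proj₂ copied u (Fin.toℕ<n u)) St.rows
      visited≡ : arr s₃ visited ≡ arr s₁ visited [ reg s₁ 16 ↦ 1 ]
      visited≡ = Frame.arrs fr₃ visited refl
      seen′ : ∀ S′ → Decides (arr s₃ visited (code S′)) (S′ List.∈ (L ++ [ S ]))
      seen′ S′ with code S′ ℕ.≟ code S
      ... | yes eq =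
        (λ _ v≡0 → case trans (sym (trans (cong (λ f → f (code S′)) visited≡)
                     ([↦]-at (arr s₁ visited) 1 (trans eq (sym code≡))))) v≡0 of λ ()) ,
        λ _ → List.∈-++⁺ʳ L (here (code-injective eq))
      ... | no ne = subst (λ a → Decides a (S′ List.∈ (L ++ [ S ])))
        (sym (trans (cong (λ f → f (code S′)) visited≡) ([↦]-other (arr s₁ visited) 1 (λ e → ne (trans e code≡)))))
        (decides-map (List.∈-++⁺ˡ)
          (λ S′∈ → case List.∈-++⁻ L S′∈ of λ
            { (inj₁ x) → x ; (inj₂ (here refl)) → contradiction refl ne })
          (seen₁ S′))
      unique′ : Unique (L ++ [ S ])
      unique′ = Unique.++⁺ St.unique ([] ∷ []) λ { (S∈ , here refl) → fresh S∈ }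
      sound′ : ∀ {S′} → S′ List.∈ (L ++ [ S ]) → Minimal Feasible S′
      sound′ S′∈ = case List.∈-++⁻ L S′∈ of λ { (inj₁ x) → St.sound x ; (inj₂ (here refl)) → min }

  attempt-insert-correct : ∀ s S L → Represents (arr s chosen) S → Store s L →
    ∃[ new ] Store (run attempt-insert s) (L ++ new) ×
      (Feasible S → ∃[ Y ] Y List.∈ (L ++ new) × Y ⊆ S)
  attempt-insert-correct s S L rep st =
    if-rule {var 5} {skip} {minimise ⨾ enqueue} {s₁} Q
      (λ ne → [] , subst (Store s₁) (sym (List.++-identityʳ L)) st₁ ,
        λ f → case decision of λ { (inj₁ (eq , _)) → contradiction eq ne ; (inj₂ (_ , ¬f)) → contradiction f ¬f })
      (λ eq → case decision of λ
        { (inj₂ (eq′ , _)) → case trans (sym eq′) eq of λ ()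
        ; (inj₁ (_ , f)) → insert f })
    where
    Q : State → Set
    Q s′ = ∃[ new ] Store s′ (L ++ new) × (Feasible S → ∃[ Y ] Y List.∈ (L ++ new) × Y ⊆ S)
    s₁ = run feasible s
    fr₁ = frame feasible s
    decision = feasible-correct S s rep
    st₁ : Store s₁ L
    st₁ = store-frame (Frame.regs fr₁ 18 refl) (Frame.arrs fr₁ queue refl) (Frame.arrs fr₁ visited refl) st
    insert : Feasible S → Q (run (minimise ⨾ enqueue) s₁)
    insert f =
      let rep₁ = subst (λ a → Represents a S) (sym (Frame.arrs fr₁ chosen refl)) rep
          S′ , rep′ , sub , min = minimise-correct s₁ S rep₁ f
          fr₂ = frame minimise s₁
          new , st′ , Y , Y∈ , Y⊆ = enqueue-correct (run minimise s₁) S′ L rep′ min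
            (store-frame (Frame.regs fr₂ 18 refl) (Frame.arrs fr₂ queue refl) (Frame.arrs fr₂ visited refl) st₁)
      in new , st′ , λ _ → Y , Y∈ , λ y → sub (Y⊆ y)

  Powers : State → Set
  Powers s = ∀ i → i ≤ K → arr s powers i ≡ n ^ i

  extend-correct : ∀ s S (ds : Vec (Fin n) K) → Powers s → Represents (arr s chosen) S →
    reg s 21 ≡ horner ds → Represents (arr (run extend s) chosen) (insertAll ds S)
  extend-correct s S ds pow rep r21 = finish {run (loop 24 2 body) s₀} (loop-rule {24} {2} {body} {s₀} I (K , ds , S , refl , r21 , rep , refl) advance)
    where
    place = par 2 ⊟ (var 24 ⊞ lit 1)
    subtract = 22 ← var 22 ⊟ powers ⟦ place ⟧ ⨾ 23 ← var 23 ⊞ lit 1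
    divide = loop 25 0 (when (var 22 ⊞ lit 1 ⊟ powers ⟦ place ⟧) subtract)
    body = 23 ← lit 0 ⨾ divide ⨾ chosen ⟦ var 23 ⟧← lit 1
    s₀ = run (22 ← var 21) s
    -- `es` are the digits still to be read: register 22 holds their value, and inserting them into
    -- the present set `S′` would finish the task.
    I : ℕ → State → Set
    I j s′ = ∃[ m ] Σ[ es ∈ Vec (Fin n) m ] ∃[ S′ ] j + m ≡ K × reg s′ 22 ≡ horner es
           × Represents (arr s′ chosen) S′ × insertAll es S′ ≡ insertAll ds S
    finish : ∀ {s′} → I K s′ → Represents (arr s′ chosen) (insertAll ds S)
    finish {s′} (zero , [] , S′ , _ , _ , rep′ , eq) = subst (Represents (arr s′ chosen)) eq rep′
    finish (suc m , _ , _ , eq , _) = contradiction (ℕ.+-cancelˡ-≡ K (suc m) 0 (trans eq (sym (ℕ.+-identityʳ K)))) λ ()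
    advance : ∀ (j : Fin K) s′ → Frame (loop 24 2 body) s₀ s′ → I (toℕ j) s′ →
              I (suc (toℕ j)) (run body (setReg 24 (toℕ j) s′))
    advance j s′ fr (zero , _ , _ , eq , _) =
      contradiction (trans (sym (ℕ.+-identityʳ (toℕ j))) eq) (ℕ.<⇒≢ (Fin.toℕ<n j))
    advance j s′ fr (suc m , e ∷ es , S′ , j+m , r22 , rep′ , same) =
      m , es , S′ [ e ]≔ true , trans (sym (ℕ.+-suc (toℕ j) m)) j+m , quotient .proj₂ ,
      subst (λ x → Represents (arr s₂ chosen [ x ↦ 1 ]) (S′ [ e ]≔ true)) (sym (quotient .proj₁))
        (represents-update {a = arr s₂ chosen} {S′} e true
          (subst (λ a → Represents a S′) (sym (Frame.arrs (frame divide s₁) chosen refl)) rep′)) ,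
      same
      where
      s₁ = run (23 ← lit 0) (setReg 24 (toℕ j) s′)
      s₂ = run divide s₁
      v = horner es
      -- `x` subtractions have been made; `x` follows the pass number `a` until it reaches the digit
      -- `e`, and then stays there.
      J : ℕ → State → Set
      J a s″ = ∃[ x ] reg s″ 23 ≡ x × reg s″ 22 ≡ n ^ m * (toℕ e ∸ x) + v × x ≤ toℕ e × (x ≡ toℕ e ⊎ x ≡ a)
      m≤K : m ≤ K
      m≤K = ℕ.≤-trans (ℕ.n≤1+n m) (ℕ.≤-trans (ℕ.m≤n+m (suc m) (toℕ j)) (ℕ.≤-reflexive j+m))
      place≡ : K ∸ (toℕ j + 1) ≡ m
      place≡ = trans (cong (_∸ (toℕ j + 1)) (trans (sym j+m) (sym (ℕ.+-assoc (toℕ j) 1 m))))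
                     (ℕ.m+n∸m≡n (toℕ j + 1) m)
      step-J : ∀ (a : Fin n) s″ → Frame divide s₁ s″ → J (toℕ a) s″ →
               J (suc (toℕ a)) (run (when (var 22 ⊞ lit 1 ⊟ powers ⟦ place ⟧) subtract) (setReg 25 (toℕ a) s″))
      step-J a s″ fr₁ (x , r23 , r22 , x≤e , x-is) =
        if-rule {var 22 ⊞ lit 1 ⊟ powers ⟦ place ⟧} {subtract} {skip} {setReg 25 (toℕ a) s″} (J (suc (toℕ a)))
          larger smaller
        where
        power≡ : arr s″ powers (K ∸ (reg s″ 24 + 1)) ≡ n ^ m
        power≡ = trans (cong (λ f → f (K ∸ (reg s″ 24 + 1))) (trans (Frame.arrs fr₁ powers refl) (Frame.arrs fr powers refl)))
          (trans (cong (arr s powers) (trans (cong (λ y → K ∸ (y + 1)) (Frame.regs fr₁ 24 refl)) place≡)) (pow m m≤K))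
        decide : Decides (reg s″ 22 + 1 ∸ arr s″ powers (K ∸ (reg s″ 24 + 1))) (n ^ m < n ^ m * (toℕ e ∸ x) + v + 1)
        decide = subst₂ (λ a b → Decides (a ∸ b) (n ^ m < n ^ m * (toℕ e ∸ x) + v + 1))
          (cong (_+ 1) (sym r22)) (sym power≡) (decides-< _ _)
        -- After `e` subtractions only `v` is left, the value of `m` lower digits, which is below
        -- `n ^ m`.
        low : x ≡ toℕ e → ¬ (n ^ m < n ^ m * (toℕ e ∸ x) + v + 1)
        low refl lt = ℕ.<-irrefl refl (ℕ.≤-trans (horner-< es) (s≤s⁻¹ (ℕ.≤-trans lt (ℕ.≤-reflexive
          (trans (ℕ.+-comm _ 1) (cong suc (trans (cong (λ y → n ^ m * y + v) (ℕ.n∸n≡0 x))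
            (cong (_+ v) (ℕ.*-zeroʳ (n ^ m))))))))))
        split : x ≢ toℕ e → n ^ m * (toℕ e ∸ x) + v ≡ n ^ m + (n ^ m * (toℕ e ∸ suc x) + v)
        split ne = trans (cong (λ y → n ^ m * y + v) (ℕ.+-∸-assoc 1 (ℕ.≤∧≢⇒< x≤e ne)))
          (trans (cong (_+ v) (ℕ.*-suc (n ^ m) (toℕ e ∸ suc x))) (ℕ.+-assoc (n ^ m) _ v))
        larger : _ → J (suc (toℕ a)) (run subtract (setReg 25 (toℕ a) s″))
        larger ne with x ℕ.≟ toℕ e
        ... | yes x≡e = contradiction (proj₂ decide ne) (low x≡e)
        ... | no x≢e  = suc x , trans (ℕ.+-comm _ 1) (cong suc r23)
                      , trans (cong₂ _∸_ (trans r22 (split x≢e)) power≡) (ℕ.m+n∸m≡n (n ^ m) _)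
                      , ℕ.≤∧≢⇒< x≤e x≢e
                      , (case x-is of λ { (inj₁ x≡e) → contradiction x≡e x≢e ; (inj₂ x≡a) → inj₂ (cong suc x≡a) })
        smaller : _ → J (suc (toℕ a)) (setReg 25 (toℕ a) s″)
        smaller eq with x ℕ.≟ toℕ e
        ... | yes x≡e = x , r23 , r22 , x≤e , inj₁ x≡e
        ... | no x≢e  = contradiction eq (proj₁ decide (ℕ.≤-trans (s≤s (ℕ.m≤m+n (n ^ m) _))
                          (ℕ.≤-reflexive (trans (cong suc (sym (split x≢e))) (ℕ.+-comm 1 _)))))
      quotient : reg s₂ 23 ≡ toℕ e × reg s₂ 22 ≡ v
      quotient with loop-rule {25} {0} {when (var 22 ⊞ lit 1 ⊟ powers ⟦ place ⟧) subtract} {s₁} J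
                      (0 , refl , r22 , z≤n , inj₂ refl) step-J
      ... | x , r23 , r22 , x≤e , inj₂ x≡n = contradiction (Fin.toℕ<n e) (ℕ.≤⇒≯ (ℕ.≤-trans (ℕ.≤-reflexive (sym x≡n)) x≤e))
      ... | x , r23 , r22 , x≤e , inj₁ x≡e = trans r23 x≡e ,
        trans r22 (trans (cong (λ y → n ^ m * y + v) (trans (cong (toℕ e ∸_) x≡e) (ℕ.n∸n≡0 (toℕ e)))) (cong (_+ v) (ℕ.*-zeroʳ (n ^ m))))

  fill-correct : ∀ s e S →
    (∀ s′ u → Frame (loop 17 0 (chosen ⟦ var 17 ⟧← e)) s s′ → eval e (setReg 17 (toℕ u) s′) ≡ bit (lookup S u)) →
    Represents (arr (run (loop 17 0 (chosen ⟦ var 17 ⟧← e)) s) chosen) S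
  fill-correct s e S h v = loop-rule {17} {0} {chosen ⟦ var 17 ⟧← e} {s}
    (λ k s′ → ∀ v → toℕ v < k → arr s′ chosen (toℕ v) ≡ bit (lookup S v)) (λ _ ())
    (λ u s′ fr old v v≤u → case v Fin.≟ u of λ
      { (yes refl) → trans ([↦]-same (arr s′ chosen) (toℕ v) _) (h s′ v fr)
      ; (no v≢u)   → trans ([↦]-other (arr s′ chosen) _ (v≢u ∘ Fin.toℕ-injective))
                           (old v (ℕ.≤∧≢⇒< (s≤s⁻¹ v≤u) (v≢u ∘ Fin.toℕ-injective))) })
    v (Fin.toℕ<n v)

  process-correct : ∀ s X L → Represents (arr s current) X → Powers s → Store s L →
    ∃[ new ] Store (run process s) (L ++ new) × Explored X (L ++ new)
  process-correct s X L rep pow st =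
    let new , st′ , ex = loop-rule {20} {0} {body} {s} I
          ([] , subst (Store s) (sym (List.++-identityʳ L)) st , λ w ()) advance
    in new , st′ , λ w w∈ ds f → ex w (Fin.toℕ<n w) w∈ ds tt f
    where
    copy-loop = loop 17 0 (chosen ⟦ var 17 ⟧← current ⟦ var 17 ⟧)
    inner = copy-loop ⨾ chosen ⟦ var 20 ⟧← lit 0 ⨾ extend ⨾ attempt-insert
    body = when (current ⟦ var 20 ⟧) (loop 21 3 inner)
    -- `P` restricts to the tuples already tried, so the same notion serves finished vertices and
    -- the one in progress.
    Done : Fin n → (Vec (Fin n) K → Set) → List (Subset n) → Set
    Done w P L′ = ∀ ds → P ds → Feasible (insertAll ds (X ∖ w)) → ∃[ Y ] Y List.∈ L′ × Y ⊆ insertAll ds (X ∖ w)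
    done-mono : ∀ {w P L′} new → Done w P L′ → Done w P (L′ ++ new)
    done-mono new d ds p f = let Y , Y∈ , Y⊆ = d ds p f in Y , List.∈-++⁺ˡ Y∈ , Y⊆
    I : ℕ → State → Set
    I k s′ = ∃[ new ] Store s′ (L ++ new) × (∀ w → toℕ w < k → w ∈ X → Done w (λ _ → ⊤) (L ++ new))
    advance : ∀ (w : Fin n) s′ → Frame (loop 20 0 body) s s′ → I (toℕ w) s′ →
              I (suc (toℕ w)) (run body (setReg 20 (toℕ w) s′))
    advance w s′ fr (new , st , dn) =
      if-rule {current ⟦ var 20 ⟧} {loop 21 3 inner} {skip} {s₀} (I (suc (toℕ w)))
        (λ ne → let new′ , st′ , d = loop-rule {21} {3} {inner} {s₀} J
                      ([] , subst (Store s₀) (sym (List.++-identityʳ (L ++ new))) st₀ , λ _ ()) explore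
                in new ++ new′ , subst (Store _) (List.++-assoc L new new′) st′ ,
                   λ v v≤w v∈ → subst (Done v (λ _ → ⊤)) (List.++-assoc L new new′) (case ℕ.m<1+n⇒m<n∨m≡n v≤w of λ
                     { (inj₁ v<w) → done-mono new′ (dn v v<w v∈)
                     ; (inj₂ v≡w) → subst (λ u → Done u (λ _ → ⊤) ((L ++ new) ++ new′)) (sym (Fin.toℕ-injective v≡w))
                                      (λ ds _ → d ds (horner-< ds)) }))
        (λ eq → new , st₀ , λ v v≤w v∈ → case ℕ.m<1+n⇒m<n∨m≡n v≤w of λ
          { (inj₁ v<w) → dn v v<w v∈
          ; (inj₂ v≡w) → contradiction eq (proj₁ (decides-∈ {a = arr s′ current} {X} rep′ w)
                           (subst (_∈ X) (Fin.toℕ-injective v≡w) v∈)) })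
      where
      s₀ = setReg 20 (toℕ w) s′
      st₀ : Store s₀ (L ++ new)
      st₀ = store-frame refl refl refl st
      rep′ : Represents (arr s′ current) X
      rep′ = subst (λ a → Represents a X) (sym (Frame.arrs fr current refl)) rep
      J : ℕ → State → Set
      J t s″ = ∃[ new′ ] Store s″ ((L ++ new) ++ new′) × Done w (λ ds → horner ds < t) ((L ++ new) ++ new′)
      explore : ∀ (t : Fin (n ^ K)) s″ → Frame (loop 21 3 inner) s₀ s″ → J (toℕ t) s″ →
                J (suc (toℕ t)) (run inner (setReg 21 (toℕ t) s″))
      explore t s″ fr′ (new′ , st″ , d) =
        let new″ , st‴ , found = attempt-insert-correct s₄ W ((L ++ new) ++ new′) rep₄ st₄
            assoc = List.++-assoc (L ++ new) new′ new″
        in new′ ++ new″ , subst (Store (run attempt-insert s₄)) assoc st‴ ,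
           subst (Done w (λ ds → horner ds < suc (toℕ t))) assoc
             (λ es lt → case ℕ.m<1+n⇒m<n∨m≡n lt of λ
               { (inj₁ lt′) → done-mono {w} {λ ds → horner ds < toℕ t} new″ d es lt′
               ; (inj₂ eq)  → subst (λ fs → Feasible (insertAll fs (X ∖ w)) →
                                ∃[ Y ] Y List.∈ (((L ++ new) ++ new′) ++ new″) × Y ⊆ insertAll fs (X ∖ w))
                                (horner-injective {ds = ds} {es} (trans (horner-digits K t) (sym eq))) found })
        where
        ds = digits K t
        W = insertAll ds (X ∖ w)
        s₁ = setReg 21 (toℕ t) s″
        s₂ = run copy-loop s₁
        s₃ = run (chosen ⟦ var 20 ⟧← lit 0) s₂
        s₄ = run extend s₃
        fr₂ = frame copy-loop s₁
        fr₄ = frame extend s₃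
        r20 : reg s₂ 20 ≡ toℕ w
        r20 = trans (Frame.regs fr₂ 20 refl) (Frame.regs fr′ 20 refl)
        rep₂ : Represents (arr s₂ chosen) X
        rep₂ = fill-correct s₁ (current ⟦ var 17 ⟧) X (λ s‴ u fr″ →
          trans (cong (λ f → f (toℕ u)) (trans (Frame.arrs fr″ current refl) (Frame.arrs fr′ current refl))) (rep′ u))
        rep₃ : Represents (arr s₃ chosen) (X ∖ w)
        rep₃ = subst (λ x → Represents (arr s₂ chosen [ x ↦ 0 ]) (X ∖ w)) (sym r20)
                 (represents-update {a = arr s₂ chosen} {X} w false rep₂)
        pow₃ : Powers s₃
        pow₃ i i≤K = trans (cong (λ f → f i) (trans (Frame.arrs fr₂ powers refl) (trans (Frame.arrs fr′ powers refl) (Frame.arrs fr powers refl))))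
                           (pow i i≤K)
        rep₄ : Represents (arr s₄ chosen) W
        rep₄ = extend-correct s₃ (X ∖ w) ds pow₃ rep₃
                 (trans (Frame.regs fr₂ 21 refl) (sym (horner-digits K t)))
        st₄ : Store s₄ ((L ++ new) ++ new′)
        st₄ = store-frame (trans (Frame.regs fr₄ 18 refl) (Frame.regs fr₂ 18 refl))
                (trans (Frame.arrs fr₄ queue refl) (Frame.arrs fr₂ queue refl))
                (trans (Frame.arrs fr₄ visited refl) (Frame.arrs fr₂ visited refl)) st″

  full : Subset n
  full = tabulate (λ _ → true)

  -- `front` has left the queue and has been processed, `rest` is waiting. `nonempty` yields the
  -- solution from which all others are reached; it is conditional because an instance may have
  -- none.
  record Progress (s : State) (front rest : List (Subset n)) : Set where
    constructor progress
    field
      stored   : Store s (front ++ rest)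
      head     : reg s 19 ≡ length front
      powers≡  : Powers s
      explored : ∀ {X} → X List.∈ front → Explored X (front ++ rest)
      nonempty : Feasible full → ∃[ Y ] Y List.∈ (front ++ rest)

  Pending : State → List (Subset n) → Set
  Pending s rest = reg s 0 ≡ length rest

  start-correct : ∀ s → Powers s → reg s 18 ≡ 0 → reg s 19 ≡ 0 → (∀ a → arr s visited a ≡ 0) →
    ∃[ new ] Progress (run start-search s) [] new × Pending (run start-search s) new
  start-correct s pow r18 r19 vis =
    let new , st , found = attempt-insert-correct s₁ full [] rep₁ st₁
    in new , conclude (run attempt-insert s₁) st (trans (Frame.regs fr₂ 19 refl) (trans (Frame.regs fr₁ 19 refl) r19))
             (λ i i≤K → trans (cong (λ f → f i) (trans (Frame.arrs fr₂ powers refl) (Frame.arrs fr₁ powers refl))) (pow i i≤K))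
             (λ f → let Y , Y∈ , _ = found f in Y , Y∈)
    where
    conclude : ∀ s₂ {new} → Store s₂ new → reg s₂ 19 ≡ 0 → Powers s₂ → (Feasible full → ∃[ Y ] Y List.∈ new) →
      Progress (run (0 ← var 18 ⊟ var 19) s₂) [] new × Pending (run (0 ← var 18 ⊟ var 19) s₂) new
    conclude s₂ st r19 pow ne = progress (store-frame refl refl refl st) r19 pow (λ ()) ne ,
                                cong₂ _∸_ (Store.size st) r19
    fill = loop 17 0 (chosen ⟦ var 17 ⟧← lit 1)
    s₁ = run fill s
    fr₁ = frame fill s
    fr₂ = frame attempt-insert s₁
    rep₁ : Represents (arr s₁ chosen) full
    rep₁ = fill-correct s (lit 1) full (λ s′ u _ → cong bit (sym (Vec.lookup∘tabulate (λ _ → true) u)))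
    st₁ : Store s₁ []
    st₁ = store-frame {s} (Frame.regs fr₁ 18 refl) (Frame.arrs fr₁ queue refl) (Frame.arrs fr₁ visited refl)
      (store′ r18 [] (λ S → (λ ()) , λ ne → contradiction (vis (code S)) ne) [] (λ ()))

  dequeue-correct : ∀ s X front rest → Progress s front (X ∷ rest) → written s ≡ [] →
    let s′ = run dequeue s in
    Progress s′ front (X ∷ rest) × Represents (arr s′ current) X × written s′ ≡ encodeSubset X
  dequeue-correct s X front rest (progress st hd pow ex ne) w≡[] =
    progress (store-frame (Frame.regs fr 18 refl) (Frame.arrs fr queue refl) (Frame.arrs fr visited refl) st)
      (trans (Frame.regs fr 19 refl) hd)
      (λ i i≤K → trans (cong (λ f → f i) (Frame.arrs fr powers refl)) (pow i i≤K)) ex ne ,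
    (λ u → proj₁ result u (Fin.toℕ<n u)) ,
    trans (proj₂ result) (applyUpTo-characteristic X)
    where
    body = current ⟦ var 17 ⟧← queue ⟦ 0 ⊠ var 19 ⊞ var 17 ⟧ ⨾ out (current ⟦ var 17 ⟧)
    fr = frame dequeue s
    result : (∀ u → toℕ u < n → arr (run dequeue s) current (toℕ u) ≡ bit (lookup X u)) ×
             written (run dequeue s) ≡ applyUpTo (characteristic X) n
    result = loop-rule {17} {0} {body} {s}
      (λ k s′ → (∀ u → toℕ u < k → arr s′ current (toℕ u) ≡ bit (lookup X u)) ×
                written s′ ≡ applyUpTo (characteristic X) k)
      ((λ _ ()) , w≡[])
      λ u s′ fr′ (old , w≡) →
        let entry : arr s′ queue (n * reg s′ 19 + toℕ u) ≡ bit (lookup X u)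
            entry = trans (cong₂ (λ f x → f (n * x + toℕ u)) (Frame.arrs fr′ queue refl) (trans (Frame.regs fr′ 19 refl) hd))
                          (rows-lookup front (Store.rows st) u)
            read : (arr s′ current [ toℕ u ↦ arr s′ queue (n * reg s′ 19 + toℕ u) ]) (toℕ u) ≡ bit (lookup X u)
            read = trans ([↦]-same (arr s′ current) (toℕ u) _) entry
        in (λ v v≤u → case v Fin.≟ u of λ
              { (yes refl) → read
              ; (no v≢u)   → trans ([↦]-other (arr s′ current) _ (v≢u ∘ Fin.toℕ-injective))
                               (old v (ℕ.≤∧≢⇒< (s≤s⁻¹ v≤u) (v≢u ∘ Fin.toℕ-injective))) })
         , trans (cong₂ (λ w a → w ++ [ a ]) w≡ (trans read (sym (characteristic-lookup X u))))
                 (List.applyUpTo-∷ʳ (characteristic X) (toℕ u))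

  advance-correct : ∀ s X front rest → Progress s front (X ∷ rest) → Represents (arr s current) X →
    let s′ = run advance-search s in
    ∃[ new ] Progress s′ (front ++ [ X ]) (rest ++ new) × Pending s′ (rest ++ new)
  advance-correct s X front rest (progress st hd pow ex ne) rep =
    let new , st′ , ex′ = process-correct s₁ X (front ++ X ∷ rest) rep pow (store-frame refl refl refl st)
        regroup : (front ++ X ∷ rest) ++ new ≡ (front ++ [ X ]) ++ (rest ++ new)
        regroup = trans (cong (_++ new) (sym (List.++-assoc front [ X ] rest)))
                        (List.++-assoc (front ++ [ X ]) rest new)
        grow : ∀ {Z} → Explored Z (front ++ X ∷ rest) → Explored Z ((front ++ X ∷ rest) ++ new)
        grow e w w∈ ds f = let Y , Y∈ , Y⊆ = e w w∈ ds f in Y , List.∈-++⁺ˡ Y∈ , Y⊆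
        r19 : reg s₂ 19 ≡ length (front ++ [ X ])
        r19 = trans (Frame.regs fr 19 refl) (trans (cong (_+ 1) hd) (sym (List.length-++ front)))
        st″ : Store s₂ ((front ++ [ X ]) ++ (rest ++ new))
        st″ = subst (Store s₂) regroup st′
    in new ,
       progress (store-frame refl refl refl st″) r19
         (λ i i≤K → trans (cong (λ f → f i) (Frame.arrs fr powers refl)) (pow i i≤K))
         (λ {Z} Z∈ → subst (Explored Z) regroup (case List.∈-++⁻ front Z∈ of λ
            { (inj₁ z) → grow (ex z) ; (inj₂ (here refl)) → ex′ }))
         (λ f → let Y , Y∈ = ne f in Y , subst (Y List.∈_) regroup (List.∈-++⁺ˡ Y∈)) ,
       trans (cong₂ _∸_ (trans (Store.size st″) (List.length-++ (front ++ [ X ]))) r19)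
             (ℕ.m+n∸m≡n (length (front ++ [ X ])) (length (rest ++ new)))
    where
    s₁ = run (19 ← var 19 ⊞ lit 1) s
    s₂ = run process s₁
    fr = frame process s₁

  -- With an empty queue every listed solution is explored, so `reach` leads from any one of them to
  -- an arbitrary minimal set.
  complete : ∀ {s L} → Progress s L [] → Unique L × (∀ S → S List.∈ L ⇔ Minimal Feasible S)
  complete {s} {L} p =
    subst Unique (List.++-identityʳ L) (Store.unique stored) ,
    λ S → mk⇔ sound all
    where
    open Progress p
    back : ∀ {X} → X List.∈ (L ++ []) → X List.∈ L
    back = subst (_ List.∈_) (List.++-identityʳ L)
    sound : ∀ {X} → X List.∈ L → Minimal Feasible X
    sound X∈ = Store.sound stored (List.∈-++⁺ˡ X∈)
    all : ∀ {S} → Minimal Feasible S → S List.∈ L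
    all {S} min = let Y , Y∈ = nonempty (feasible-mono (λ {u} _ → ∈-tabulate⁺ refl) (proj₁ min)) in
      reach L (λ X∈ → subst (Explored _) (List.++-identityʳ L) (explored X∈)) sound min
        (∣ Y ∩ ∁ S ∣) (back Y∈) ℕ.≤-refl

-- Reading the input

contents-++ˡ : ∀ xs ys {i} → i < length xs → contents (xs ++ ys) i ≡ contents xs i
contents-++ˡ (x ∷ xs) ys {zero}  lt       = refl
contents-++ˡ (x ∷ xs) ys {suc i} (s≤s lt) = contents-++ˡ xs ys lt

contents-++ʳ : ∀ xs ys i → contents (xs ++ ys) (length xs + i) ≡ contents ys i
contents-++ʳ []       ys i = refl
contents-++ʳ (x ∷ xs) ys i = contents-++ʳ xs ys i

contents-outside : ∀ xs {i} → length xs ≤ i → contents xs i ≡ 0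
contents-outside []       le       = refl
contents-outside (x ∷ xs) (s≤s le) = contents-outside xs le

contents-tabulate : ∀ {n} (f : Fin n → ℕ) u → contents (List.tabulate f) (toℕ u) ≡ f u
contents-tabulate f zero    = refl
contents-tabulate f (suc u) = contents-tabulate (f ∘ suc) u

contents-allFin : ∀ {n} (f : Fin n → ℕ) u → contents (map f (allFin n)) (toℕ u) ≡ f u
contents-allFin f u = trans (cong (λ xs → contents xs (toℕ u)) (List.map-tabulate id f)) (contents-tabulate f u)

module _ {X Y : Set} (f : X → Y → Bool) where

  contents-cartesian : ∀ {m n} (g : Fin m → X) (h : Fin n → Y) u v →
    contents (map bit (cartesianProductWith f (List.tabulate g) (List.tabulate h))) (n * toℕ u + toℕ v) ≡
    bit (f (g u) (h v))
  contents-cartesian {n = n} g h zero v =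
    trans (cong₂ contents (List.map-++ bit (map (f (g zero)) (List.tabulate h)) _) (cong (_+ toℕ v) (ℕ.*-zeroʳ n)))
      (trans (contents-++ˡ (map bit (map (f (g zero)) (List.tabulate h))) _
                (ℕ.≤-trans (Fin.toℕ<n v) (ℕ.≤-reflexive (sym (row-length g)))))
        (trans (cong (λ xs → contents xs (toℕ v))
                  (trans (cong (map bit) (List.map-tabulate h (f (g zero)))) (List.map-tabulate (f (g zero) ∘ h) bit)))
               (contents-tabulate (bit ∘ f (g zero) ∘ h) v)))
    where
    row-length : ∀ {m} (g : Fin (suc m) → X) → length (map bit (map (f (g zero)) (List.tabulate h))) ≡ n
    row-length g = 
      trans (List.length-map bit (map (f (g zero)) (List.tabulate h)))
        (trans (List.length-map (f (g zero)) (List.tabulate h)) (List.length-tabulate h))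
  contents-cartesian {n = n} g h (suc u) v =
    trans (cong₂ contents (List.map-++ bit row _)
             (trans (cong (_+ toℕ v) (ℕ.*-suc n (toℕ u)))
               (trans (ℕ.+-assoc n (n * toℕ u) (toℕ v)) (cong (_+ (n * toℕ u + toℕ v)) (sym row-length)))))
      (trans (contents-++ʳ (map bit row) _ (n * toℕ u + toℕ v)) (contents-cartesian (g ∘ suc) h u v))
    where
    row = map (f (g zero)) (List.tabulate h)
    row-length : length (map bit row) ≡ n
    row-length = trans (List.length-map bit row) (trans (List.length-map (f (g zero)) (List.tabulate h)) (List.length-tabulate h))

length-cartesianProductWith : ∀ {X Y Z : Set} (f : X → Y → Z) xs ys →
  length (cartesianProductWith f xs ys) ≡ length xs * length ys
length-cartesianProductWith f []       ys = refl
length-cartesianProductWith f (x ∷ xs) ys =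
  trans (List.length-++ (map (f x) ys)) (cong₂ _+_ (List.length-map (f x) ys) (length-cartesianProductWith f xs ys))

-- The offset 1 skips the word n at address 0 of the input; the rows of the matrix and then the
-- capacities follow.
adjₑ : Expr → Expr → Expr
adjₑ e e′ = input (lit 1 ⊞ (0 ⊠ e ⊞ e′))

capₑ : Expr → Expr
capₑ e = input (lit 1 ⊞ (0 ⊠ par 0 ⊞ e))

eqₑ : Expr → Expr → Expr
eqₑ e e′ = lit 1 ⊟ ((e ⊟ e′) ⊞ (e′ ⊟ e))

decides-≡ : ∀ a b → Decides (1 ∸ ((a ∸ b) + (b ∸ a))) (a ≡ b)
decides-≡ a b = (λ { refl → subst (λ x → 1 ∸ (x + x) ≢ 0) (sym (ℕ.n∸n≡0 a)) λ () }) , h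
  where
  h : 1 ∸ ((a ∸ b) + (b ∸ a)) ≢ 0 → a ≡ b
  h ne with (a ∸ b) + (b ∸ a) in eq
  ... | zero  = ℕ.≤-antisym (ℕ.m∸n≡0⇒m≤n (ℕ.m+n≡0⇒m≡0 (a ∸ b) eq)) (ℕ.m∸n≡0⇒m≤n (ℕ.m+n≡0⇒n≡0 (a ∸ b) eq))
  ... | suc x = contradiction (ℕ.0∸n≡0 x) ne

module Input {n} (G : Graph n) (c : Capacity n) where

  inp : ℕ → ℕ
  inp = contents (encodeInput G c)

  matrix : Word
  matrix = map bit (cartesianProductWith (adj G) (allFin n) (allFin n))

  matrix-length : length matrix ≡ n * n
  matrix-length = trans (List.length-map bit (cartesianProductWith (adj G) (allFin n) (allFin n)))
    (trans (length-cartesianProductWith (adj G) (allFin n) (allFin n))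
           (cong₂ _*_ (List.length-tabulate {n = n} id) (List.length-tabulate {n = n} id)))

  inp-adj : ∀ u v → inp (suc (n * toℕ u + toℕ v)) ≡ bit (adj G u v)
  inp-adj u v = trans
    (contents-++ˡ matrix (map c (allFin n)) (subst₂ _<_ (Fin.toℕ-combine u v) (sym matrix-length) (Fin.toℕ<n (combine u v))))
    (contents-cartesian (adj G) id id u v)

  inp-cap : ∀ w → inp (suc (n * n + toℕ w)) ≡ c w
  inp-cap w = trans (cong (λ x → contents (matrix ++ map c (allFin n)) (x + toℕ w)) (sym matrix-length))
    (trans (contents-++ʳ matrix (map c (allFin n)) (toℕ w)) (contents-allFin c w))

  -- The length of the input, and thus the first address available to the arrays.
  base : ℕ
  base = 1 + n + n * n

  inp-outside : ∀ y → base ≤ y → inp y ≡ 0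
  inp-outside y le = contents-outside (encodeInput G c) (ℕ.≤-trans (ℕ.≤-reflexive (cong suc
    (trans (List.length-++ matrix) (trans (cong₂ _+_ matrix-length
      (trans (List.length-map c (allFin n)) (List.length-tabulate id))) (ℕ.+-comm (n * n) n))))) le)

  module _ (ρ : ℕ → ℕ) (ρ0 : ρ 0 ≡ n) where

    open Semantics inp ρ

    eval-adj : ∀ {e e′ s} u v → eval e s ≡ toℕ u → eval e′ s ≡ toℕ v → eval (adjₑ e e′) s ≡ bit (adj G u v)
    eval-adj u v p q = trans (cong inp (cong suc (cong₂ _+_ (cong₂ _*_ ρ0 p) q))) (inp-adj u v)

    eval-cap : ∀ {e s} w → eval e s ≡ toℕ w → eval (capₑ e) s ≡ c w
    eval-cap w p = trans (cong inp (cong suc (cong₂ _+_ (cong₂ _*_ ρ0 ρ0) p))) (inp-cap w)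

    decides-adj : ∀ {e e′ s} u v → eval e s ≡ toℕ u → eval e′ s ≡ toℕ v →
                  Decides (eval (adjₑ e e′) s) (Adjacent G u v)
    decides-adj {e} {e′} {s} u v p q =
      subst (λ x → Decides x (Adjacent G u v)) (sym (eval-adj {e} {e′} {s} u v p q)) (decides-bit (adj G u v))

    decides-vertex≡ : ∀ {e e′ s} {u v : Fin n} → eval e s ≡ toℕ u → eval e′ s ≡ toℕ v →
                      Decides (eval (eqₑ e e′) s) (u ≡ v)
    decides-vertex≡ {u = u} {v} p q = subst₂ (λ a b → Decides (1 ∸ ((a ∸ b) + (b ∸ a))) (u ≡ v)) (sym p) (sym q)
      (decides-map Fin.toℕ-injective (cong toℕ) (decides-≡ (toℕ u) (toℕ v)))

coverJobₑ coverOkₑ dominationJobₑ dominationOkₑ : Expr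
coverJobₑ = andₑ (var 2 ⊟ var 1) (adjₑ (var 1) (var 2))
coverOkₑ = andₑ (capₑ (var 3) ⊟ var 4) (eqₑ (var 3) (var 7) ⊞ eqₑ (var 3) (var 8))
dominationJobₑ = eqₑ (var 1) (var 2)
dominationOkₑ =
  andₑ (lit 1 ⊟ var 4) (eqₑ (var 3) (var 7)) ⊞
  andₑ (var 4) (andₑ (capₑ (var 3) ⊞ lit 1 ⊟ var 4) (adjₑ (var 7) (var 3)))

JobSpec OkSpec : (∀ {n} → Graph n → Capacity n → (K : ℕ) → AssignmentProblem n K) → Expr → Set
JobSpec A e = ∀ {n} (G : Graph n) (c : Capacity n) B K P R s (u v : Fin n) →
  reg s 1 ≡ toℕ u → reg s 2 ≡ toℕ v →
  Decides (Semantics.eval (Input.inp G c) (environment n B K P R) e s) (AssignmentProblem.Job (A G c K) u v)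
OkSpec A e = ∀ {n} (G : Graph n) (c : Capacity n) B K P R s (u v w : Fin n) (i : Fin K) →
  reg s 7 ≡ toℕ u → reg s 8 ≡ toℕ v → reg s 3 ≡ toℕ w → reg s 4 ≡ toℕ i →
  Decides (Semantics.eval (Input.inp G c) (environment n B K P R) e s) (AssignmentProblem.Ok (A G c K) u v w i)

coverJob-spec : JobSpec vertexCoverProblem coverJobₑ
coverJob-spec {n} G c B K P R s u v r1 r2 = decides-and
  (subst₂ (λ a b → Decides (b ∸ a) (u Fin.< v)) (sym r1) (sym r2) (decides-< (toℕ u) (toℕ v)))
  (Input.decides-adj G c (environment n B K P R) refl {var 1} {var 2} {s} u v r1 r2)

coverOk-spec : OkSpec vertexCoverProblem coverOkₑ
coverOk-spec {n} G c B K P R s u v w i r7 r8 r3 r4 = decides-and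
  (subst₂ (λ a b → Decides (b ∸ a) (toℕ i < c w)) (sym r4)
    (sym (Input.eval-cap G c (environment n B K P R) refl {var 3} {s} w r3)) (decides-< (toℕ i) (c w)))
  (decides-or
    (Input.decides-vertex≡ G c (environment n B K P R) refl {var 3} {var 7} {s} {w} {u} r3 r7)
    (Input.decides-vertex≡ G c (environment n B K P R) refl {var 3} {var 8} {s} {w} {v} r3 r8))

dominationJob-spec : JobSpec dominatingSetProblem dominationJobₑ
dominationJob-spec {n} G c B K P R s u v r1 r2 =
  Input.decides-vertex≡ G c (environment n B K P R) refl {var 1} {var 2} {s} {u} {v} r1 r2

dominationOk-spec : OkSpec dominatingSetProblem dominationOkₑ
dominationOk-spec {n} G c B K P R s u v w i r7 r8 r3 r4 = decides-or
  (decides-and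
    (subst (λ a → Decides (1 ∸ a) (toℕ i ≡ 0)) (sym r4) (decides-zero (toℕ i)))
    (Input.decides-vertex≡ G c (environment n B K P R) refl {var 3} {var 7} {s} {w} {u} r3 r7))
  (decides-and
    (subst (λ a → Decides a (0 < toℕ i)) (sym r4) (ℕ.m<n⇒n≢0 , ℕ.n≢0⇒n>0))
    (decides-and
      (subst₂ (λ a b → Decides (b + 1 ∸ a) (toℕ i ≤ c w)) (sym r4)
        (sym (Input.eval-cap G c (environment n B K P R) refl {var 3} {s} w r3))
        (decides-map (λ lt → s≤s⁻¹ (ℕ.≤-trans lt (ℕ.≤-reflexive (ℕ.+-comm (c w) 1))))
                     (λ le → ℕ.≤-trans (s≤s le) (ℕ.≤-reflexive (ℕ.+-comm 1 (c w))))
                     (decides-< (toℕ i) (c w + 1))))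
      (Input.decides-adj G c (environment n B K P R) refl {var 7} {var 3} {s} u w r7 r3)))
  where
  decides-zero : ∀ x → Decides (1 ∸ x) (x ≡ 0)
  decides-zero zero    = (λ _ ()) , λ _ → refl
  decides-zero (suc x) = (λ ()) , λ ne → contradiction (ℕ.0∸n≡0 x) ne

-- In truncated arithmetic `x + (y ∸ x)` is a maximum and `x ∸ (x ∸ y)` a minimum. Register 33
-- receives `min {q, Δ} + 1`, the number K of slots per vertex.
computeSlots : Cmd
computeSlots =
  30 ← lit 0 ⨾
  loop 27 0 (30 ← var 30 ⊞ (capₑ (var 27) ⊟ var 30)) ⨾
  31 ← lit 0 ⨾
  loop 27 0
    (32 ← lit 0 ⨾
     loop 28 0 (32 ← var 32 ⊞ adjₑ (var 27) (var 28)) ⨾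
     31 ← var 31 ⊞ (var 32 ⊟ var 31)) ⨾
  33 ← lit 1 ⊞ (var 30 ⊟ (var 30 ⊟ var 31))

computePowers : Cmd
computePowers =
  powers ⟦ lit 0 ⟧← lit 1 ⨾
  loop 26 2 (powers ⟦ var 26 ⊞ lit 1 ⟧← 0 ⊠ powers ⟦ var 26 ⟧) ⨾
  34 ← powers ⟦ par 2 ⟧ ⨾
  -- The number of auction rounds: with `n * K` slots, none priced above `n * K`, this exceeds every
  -- possible sum of prices.
  35 ← 0 ⊠ (2 ⊠ (0 ⊠ par 2)) ⊞ lit 1

m+[n∸m]≤ : ∀ {m n o} → m ≤ o → n ≤ o → m + (n ∸ m) ≤ o
m+[n∸m]≤ {m} {n} m≤o n≤o with ℕ.≤-total m n
... | inj₁ m≤n = ℕ.≤-trans (ℕ.≤-reflexive (ℕ.m+[n∸m]≡n m≤n)) n≤o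
... | inj₂ n≤m = ℕ.≤-trans (ℕ.≤-reflexive (trans (cong (m +_) (ℕ.m≤n⇒m∸n≡0 n≤m)) (ℕ.+-identityʳ m))) m≤o

≤m∸[m∸n] : ∀ {m n o} → o ≤ m → o ≤ n → o ≤ m ∸ (m ∸ n)
≤m∸[m∸n] {m} {n} {o} o≤m o≤n with ℕ.≤-total m n
... | inj₁ m≤n = ℕ.≤-trans o≤m (ℕ.≤-reflexive (cong (m ∸_) (sym (ℕ.m≤n⇒m∸n≡0 m≤n))))
... | inj₂ n≤m = ℕ.≤-trans o≤n (ℕ.≤-reflexive (sym (ℕ.m∸[m∸n]≡n n≤m)))

≤-max-map : ∀ {n} (f : Fin n → ℕ) u → f u ≤ max 0 (map f (allFin n))
≤-max-map {n} f u = All.lookup (Extrema.xs≤max 0 (map f (allFin n))) (List.∈-map⁺ f (List.∈-allFin u))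

record Initialised (s : State) : Set where
  constructor initialised
  field
    reg18    : reg s 18 ≡ 0
    reg19    : reg s 19 ≡ 0
    visited≡ : ∀ a → arr s visited a ≡ 0
    written≡ : written s ≡ []

-- Parameters are produced in stages, so each command here runs in an environment where the later
-- ones are still 0.
module Preparation {n} (G : Graph n) (c : Capacity n) (B : ℕ) where

  open Input G c using (inp; eval-adj; eval-cap)

  module _ where
    ρ = environment n B 0 0 0
    open Semantics inp ρ
    open Verification inp ρ

    computeSlots-correct : ∀ s → Initialised s → let s′ = run computeSlots s in
      Initialised s′ × ∃[ r ] reg s′ 33 ≡ suc r × r ≤ maxCapacity c ⊓ maxDegree G × SlotsSuffice G c r
    computeSlots-correct s ini =
      let q≥ , q≤ = capacities ; d≥ , d≤ = degrees
          q = reg s₄ 30 ; d = reg s₄ 31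
          q≡ : q ≡ reg s₂ 30
          q≡ = Frame.regs fr₄ 30 refl
      in unchanged , q ∸ (q ∸ d) , refl
         , ℕ.⊓-glb (ℕ.≤-trans (ℕ.m∸n≤m q (q ∸ d)) (ℕ.≤-trans (ℕ.≤-reflexive q≡) q≤))
                   (ℕ.≤-trans (ℕ.m≤n+o⇒m∸n≤o q (q ∸ d)
                      (ℕ.≤-trans (ℕ.m≤n+m∸n q d) (ℕ.≤-reflexive (ℕ.+-comm d (q ∸ d))))) d≤)
         , λ w x≤c x≤d → ≤m∸[m∸n]
             (ℕ.≤-trans x≤c (ℕ.≤-trans (q≥ w (Fin.toℕ<n w)) (ℕ.≤-reflexive (sym q≡))))
             (ℕ.≤-trans x≤d (d≥ w (Fin.toℕ<n w)))
      where
      body₁ = 30 ← var 30 ⊞ (capₑ (var 27) ⊟ var 30)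
      count = 32 ← var 32 ⊞ adjₑ (var 27) (var 28)
      body₂ = 32 ← lit 0 ⨾ loop 28 0 count ⨾ 31 ← var 31 ⊞ (var 32 ⊟ var 31)
      s₁ = run (30 ← lit 0) s
      s₂ = run (loop 27 0 body₁) s₁
      s₃ = run (31 ← lit 0) s₂
      s₄ = run (loop 27 0 body₂) s₃
      fr₂ = frame (loop 27 0 body₁) s₁
      fr₄ = frame (loop 27 0 body₂) s₃
      unchanged : Initialised (run (33 ← lit 1 ⊞ (var 30 ⊟ (var 30 ⊟ var 31))) s₄)
      unchanged = initialised
        (trans (Frame.regs fr₄ 18 refl) (trans (Frame.regs fr₂ 18 refl) (Initialised.reg18 ini)))
        (trans (Frame.regs fr₄ 19 refl) (trans (Frame.regs fr₂ 19 refl) (Initialised.reg19 ini)))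
        (λ a → trans (cong (λ f → f a) (trans (Frame.arrs fr₄ visited refl) (Frame.arrs fr₂ visited refl))) (Initialised.visited≡ ini a))
        (trans (Frame.outs fr₄ refl) (trans (Frame.outs fr₂ refl) (Initialised.written≡ ini)))
      extend-bound : ∀ {k} {x y z : ℕ} {f : Fin n → ℕ} (u : Fin n) → toℕ u ≡ k → y ≡ f u → z ≡ x + (y ∸ x) →
        (∀ w → toℕ w < k → f w ≤ x) → ∀ w → toℕ w < suc k → f w ≤ z
      extend-bound {x = x} {y} u refl refl refl old w le with ℕ.m<1+n⇒m<n∨m≡n le
      ... | inj₁ lt = ℕ.≤-trans (old w lt) (ℕ.m≤m+n x (y ∸ x))
      ... | inj₂ eq with Fin.toℕ-injective eq
      ...   | refl = ℕ.m≤n+m∸n y x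
      capacities : (∀ w → toℕ w < n → c w ≤ reg s₂ 30) × reg s₂ 30 ≤ maxCapacity c
      capacities = loop-rule {27} {0} {body₁} {s₁}
        (λ k s′ → (∀ w → toℕ w < k → c w ≤ reg s′ 30) × reg s′ 30 ≤ maxCapacity c)
        ((λ _ ()) , z≤n)
        λ u s′ fr (old , le) →
          let cap≡ = eval-cap ρ refl {var 27} {setReg 27 (toℕ u) s′} u refl in
          extend-bound {f = c} u refl cap≡ refl old ,
          m+[n∸m]≤ le (ℕ.≤-trans (ℕ.≤-reflexive cap≡) (≤-max-map c u))
      degrees : (∀ w → toℕ w < n → degree G w ≤ reg s₄ 31) × reg s₄ 31 ≤ maxDegree G
      degrees = loop-rule {27} {0} {body₂} {s₃}
        (λ k s′ → (∀ w → toℕ w < k → degree G w ≤ reg s′ 31) × reg s′ 31 ≤ maxDegree G)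
        ((λ _ ()) , z≤n)
        λ u s′ fr (old , le) →
          let t = run (32 ← lit 0) (setReg 27 (toℕ u) s′)
              deg≡ : reg (run (loop 28 0 count) t) 32 ≡ degree G u
              deg≡ = trans (loop-rule {28} {0} {count} {t}
                (λ k s″ → reg s″ 32 ≡ countBelow (tabulate (adj G u)) k) (sym (countBelow-zero (tabulate (adj G u))))
                (λ v s″ fr″ eq → trans (cong₂ _+_ eq
                   (trans (eval-adj ρ refl {var 27} {var 28} {setReg 28 (toℕ v) s″} u v (Frame.regs fr″ 27 refl) refl)
                          (cong bit (sym (Vec.lookup∘tabulate (adj G u) v)))))
                   (sym (countBelow-suc (tabulate (adj G u)) v))))
                (countBelow-all (tabulate (adj G u)))
              old≡ : reg (run (loop 28 0 count) t) 31 ≡ reg s′ 31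
              old≡ = Frame.regs (frame (loop 28 0 count) t) 31 refl
          in extend-bound {f = degree G} u refl deg≡ refl
               (λ w lt → ℕ.≤-trans (old w lt) (ℕ.≤-reflexive (sym old≡))) ,
             m+[n∸m]≤ (ℕ.≤-trans (ℕ.≤-reflexive old≡) le)
               (ℕ.≤-trans (ℕ.≤-reflexive deg≡) (≤-max-map (degree G) u))

  computePowers-correct : ∀ K s → Initialised s →
    let s′ = Semantics.run inp (environment n B K 0 0) computePowers s in
    Initialised s′ × (∀ i → i ≤ K → arr s′ powers i ≡ n ^ i) × reg s′ 34 ≡ n ^ K ×
    reg s′ 35 ≡ n * K * (n * K) + 1
  computePowers-correct K s ini =
    initialised (trans (Frame.regs fr 18 refl) (Initialised.reg18 ini))
      (trans (Frame.regs fr 19 refl) (Initialised.reg19 ini))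
      (λ a → trans (cong (λ f → f a) (Frame.arrs fr visited refl)) (Initialised.visited≡ ini a))
      (trans (Frame.outs fr refl) (Initialised.written≡ ini)) ,
    pow , pow K ℕ.≤-refl , cong (_+ 1) (sym (ℕ.*-assoc n K (n * K)))
    where
    open Semantics inp (environment n B K 0 0)
    open Verification inp (environment n B K 0 0)
    body = powers ⟦ var 26 ⊞ lit 1 ⟧← 0 ⊠ powers ⟦ var 26 ⟧
    s₁ = run (powers ⟦ lit 0 ⟧← lit 1) s
    s₂ = run (loop 26 2 body) s₁
    fr = frame (loop 26 2 body) s₁
    pow : ∀ i → i ≤ K → arr s₂ powers i ≡ n ^ i
    pow = loop-rule {26} {2} {body} {s₁} (λ k s′ → ∀ i → i ≤ k → arr s′ powers i ≡ n ^ i)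
      (λ { zero _ → [↦]-same (arr s powers) 0 1 })
      λ k s′ _ old i i≤ → case i ℕ.≟ suc (toℕ k) of λ
        { (yes refl) → trans ([↦]-at (arr s′ powers) _ (sym (ℕ.+-comm (toℕ k) 1)))
                             (cong (n *_) (old (toℕ k) ℕ.≤-refl))
        ; (no ne) → trans ([↦]-other (arr s′ powers) _ (λ eq → ne (trans eq (ℕ.+-comm (toℕ k) 1))))
                          (old i (s≤s⁻¹ (ℕ.≤∧≢⇒< i≤ ne))) }

-- Running time and delay

-- Written directly in machine instructions, because compiled code presupposes parameters 0 and 1:
-- this reads n and adds up `1 + n + n * n`, the start of the arrays.
prelude : List Instr
prelude =
  ((cell (scratch 0) ≔ 0) ∷ []) ++
  (load (cell (parameter 0)) (cell (scratch 0)) ∷ []) ++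
  ((cell (parameter 1) ≔ 1) ∷ []) ++
  ((cell (parameter 1) ≔ cell (parameter 1) ⊕ cell (parameter 0)) ∷ []) ++
  copy (scratch 1) (parameter 0) ++
  ((cell (scratch 2) ≔ 1) ∷ []) ++
  addRepeatedly (parameter 1) (parameter 0) (scratch 1) (scratch 2) ∷ []

rounds : ℕ → ℕ → ℕ
rounds n r = n * suc r * (n * suc r) + 1

initialState : State
initialState = state (λ _ → 0) (λ _ _ → 0) []

preludeCost : ℕ → ℕ
preludeCost n = 1 + (1 + (1 + (1 + (2 + (1 + suc (n * 3))))))

module Start {n} (G : Graph n) (c : Capacity n) where

  open Input G c

  exec-prelude : Exec prelude (preludeCost n) (machine (λ _ → 0) inp [])
    (λ σ → Simulation.Sim inp (environment n base 0 0 0) inp-outside σ initialState)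
  exec-prelude =
    exec-≔ (scratch 0) 0 ⟫ λ c₁ →
    exec-load (parameter 0) (scratch 0) {σ = _} (value c₁) ⟫ λ c₂ →
    let n₂ = trans (value c₂) (cong (λ f → f 0) (memory≡ c₁)) in
    exec-≔ (parameter 1) 1 ⟫ λ c₃ →
    let n₃ = trans (others c₃ (parameter 0) (λ ())) n₂ in
    exec-⊕ (parameter 1) (parameter 1) (parameter 0) (value c₃) n₃ ⟫ λ c₄ →
    let n₄ = trans (others c₄ (parameter 0) (λ ())) n₃ in
    exec-copy {scratch 1} {parameter 0} (λ ()) n₄ ⟫ λ c₅ →
    exec-≔ (scratch 2) 1 ⟫ λ c₆ →
    let n₆ = trans (others c₆ (parameter 0) (λ ())) (trans (others c₅ (parameter 0) (λ ())) n₄)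
        chain : ∀ a → a ≢ scratch 0 → a ≢ parameter 0 → a ≢ parameter 1 → a ≢ scratch 1 → a ≢ scratch 2 → _ ≡ 0
        chain a e₀ e₁ e₂ e₃ e₄ = trans (others c₆ a e₄) (trans (others c₅ a e₃) (trans (others c₄ a e₂)
          (trans (others c₃ a e₂) (trans (others c₂ a e₁) (others c₁ a e₀)))))
        mem = trans (memory≡ c₆) (trans (memory≡ c₅) (trans (memory≡ c₄) (trans (memory≡ c₃) (trans (memory≡ c₂) (memory≡ c₁)))))
        buf = trans (buffer≡ c₆) (trans (buffer≡ c₅) (trans (buffer≡ c₄) (trans (buffer≡ c₃) (trans (buffer≡ c₂) (buffer≡ c₁)))))
    in exec-map (λ σ (v , o , m , b) →
         let rest : ∀ p → regs σ (cell (parameter (suc (suc p)))) ≡ 0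
             rest p = trans (o (parameter (suc (suc p))) (λ ()) (λ ())) (chain (parameter (suc (suc p))) (λ ()) (λ ()) (λ ()) (λ ()) (λ ()))
         in Simulation.sim
         (λ x → trans (o (variable′ x) (λ ()) (λ ())) (chain (variable′ x) (λ ()) (λ ()) (λ ()) (λ ()) (λ ())))
         (λ { 0 → trans (o (parameter 0) (λ ()) (λ ())) n₆
            ; 1 → v
            ; 2 → rest 0
            ; 3 → rest 1
            ; 4 → rest 2
            ; (suc (suc (suc (suc (suc p))))) → rest (suc (suc (suc p))) })
         -- Memory beyond the input is 0 at the start. So the exponentially large table `visited` is
         -- clear without any initialisation.
         (λ i a → trans (cong (λ f → f (address base i a)) (trans m mem)) (inp-outside _ (ℕ.m≤n+m base (a * 16 + toℕ i))))
         (λ y _ → cong (λ f → f y) (trans m mem))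
         (trans b buf))
       (exec-addRepeatedly {parameter 1} {parameter 0} {scratch 1} {scratch 2}
         (λ ()) (λ ()) (λ ()) (λ ()) (λ ()) (λ ()) n {1 + n} {n}
         (trans (others c₆ (parameter 1) (λ ())) (trans (others c₅ (parameter 1) (λ ())) (value c₄)))
         n₆
         (trans (others c₆ (scratch 1) (λ ())) (value c₅))
         (value c₆))
    where open Changed

  -- Both environments share `base`, on which the memory layout depends, so writing the register of
  -- `p` is all it takes to pass from one to the other.
  sim-parameter : ∀ {K P R K′ P′ R′ p v σ σ′ s} → p ≢ 1 →
    environment n base K′ P′ R′ p ≡ v →
    (∀ q → q ≢ p → environment n base K′ P′ R′ q ≡ environment n base K P R q) →
    Simulation.Sim inp (environment n base K P R) inp-outside σ s → Changed (parameter p) v σ σ′ →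
    Simulation.Sim inp (environment n base K′ P′ R′) inp-outside σ′ s
  sim-parameter {p = p} p≢1 new old h (changed val o m b) = Simulation.sim
    (λ x → trans (o (variable′ x) (λ ())) (variables x))
    (λ q → case q ℕ.≟ p of λ
      { (yes refl) → trans val (sym new)
      ; (no q≢p)   → trans (o (parameter q) (λ { refl → q≢p refl })) (trans (parameters q) (sym (old q q≢p))) })
    (λ i a → trans (cong (λ f → f (address base i a)) m) (arrays i a))
    (λ y lt → trans (cong (λ f → f y) m) (inputs y lt))
    (trans b outputs)
    where open Simulation.Sim h

-- The complete program and its outputs

module Solver (jobₑ okₑ : Expr) where

  open Programs jobₑ okₑ using (advance-search; start-search)

  setup afterPrelude afterSlots afterK afterPowers afterP : List Instr
  setup        = prelude ++ afterPrelude
  afterPrelude = compile computeSlots 0 ++ afterSlots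
  afterSlots   = copy (parameter 2) (variable′ 33) ++ afterK
  afterK       = compile computePowers 0 ++ afterPowers
  afterPowers  = copy (parameter 3) (variable′ 34) ++ afterP
  afterP       = copy (parameter 4) (variable′ 35) ++ compile start-search 0

  mainLoop : Instr
  mainLoop = while (cell (variable′ 0)) (compile dequeue 0 ++ emit ∷ compile advance-search 0)

  program : Program
  program = setup ++ mainLoop ∷ []

  -- One bound for both kinds of interval, the setup followed by the first output and a full pass of
  -- the main loop, so all parts are added. The prelude takes 8 + n * 3 steps, copying three
  -- parameters takes 6, and the loop test and `emit` take 2.
  totalGrade : Grade
  totalGrade =
    (constᵍ 8 ⊕ᵍ parameterGrade 0 ⊗ᵍ constᵍ 3) ⊕ᵍ
    (grade computeSlots ⊕ᵍ (grade computePowers ⊕ᵍ (constᵍ 6 ⊕ᵍ (grade start-search ⊕ᵍ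
    (constᵍ 2 ⊕ᵍ (grade dequeue ⊕ᵍ grade advance-search))))))

  module _ {n} (G : Graph n) (c : Capacity n) (r : ℕ) (A : AssignmentProblem n (suc r))
    (job-spec : ∀ B P R s (u v : Fin n) → reg s 1 ≡ toℕ u → reg s 2 ≡ toℕ v →
      Decides (Semantics.eval (Input.inp G c) (environment n B (suc r) P R) jobₑ s) (AssignmentProblem.Job A u v))
    (ok-spec : ∀ B P R s (u v w : Fin n) (i : Fin (suc r)) → reg s 7 ≡ toℕ u → reg s 8 ≡ toℕ v →
      reg s 3 ≡ toℕ w → reg s 4 ≡ toℕ i →
      Decides (Semantics.eval (Input.inp G c) (environment n B (suc r) P R) okₑ s) (AssignmentProblem.Ok A u v w i))
    where

    open Input G c
    open Start G c
    open AssignmentProblem A using (Feasible)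

    rounds-enough : n * suc r * (n * suc r) < rounds n r
    rounds-enough = ℕ.≤-reflexive (ℕ.+-comm 1 _)

    open Search A inp base (rounds n r) jobₑ okₑ rounds-enough
      (job-spec base (n ^ suc r) (rounds n r)) (ok-spec base (n ^ suc r) (rounds n r))

    module Sim₁ = Simulation inp (environment n base 0 0 0) inp-outside
    module Sim₂ = Simulation inp (environment n base (suc r) 0 0) inp-outside
    open Simulation inp (environment n base (suc r) (n ^ suc r) (rounds n r)) inp-outside
    open Semantics inp (environment n base (suc r) (n ^ suc r) (rounds n r))
    open Verification inp (environment n base (suc r) (n ^ suc r) (rounds n r))

    setupCost loopCost : ℕ
    setupCost = preludeCost n + (Sim₁.cost computeSlots + (2 + (Sim₂.cost computePowers + (2 + (2 + cost start-search)))))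
    loopCost = suc (cost dequeue + 1)

    record Ready (σ : Machine) (front rest : List (Subset n)) : Set where
      constructor ready
      field
        {current-state} : State
        simulated  : Sim σ current-state
        progressed : Progress current-state front rest
        pending    : Pending current-state rest
        written≡   : written current-state ≡ []

    exec-setup : reg (Semantics.run inp (environment n base 0 0 0) computeSlots initialState) 33 ≡ suc r →
      Exec setup setupCost (machine (λ _ → 0) inp []) (λ σ → ∃[ rest ] Ready σ [] rest)
    exec-setup r33 =
      _⟫_ {prelude} {afterPrelude} exec-prelude λ h₀ →
      _⟫_ {compile computeSlots 0} {afterSlots} (Sim₁.exec-compile computeSlots 0 h₀) λ (h₁ , _) →
      _⟫_ {copy (parameter 2) (variable′ 33)} {afterK}
        (exec-copy {parameter 2} {variable′ 33} (λ ()) (trans (Simulation.Sim.variables h₁ 33) r33)) λ c₂ →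
      let h₂ = sim-parameter {K′ = suc r} (λ ()) refl
                 (λ { 0 _ → refl ; 1 _ → refl ; 2 ne → contradiction refl ne ; 3 _ → refl ; 4 _ → refl
                    ; (suc (suc (suc (suc (suc _))))) _ → refl }) h₁ c₂ in
      _⟫_ {compile computePowers 0} {afterPowers} (Sim₂.exec-compile computePowers 0 h₂) λ (h₃ , _) →
      _⟫_ {copy (parameter 3) (variable′ 34)} {afterP}
        (exec-copy {parameter 3} {variable′ 34} (λ ()) (trans (Simulation.Sim.variables h₃ 34) r34)) λ c₄ →
      let h₄ = sim-parameter {K′ = suc r} {P′ = n ^ suc r} (λ ()) refl
                 (λ { 0 _ → refl ; 1 _ → refl ; 2 _ → refl ; 3 ne → contradiction refl ne ; 4 _ → refl
                    ; (suc (suc (suc (suc (suc _))))) _ → refl }) h₃ c₄ in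
      _⟫_ {copy (parameter 4) (variable′ 35)} {compile start-search 0}
        (exec-copy {parameter 4} {variable′ 35} (λ ()) (trans (Simulation.Sim.variables h₄ 35) r35)) λ c₅ →
      let h₅ = sim-parameter {K′ = suc r} {P′ = n ^ suc r} {R′ = rounds n r} (λ ()) refl
                 (λ { 0 _ → refl ; 1 _ → refl ; 2 _ → refl ; 3 _ → refl ; 4 ne → contradiction refl ne
                    ; (suc (suc (suc (suc (suc _))))) _ → refl }) h₄ c₅ in
      exec-map (λ σ (h₆ , _) → proj₁ started ,
          ready h₆ (proj₁ (proj₂ started)) (proj₂ (proj₂ started))
            (trans (Frame.outs (frame start-search s₂) refl) (Initialised.written≡ ini₂)))
        (exec-compile start-search 0 h₅)
      where
      s₁ = Semantics.run inp (environment n base 0 0 0) computeSlots initialState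
      s₂ = Semantics.run inp (environment n base (suc r) 0 0) computePowers s₁
      ini₁ : Initialised s₁
      ini₁ = proj₁ (Preparation.computeSlots-correct G c base initialState (initialised refl refl (λ _ → refl) refl))
      prepared = Preparation.computePowers-correct G c base (suc r) s₁ ini₁
      ini₂ : Initialised s₂
      ini₂ = proj₁ prepared
      r34 : reg s₂ 34 ≡ n ^ suc r
      r34 = proj₁ (proj₂ (proj₂ prepared))
      r35 : reg s₂ 35 ≡ rounds n r
      r35 = proj₂ (proj₂ (proj₂ prepared))
      started = start-correct s₂ (proj₁ (proj₂ prepared)) (Initialised.reg18 ini₂) (Initialised.reg19 ini₂) (Initialised.visited≡ ini₂)

    clearOutput : State → State
    clearOutput s = state (reg s) (arr s) []

    module MainLoop (deq adv : Cmd)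
      (deq-correct : ∀ s X front rest → Progress s front (X ∷ rest) → written s ≡ [] →
         Progress (run deq s) front (X ∷ rest) × Represents (arr (run deq s) current) X ×
         written (run deq s) ≡ encodeSubset X)
      (adv-correct : ∀ s X front rest → Progress s front (X ∷ rest) → Represents (arr s current) X →
         ∃[ new ] Progress (run adv s) (front ++ [ X ]) (rest ++ new) × Pending (run adv s) (rest ++ new))
      (adv-silent : writesOut adv ≡ false)
      (D : ℕ) (adv-fits : cost adv + suc (cost deq + 1) ≤ D) where

      iteration : Instr
      iteration = while (cell (variable′ 0)) (compile deq 0 ++ emit ∷ compile adv 0)

      -- `κ` is the configuration just after the previous output and `t` the time spent since.
      -- Carrying this path along charges the processing of one solution and the printing of the
      -- next to the same interval.
      emits-loop : ∀ fuel {σ front rest} → 2 ^ n ≤ length front + fuel → Ready σ front rest →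
        ∃[ later ] (∃[ s ] Progress s (front ++ later) []) ×
          (∀ {κ t} → κ ⟶⟨ t ⟩ config (iteration ∷ []) σ → t + suc (cost deq + 1) ≤ D →
             Emits D κ (map encodeSubset later))
      emits-loop fuel {σ} {front} {[]} bound (ready {s} h p pend w) =
        [] , (s , subst (λ L → Progress s L []) (sym (List.++-identityʳ front)) p) ,
        λ {κ} {t} path fits → stop
          (path ▷ more (while-zero (trans (Sim.variables h 0) pend)) done) refl
          (ℕ.≤-trans (ℕ.+-monoʳ-≤ t (s≤s z≤n)) fits)
      emits-loop zero {σ} {front} {X ∷ rest} bound (ready h p pend w) =
        -- Fuel runs out only when `front` has `2 ^ n` entries; a further `X` would make too many
        -- distinct subsets.
        contradiction (unique-length (Store.unique (Progress.stored p)))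
          (ℕ.<⇒≱ (ℕ.≤-trans (s≤s bound) (ℕ.≤-trans
            (ℕ.≤-reflexive (trans (cong suc (ℕ.+-identityʳ (length front))) (ℕ.+-comm 1 (length front))))
            (ℕ.≤-trans (ℕ.+-monoʳ-≤ (length front) (s≤s z≤n)) (ℕ.≤-reflexive (sym (List.length-++ front)))))))
      emits-loop (suc fuel) {σ} {front} {X ∷ rest} bound (ready {s} h p pend w) =
        let exec {t₁} t₁≤ {σ₁} steps₁ (h₁ , _) = exec-compile deq 0 h
            p₁ , rep , out≡ = deq-correct s X front rest p w
            s₁ = clearOutput (run deq s)
            h₁′ : Sim (machine (regs σ₁) (memory σ₁) []) s₁
            h₁′ = sim (Sim.variables h₁) (Sim.parameters h₁) (Sim.arrays h₁) (Sim.inputs h₁) refl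
            exec {t₂} t₂≤ {σ₂} steps₂ (h₂ , _) = exec-compile adv 0 h₁′
            new , p₂ , pend₂ = adv-correct s₁ X front rest (restart p₁) rep
            later , (s′ , p′) , emits = emits-loop fuel {σ₂} {front ++ [ X ]} {rest ++ new}
              (ℕ.≤-trans bound (ℕ.≤-reflexive (trans (ℕ.+-suc (length front) fuel)
                (trans (cong (_+ fuel) (ℕ.+-comm 1 (length front))) (cong (_+ fuel) (sym (List.length-++ front)))))))
              (ready h₂ p₂ pend₂ (Frame.outs (frame adv s₁) adv-silent))
        in X ∷ later , (s′ , subst (λ L → Progress s′ L []) (List.++-assoc front [ X ] later) p′) ,
           λ {κ} {t} path fits → next
             (path ▷ more (while-suc (trans (Sim.variables h 0) pend))
               (subst (λ k → config k σ ⟶⟨ t₁ ⟩ config (emit ∷ compile adv 0 ++ iteration ∷ []) σ₁)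
                 (sym (List.++-assoc (compile deq 0) (emit ∷ compile adv 0) (iteration ∷ [])))
                 (steps₁ (emit ∷ compile adv 0 ++ iteration ∷ []))))
             (cong (λ b → emitted b (config (compile adv 0 ++ iteration ∷ []) (machine (regs σ₁) (memory σ₁) [])))
               (trans (Sim.outputs h₁) out≡))
             (ℕ.≤-trans (ℕ.≤-reflexive (sym (ℕ.+-suc t (suc t₁))))
               (ℕ.≤-trans (ℕ.+-monoʳ-≤ t (s≤s (ℕ.≤-trans (s≤s t₁≤) (ℕ.≤-reflexive (ℕ.+-comm 1 _))))) fits))
             (emits (steps₂ (iteration ∷ [])) (ℕ.≤-trans (ℕ.+-monoˡ-≤ _ t₂≤) adv-fits))
        where
        restart : ∀ {s} → Progress s front (X ∷ rest) → Progress (clearOutput s) front (X ∷ rest)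
        restart {s} (progress st hd pow ex ne) = progress (store-frame {s} {clearOutput s} refl refl refl st) hd pow ex ne

    enumerates : ∀ D → reg (Semantics.run inp (environment n base 0 0 0) computeSlots initialState) 33 ≡ suc r →
      setupCost + loopCost ≤ D → cost advance-search + loopCost ≤ D →
      ∃[ solutions ] Unique solutions × (∀ S → S List.∈ solutions ⇔ Minimal Feasible S)
                   × Emits D (initial program (encodeInput G c)) (map encodeSubset solutions)
    enumerates D r33 fits fits′ = after-setup (exec-setup r33)
      where
      after-setup : Exec setup setupCost (machine (λ _ → 0) inp []) (λ σ → ∃[ rest ] Ready σ [] rest) → _
      after-setup (exec {t} t≤ {σ} steps (rest , rdy)) = after-loop
        (MainLoop.emits-loop dequeue advance-search dequeue-correct advance-correct refl D fits′
          (2 ^ n) {σ} {[]} {rest} ℕ.≤-refl rdy)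
        where
        after-loop : (∃[ later ] (∃[ s ] Progress s later []) ×
          (∀ {κ t} → κ ⟶⟨ t ⟩ config (mainLoop ∷ []) σ → t + loopCost ≤ D → Emits D κ (map encodeSubset later))) → _
        after-loop (later , (s , p) , emits) =
          let u , e = complete p
          in later , u , e , emits {config (setup ++ mainLoop ∷ []) (machine (λ _ → 0) inp [])} {t}
                               (steps (mainLoop ∷ [])) (ℕ.≤-trans (ℕ.+-monoˡ-≤ loopCost t≤) fits)

-- The delay bound

module Delay (jobₑ okₑ : Expr) where

  open Solver jobₑ okₑ using (program; totalGrade; setupCost; loopCost; enumerates)
  open Programs jobₑ okₑ using (advance-search; start-search)

  degree≤ : ∀ {n} (G : Graph n) → maxDegree G ≤ n
  degree≤ {n} G = Extrema.max≤v⁺ {xs = map (degree G) (allFin n)} z≤n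
    (All.tabulate λ x∈ → let u , _ , eq = List.∈-map⁻ (degree G) x∈ in
      subst (_≤ n) (sym eq) (Subset.∣p∣≤n (tabulate (adj G u))))

  module Bounds {n} (G : Graph n) (c : Capacity n) (r : ℕ) (r≤n : r ≤ n) where

    open Input G c

    b : ℕ
    b = n ⊔ 2

    2≤b : 2 ≤ b
    2≤b = ℕ.m≤n⊔m n 2

    module G₁ = Growth inp (environment n base 0 0 0) inp-outside b r 2≤b
    module G₂ = Growth inp (environment n base (suc r) 0 0) inp-outside b r 2≤b
    module G₃ = Growth inp (environment n base (suc r) (n ^ suc r) (rounds n r)) inp-outside b r 2≤b

    n≤ : n ≤ b ^ 1
    n≤ = ℕ.≤-trans (ℕ.m≤m⊔n n 2) (ℕ.≤-reflexive (sym (ℕ.^-identityʳ b)))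

    square : ∀ {x} k → x ≤ b ^ k → x * x ≤ b ^ (k + k)
    square k le = ℕ.≤-trans (ℕ.*-mono-≤ le le) (ℕ.≤-reflexive (sym (ℕ.^-distribˡ-+-* b k k)))

    -- The exponent 7 of `parameterGrade` comes from the rounds: r ≤ n gives `r + 1 ≤ b ^ 2`, so
    -- `n * (r + 1) ≤ b ^ 3`, squaring gives 6, and adding one costs one more.
    environment-bounded : ∀ {K P R} → K ≤ suc r → P ≤ n ^ suc r → R ≤ rounds n r →
      ∀ p → G₁.Bounded (environment n base K P R p) (parameterGrade p)
    environment-bounded {K} {P} {R} K≤ P≤ R≤ = λ
      { 0 → ℕ.≤-trans n≤ (mono {1} {7} (s≤s z≤n))
      ; 1 → ℕ.≤-trans base≤ (mono (ℕ.m≤m+n 5 2))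
      ; 2 → ℕ.≤-trans (ℕ.≤-trans K≤ sucr≤) (mono (ℕ.m≤m+n 2 5))
      ; 3 → ℕ.≤-trans P≤ (ℕ.≤-trans (ℕ.^-monoˡ-≤ (suc r) (ℕ.m≤m⊔n n 2))
              (mono (ℕ.≤-trans (s≤s (ℕ.m≤n+m r 6)) (ℕ.≤-reflexive (cong (7 +_) (sym (ℕ.+-identityʳ r)))))))
      ; 4 → ℕ.≤-trans R≤ (ℕ.≤-trans rounds≤ (mono {7} {7} ℕ.≤-refl))
      ; (suc (suc (suc (suc (suc _))))) → z≤n }
      where
      mono : ∀ {x y} → x ≤ y → b ^ x ≤ b ^ y
      mono = G₁.b^-mono
      suc≤ : ∀ {x} → x ≤ n → suc x ≤ b ^ 2
      suc≤ le = G₁.b^-+ {1} 0 1 (s≤s z≤n) (ℕ.≤-trans le n≤)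
      sucr≤ : suc r ≤ b ^ 2
      sucr≤ = suc≤ r≤n
      base≤ : base ≤ b ^ 5
      base≤ = G₁.b^-+ 2 2 (suc≤ ℕ.≤-refl) (square 1 n≤)
      slots≤ : n * suc r ≤ b ^ 3
      slots≤ = ℕ.≤-trans (ℕ.*-mono-≤ n≤ sucr≤) (ℕ.≤-reflexive (sym (ℕ.^-distribˡ-+-* b 1 2)))
      rounds≤ : rounds n r ≤ b ^ 7
      rounds≤ = G₁.b^-+ 6 0 (square 3 slots≤) (s≤s z≤n)

    -- The coefficient of `r` is a premise because `jobₑ` and `okₑ` are variables here, so that the
    -- grade does not compute.
    total≤ : (A : AssignmentProblem n (suc r)) → ∀ job-spec ok-spec → proj₂ totalGrade ≡ 1 →
      setupCost G c r A job-spec ok-spec + loopCost G c r A job-spec ok-spec +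
        Simulation.cost inp (environment n base (suc r) (n ^ suc r) (rounds n r)) inp-outside advance-search
      ≤ b ^ (r + proj₁ totalGrade)
    total≤ A job-spec ok-spec d≡1 = begin
      setupCost G c r A job-spec ok-spec + loopCost G c r A job-spec ok-spec + C₃.cost advance-search
        ≡⟨ regroup (preludeCost n) (C₁.cost computeSlots) (C₂.cost computePowers) (C₃.cost start-search)
             (C₃.cost dequeue) (C₃.cost advance-search) ⟩
      preludeCost n + (C₁.cost computeSlots + (C₂.cost computePowers + (6 + (C₃.cost start-search +
        (2 + (C₃.cost dequeue + C₃.cost advance-search))))))
        ≤⟨ bounded ⟩
      b ^ (proj₁ totalGrade + proj₂ totalGrade * r)
        ≡⟨ collapse (proj₁ totalGrade) (proj₂ totalGrade) d≡1 ⟩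
      b ^ (r + proj₁ totalGrade) ∎
      where
      open ℕ.≤-Reasoning
      module C₁ = Simulation inp (environment n base 0 0 0) inp-outside
      module C₂ = Simulation inp (environment n base (suc r) 0 0) inp-outside
      module C₃ = Simulation inp (environment n base (suc r) (n ^ suc r) (rounds n r)) inp-outside
      collapse : ∀ k d → d ≡ 1 → b ^ (k + d * r) ≡ b ^ (r + k)
      collapse k d refl = cong (b ^_) (trans (cong (k +_) (ℕ.+-identityʳ r)) (ℕ.+-comm k r))
      regroup : ∀ p s w t q a → p + (s + (2 + (w + (2 + (2 + t))))) + suc (q + 1) + a ≡
                                p + (s + (w + (6 + (t + (2 + (q + a))))))
      regroup = solve 6 (λ p s w t q a →
        p :+ (s :+ (con 2 :+ (w :+ (con 2 :+ (con 2 :+ t))))) :+ (con 1 :+ (q :+ con 1)) :+ a :=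
        p :+ (s :+ (w :+ (con 6 :+ (t :+ (con 2 :+ (q :+ a))))))) refl
        where open +-*-Solver
      e₁ = environment-bounded {0} {0} {0} z≤n z≤n z≤n
      e₂ = environment-bounded {suc r} {0} {0} ℕ.≤-refl z≤n z≤n
      e₃ = environment-bounded {suc r} ℕ.≤-refl ℕ.≤-refl ℕ.≤-refl
      bounded : preludeCost n + (C₁.cost computeSlots + (C₂.cost computePowers + (6 + (C₃.cost start-search +
        (2 + (C₃.cost dequeue + C₃.cost advance-search)))))) ≤ b ^ (proj₁ totalGrade + proj₂ totalGrade * r)
      bounded =
        G₁.bounded-+ (constᵍ 8 ⊕ᵍ parameterGrade 0 ⊗ᵍ constᵍ 3) g₁
          (G₁.bounded-+ (constᵍ 8) (parameterGrade 0 ⊗ᵍ constᵍ 3) (G₁.bounded-const 8)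
            (G₁.bounded-* (parameterGrade 0) (constᵍ 3) (e₁ 0) (G₁.bounded-const 3)))
        (G₁.bounded-+ (grade computeSlots) g₂ (G₁.cost-bounded e₁ computeSlots)
        (G₁.bounded-+ (grade computePowers) g₃ (G₂.cost-bounded e₂ computePowers)
        (G₁.bounded-+ (constᵍ 6) g₄ (G₁.bounded-const 6)
        (G₁.bounded-+ (grade start-search) g₅ (G₃.cost-bounded e₃ start-search)
        (G₁.bounded-+ (constᵍ 2) g₆ (G₁.bounded-const 2)
        (G₁.bounded-+ (grade dequeue) (grade advance-search)
          (G₃.cost-bounded e₃ dequeue) (G₃.cost-bounded e₃ advance-search)))))))
        where
        g₆ = grade dequeue ⊕ᵍ grade advance-search
        g₅ = constᵍ 2 ⊕ᵍ g₆
        g₄ = grade start-search ⊕ᵍ g₅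
        g₃ = constᵍ 6 ⊕ᵍ g₄
        g₂ = grade computePowers ⊕ᵍ g₃
        g₁ = grade computeSlots ⊕ᵍ g₂

  enumerates-with-delay : (Cover : EnumerationProblem)
    (A : ∀ {n} → Graph n → Capacity n → (K : ℕ) → AssignmentProblem n K) →
    JobSpec A jobₑ → OkSpec A okₑ →
    (∀ {n} (G : Graph n) (c : Capacity n) r → SlotsSuffice G c r → ∀ {S} →
       Cover G c S → AssignmentProblem.Feasible (A G c (suc r)) S) →
    (∀ {n} (G : Graph n) (c : Capacity n) r → SlotsSuffice G c r → ∀ {S} →
       AssignmentProblem.Feasible (A G c (suc r)) S → Cover G c S) →
    proj₂ totalGrade ≡ 1 →
    EnumeratesWithDelay program (λ G c → Minimal (Cover G c)) (delayBound (proj₁ totalGrade))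
  enumerates-with-delay Cover A job-spec ok-spec to from d≡1 {n} G c =
    let _ , r , r33 , r≤ , suffices = Preparation.computeSlots-correct G c (Input.base G c) initialState
          (initialised refl refl (λ _ → refl) refl)
    in result r r33 r≤ suffices
    where
    D = delayBound (proj₁ totalGrade) G c
    result : ∀ r → reg (Semantics.run (Input.inp G c) (environment n (Input.base G c) 0 0 0) computeSlots initialState) 33 ≡ suc r →
      r ≤ maxCapacity c ⊓ maxDegree G → SlotsSuffice G c r →
      ∃[ solutions ] Unique solutions × (∀ S → S List.∈ solutions ⇔ Minimal (Cover G c) S)
                   × Emits D (initial program (encodeInput G c)) (map encodeSubset solutions)
    result r r33 r≤ suffices =
      let setup-fits , advance-fits = split {setupCost G c r (A G c (suc r)) js os} {loopCost G c r (A G c (suc r)) js os}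
            {Simulation.cost (Input.inp G c) (environment n (Input.base G c) (suc r) (n ^ suc r) (rounds n r)) (Input.inp-outside G c) advance-search} fits
          L , u , e , emits = enumerates G c r (A G c (suc r)) js os D r33 setup-fits advance-fits
      in L , u , (λ S → mk⇔ (transfer (from G c r suffices) (to G c r suffices) ∘ Equivalence.to (e S))
                            (Equivalence.from (e S) ∘ transfer (to G c r suffices) (from G c r suffices)))
       , emits
      where
      js = λ B P R → job-spec G c B (suc r) P R
      os = λ B P R → ok-spec G c B (suc r) P R
      r≤n : r ≤ n
      r≤n = ℕ.≤-trans r≤ (ℕ.≤-trans (ℕ.m⊓n≤n (maxCapacity c) (maxDegree G)) (degree≤ G))
      split : ∀ {a b c D} → a + b + c ≤ D → a + b ≤ D × c + b ≤ D
      split {a} {b} {c} le = ℕ.≤-trans (ℕ.m≤m+n (a + b) c) le ,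
        ℕ.≤-trans (ℕ.≤-trans (ℕ.≤-reflexive (ℕ.+-comm c b)) (ℕ.+-monoˡ-≤ c (ℕ.m≤n+m b a))) le
      fits : setupCost G c r (A G c (suc r)) js os + loopCost G c r (A G c (suc r)) js os +
        Simulation.cost (Input.inp G c) (environment n (Input.base G c) (suc r) (n ^ suc r) (rounds n r)) (Input.inp-outside G c) advance-search ≤ D
      fits = ℕ.≤-trans (Bounds.total≤ G c r r≤n (A G c (suc r)) js os d≡1)
        (ℕ.^-monoʳ-≤ (n ⊔ 2) {{>-nonZero (ℕ.≤-trans (s≤s z≤n) (ℕ.m≤n⊔m n 2))}} (ℕ.+-monoˡ-≤ (proj₁ totalGrade) r≤))
      transfer : ∀ {P Q : Subset n → Set} {S} → (∀ {S} → P S → Q S) → (∀ {S} → Q S → P S) → Minimal P S → Minimal Q S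
      transfer f g (p , m) = f p , λ S′ sub q → m S′ sub (g q)

theorem9 : (∃[ p ] ∃[ k ] EnumeratesWithDelay p MinimalCapacitatedVertexCover (delayBound k)) ×
    (∃[ p ] ∃[ k ] EnumeratesWithDelay p MinimalCapacitatedDominatingSet (delayBound k))
theorem9 =
  (Solver.program coverJobₑ coverOkₑ , proj₁ (Solver.totalGrade coverJobₑ coverOkₑ) ,
   Delay.enumerates-with-delay coverJobₑ coverOkₑ IsCapacitatedVertexCover vertexCoverProblem
     -- `refl` evaluates the grade of the concrete program and finds the coefficient 1 of `r`.
     coverJob-spec coverOk-spec VertexCover.to VertexCover.from refl) ,
  (Solver.program dominationJobₑ dominationOkₑ , proj₁ (Solver.totalGrade dominationJobₑ dominationOkₑ) ,
   Delay.enumerates-with-delay dominationJobₑ dominationOkₑ IsCapacitatedDominatingSet dominatingSetProblem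
     dominationJob-spec dominationOk-spec DominatingSet.to DominatingSet.from refl)
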